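{- For each integer $t\ge 2$, every red-blue $K_n$ has at most $\frac{1}{t}\left(\frac{n}{2}\right)^{2t}+O(n^{2t-1})$ alternating $2t$-cycles (the implied constant depending only on $t$). Furthermore, for every integer $t\ge1$ there exists $n_0$ such that for all $n\ge n_0$, every red-blue copy $G$ of $K_n$ has at most $\frac{1}{2t}\left(\lceil\frac{n}{2}\rceil\right)_{2t}\left(\lfloor\frac{n}{2}\rfloor\right)_{2t}$ alternating $4t$-cycles, and this bound is achieved if and only if the edges of one colour of $G$ form a complete bipartite graph $K_{\lfloor n/2\rfloor,\lceil n/2\rceil}$ spanning all $n$ vertices.
   Context: A red-blue $K_n$ is a complete graph on $n$ vertices each of whose edges is coloured red or blue. An alternating cycle of length $m$ (alternating $m$-cycle) is a cycle with $m$ edges, counted as a subgraph, in which each vertex is incident with exactly one red and one blue edge of the cycle. For integers $a,k$, $(a)_k=a(a-1)\cdots(a-k+1)$ denotes the falling factorial. -}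

module Defs where

open import Data.Nat using (ℕ; zero; suc; _+_; _*_; _∸_; _/_; _≤_; _≡ᵇ_)
open import Data.Bool using (Bool; true; false; _∧_; _xor_; not; if_then_else_)
open import Data.Fin using (Fin)
open import Data.Fin.Properties using () renaming (_≟_ to _≟ᶠ_)
open import Data.List using (List; []; _∷_; _++_; [_]; map; concatMap; length; filterᵇ; zipWith)
open import Data.Bool.ListAction using (and; any)
open import Data.List.Base using (allFin)
open import Data.Product using (Σ; _×_; ∃)
open import Relation.Binary.PropositionalEquality using (_≡_; _≢_)
open import Relation.Nullary.Decidable using (⌊_⌋)

-- A red-blue K_n: a symmetric colouring of the pairs of distinct vertices
-- (true = red, false = blue).  The value on the diagonal is never used.
record RedBlueK (n : ℕ) : Set where
  field
    colour : Fin n → Fin n → Bool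
    symmetric : ∀ i j → colour i j ≡ colour j i
open RedBlueK public

fall : ℕ → ℕ → ℕ
fall a zero = 1
fall a (suc k) = a * fall (a ∸ 1) k

allSeqs : (n m : ℕ) → List (List (Fin n))
allSeqs n zero = [] ∷ []
allSeqs n (suc m) = concatMap (λ x → map (x ∷_) (allSeqs n m)) (allFin n)

rotate : {A : Set} → List A → List A
rotate [] = []
rotate (x ∷ xs) = xs ++ [ x ]

distinctᵇ : {n : ℕ} → List (Fin n) → Bool
distinctᵇ [] = true
distinctᵇ (x ∷ xs) = not (any (λ y → ⌊ x ≟ᶠ y ⌋) xs) ∧ distinctᵇ xs

edgeColours : {n : ℕ} → RedBlueK n → List (Fin n) → List Bool
edgeColours G vs = zipWith (colour G) vs (rotate vs)

alternatingᵇ : List Bool → Bool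
alternatingᵇ cs = and (zipWith _xor_ cs (rotate cs))

isAltSeqᵇ : {n : ℕ} → RedBlueK n → List (Fin n) → Bool
isAltSeqᵇ G vs = distinctᵇ vs ∧ alternatingᵇ (edgeColours G vs)

-- number of such sequences (each alternating m-cycle, m ≥ 4, arises from
-- exactly 2m of them: m starting points × 2 directions)
altSeqCount : {n : ℕ} → RedBlueK n → ℕ → ℕ
altSeqCount {n} G m = length (filterᵇ (isAltSeqᵇ G) (allSeqs n m))

altCycles : {n : ℕ} → RedBlueK n → ℕ → ℕ
altCycles G zero = 0
altCycles G (suc k) = altSeqCount G (suc k) / (2 * suc k)

size : {n : ℕ} → (Fin n → Bool) → ℕ
size {n} S = length (filterᵇ S (allFin n))

colourClassIsBalancedCompleteBipartite : {n : ℕ} → RedBlueK n → Bool → Set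
colourClassIsBalancedCompleteBipartite {n} G b =
  Σ (Fin n → Bool) λ S →
    (size S ≡ n / 2) ×
    (∀ i j → i ≢ j → (colour G i j ≡ b → S i ≢ S j) × (S i ≢ S j → colour G i j ≡ b))

{-# OPTIONS --safe #-}
module Submission where

-- Let r and b denote red and blue degrees, so r + b = n and rb ≤ n²/4 at every vertex.  Cut a
-- closed alternating walk at an edge and at the vertex opposite to it, and apply Cauchy–Schwarz
-- along both halves with the weights r and b: there are at most 2 (n/2)^2t closed alternating
-- walks with 2t edges and given starting colour, which is the first part.
--
-- If a colouring has as many alternating 4t-cycles as claimed, then little is lost in
-- Cauchy–Schwarz.  This forces some vertex u to lie on only O(n²) four-cycles with an odd number
-- of red edges, and then the colouring differs in only O(n) pairs from a template, that is, from
-- a colouring in which one colour class is complete bipartite with nearly equal parts.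
--
-- Now recolour all edges at a vertex of maximal bad degree d according to the template.  By
-- parity a cycle cannot contain exactly one bad edge.  Cycles destroyed by the recolouring
-- contain either exactly two bad edges, both at this vertex, or another bad edge as well; the
-- former are outnumbered by the new cycles, by order d n^(4t-2), and the latter are of smaller
-- order.  So the number of cycles increases strictly until the template is reached, and a
-- template with parts x and y has exactly 2 (x)_2t (y)_2t closed sequences for each starting
-- colour.

open import Defs
open import Data.Nat.Base
open import Data.Nat.Properties
open import Data.Nat.DivMod using (m*n/n≡m; m/n*n≤m; +-distrib-/-∣ʳ)
open import Data.Nat.Divisibility using (_∣_; divides; ∣m∣n⇒∣m+n; m∣m*n; n∣m*n; _∣0; ∣m⇒∣m*n)
open import Data.Nat.Tactic.RingSolver using (solve-∀)
import Algebra.Properties.Semiring.Sum +-*-semiring as Sum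
open import Data.Bool.Base using (T; Bool; true; false; not; _∧_; _∨_; _xor_; if_then_else_)
open import Data.Bool.Properties using (not-involutive; ∧-assoc; ∧-comm; ∧-zeroʳ; ∧-identityʳ)
open import Data.Bool.ListAction using (and; any)
open import Data.Fin.Base using (Fin; zero; suc)
open import Data.Fin.Properties using () renaming (_≟_ to _≟ᶠ_)
open import Data.List.Base using (List; []; _∷_; _++_; [_]; map; concatMap; length; filterᵇ; zipWith; take; tabulate)
open import Data.List.Properties using (++-identityʳ; length-++; filter-++)
open import Data.List.Relation.Unary.All using (All; []; _∷_)
open import Data.Product using (Σ; _×_; _,_; proj₁; proj₂; ∃)
open import Data.Sum.Base using (_⊎_; inj₁; inj₂; [_,_]′)
open import Data.Empty using (⊥-elim)
open import Data.Unit.Base using (tt)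
open import Function.Base using (_∘_; case_of_)
open import Function.Bundles using (_⇔_; mk⇔)
open import Relation.Binary.PropositionalEquality using (_≡_; _≢_; refl; sym; trans; cong; cong₂; subst; subst₂; module ≡-Reasoning)
open import Relation.Nullary using (¬_; Dec; yes; no)
open import Relation.Nullary.Decidable using (⌊_⌋; isYes≗does; dec-true; dec-false)

-- Closed walks overcount cycles by order `n^(4t-1)`, through repeated vertices and loops on the
-- diagonal, and the falling factorials in the claimed maximum fall short of the corresponding
-- powers by the same order. The walk estimates therefore fix the colouring only up to `O(n)` pairs.
-- Exactness has to come from the recolouring, where gain and error are both measured against the
-- bad degree `d` of one vertex, however small it is.
--
-- The weights are essential: a plain Cauchy-Schwarz step would cost a product of degrees in the
-- same colour at two different vertices, and this can exceed `n²/4`.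
--
-- Length `4t` enters through parity. A closed walk crosses a bipartition an even number of times,
-- and in a template an alternating cycle crosses it on exactly the edges of one colour, so half of
-- its length must be even.
--
-- Cycles are counted as vertex sequences with a prescribed first colour. Rotation by one place
-- exchanges the two colours, so both counts agree. Bounds on one of them suffice.

private variable
  n : ℕ

-- Finite sums

opaque
  ∑ : (Fin n → ℕ) → ℕ
  ∑ = Sum.sum

  ∑-cong : {f g : Fin n → ℕ} → (∀ i → f i ≡ g i) → ∑ f ≡ ∑ g
  ∑-cong = Sum.sum-cong-≗

  ∑-distrib-+ : (f g : Fin n → ℕ) → ∑ (λ i → f i + g i) ≡ ∑ f + ∑ g
  ∑-distrib-+ = Sum.∑-distrib-+

  ∑-comm : ∀ {m n} (f : Fin m → Fin n → ℕ) → ∑ (λ i → ∑ (f i)) ≡ ∑ (λ j → ∑ λ i → f i j)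
  ∑-comm = Sum.∑-comm

  ∑-*ˡ : ∀ k (f : Fin n → ℕ) → ∑ (λ i → k * f i) ≡ k * ∑ f
  ∑-*ˡ k f = sym (Sum.*-distribˡ-sum k f)

  ∑-*ʳ : ∀ k (f : Fin n → ℕ) → ∑ (λ i → f i * k) ≡ ∑ f * k
  ∑-*ʳ k f = sym (Sum.*-distribʳ-sum k f)

  ∑-mono : {f g : Fin n → ℕ} → (∀ i → f i ≤ g i) → ∑ f ≤ ∑ g
  ∑-mono {zero} h = z≤n
  ∑-mono {suc n} h = +-mono-≤ (h zero) (∑-mono (h ∘ suc))

  ∑-const : ∀ n k → ∑ {n} (λ _ → k) ≡ n * k
  ∑-const zero k = refl
  ∑-const (suc n) k = cong (k +_) (∑-const n k)

  term≤∑ : (f : Fin n → ℕ) (i : Fin n) → f i ≤ ∑ f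
  term≤∑ f zero = m≤m+n _ _
  term≤∑ f (suc i) = ≤-trans (term≤∑ (f ∘ suc) i) (m≤n+m _ _)

  ∑-suc : (f : Fin (suc n) → ℕ) → ∑ f ≡ f zero + ∑ (f ∘ suc)
  ∑-suc f = refl

  ∑-zero : (f : Fin 0 → ℕ) → ∑ f ≡ 0
  ∑-zero f = refl

  ∑-averaging : (f : Fin (suc n) → ℕ) (k : ℕ) → ∑ f ≤ suc n * k → ∃ λ i → f i ≤ k
  ∑-averaging {zero} f k h = zero , subst₂ _≤_ (+-identityʳ _) (+-identityʳ _) h
  ∑-averaging {suc n} f k h with f zero ≤? k
  ... | yes p = zero , p
  ... | no ¬p = case ∑-averaging (f ∘ suc) k (+-cancelˡ-≤ k _ _ (≤-trans (+-monoˡ-≤ _ (<⇒≤ (≰⇒> ¬p))) h)) of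
        λ { (i , q) → suc i , q }

∑-bound : {f : Fin n → ℕ} {k : ℕ} → (∀ i → f i ≤ k) → ∑ f ≤ n * k
∑-bound {n} {k = k} h = ≤-trans (∑-mono h) (≤-reflexive (∑-const n k))

∑-* : ∀ {m n} (f : Fin m → ℕ) (g : Fin n → ℕ) → ∑ (λ i → ∑ λ j → f i * g j) ≡ ∑ f * ∑ g
∑-* f g = trans (∑-cong (λ i → ∑-*ˡ (f i) g)) (∑-*ʳ (∑ g) f)

∑-mono₂ : ∀ {m n} {f g : Fin m → Fin n → ℕ} → (∀ i j → f i j ≤ g i j) → ∑ (λ i → ∑ (f i)) ≤ ∑ (λ i → ∑ (g i))
∑-mono₂ h = ∑-mono (λ i → ∑-mono (h i))

∑-cong₂ : ∀ {m n} {f g : Fin m → Fin n → ℕ} → (∀ i j → f i j ≡ g i j) → ∑ (λ i → ∑ (f i)) ≡ ∑ (λ i → ∑ (g i))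
∑-cong₂ h = ∑-cong (λ i → ∑-cong (h i))

∑₂-distrib-+ : ∀ {m n} (f g : Fin m → Fin n → ℕ) →
  ∑ (λ i → ∑ λ j → f i j + g i j) ≡ ∑ (λ i → ∑ (f i)) + ∑ (λ i → ∑ (g i))
∑₂-distrib-+ f g = trans (∑-cong (λ i → ∑-distrib-+ (f i) (g i))) (∑-distrib-+ (λ i → ∑ (f i)) (λ i → ∑ (g i)))

argmax : (f : Fin (suc n) → ℕ) → ∃ λ i → ∀ j → f j ≤ f i
argmax {zero} f = zero , λ { zero → ≤-refl }
argmax {suc n} f with argmax (f ∘ suc)
... | i , h with f zero ≤? f (suc i)
...   | yes p = suc i , λ { zero → p ; (suc j) → h j }
...   | no ¬p = zero , λ { zero → ≤-refl ; (suc j) → ≤-trans (h j) (<⇒≤ (≰⇒> ¬p)) }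

maximum : 0 < n → (f : Fin n → ℕ) → ∃ λ i → ∀ j → f j ≤ f i
maximum {suc n} _ = argmax

≤-by : ∀ {a b} k → a + k ≡ b → a ≤ b
≤-by k refl = m≤m+n _ k

2ab≤a²+b² : ∀ a b → 2 * (a * b) ≤ a * a + b * b
2ab≤a²+b² a b with ≤-total a b
... | inj₁ a≤b with m≤n⇒∃[o]m+o≡n a≤b
...   | k , refl = ≤-by (k * k) (lem a k)
  where lem : ∀ a k → 2 * (a * (a + k)) + k * k ≡ a * a + (a + k) * (a + k)
        lem = solve-∀
2ab≤a²+b² a b | inj₂ b≤a with m≤n⇒∃[o]m+o≡n b≤a
...   | k , refl = ≤-by (k * k) (lem b k)
  where lem : ∀ b k → 2 * ((b + k) * b) + k * k ≡ (b + k) * (b + k) + b * b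
        lem = solve-∀

4ab≤[a+b]² : ∀ a b → 4 * (a * b) ≤ (a + b) * (a + b)
4ab≤[a+b]² a b = begin
  4 * (a * b)                        ≡⟨ lem₁ a b ⟩
  2 * (a * b) + 2 * (a * b)          ≤⟨ +-monoˡ-≤ _ (2ab≤a²+b² a b) ⟩
  (a * a + b * b) + 2 * (a * b)      ≡⟨ lem₂ a b ⟩
  (a + b) * (a + b)                  ∎
  where
  open ≤-Reasoning
  lem₁ : ∀ a b → 4 * (a * b) ≡ 2 * (a * b) + 2 * (a * b)
  lem₁ = solve-∀
  lem₂ : ∀ a b → (a * a + b * b) + 2 * (a * b) ≡ (a + b) * (a + b)
  lem₂ = solve-∀

-- Weighted Cauchy-Schwarz: doubled and expanded over pairs `w`, `x`, it holds termwise by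
-- `2ab≤a²+b²` for `q w` and `q x`, multiplied by `a w * a x`.
cauchy : (a q : Fin n → ℕ) →
  ∑ (λ w → a w * q w) * ∑ (λ w → a w * q w) ≤ ∑ a * ∑ (λ w → a w * (q w * q w))
cauchy {n} a q = *-cancelˡ-≤ 2 (begin
  2 * (S * S)                                              ≡⟨ cong (2 *_) (sym (∑-* (λ w → a w * q w) (λ w → a w * q w))) ⟩
  2 * ∑ (λ w → ∑ λ x → (a w * q w) * (a x * q x))           ≡⟨ sym (∑-*ˡ 2 (λ w → ∑ λ x → (a w * q w) * (a x * q x))) ⟩
  ∑ (λ w → 2 * ∑ λ x → (a w * q w) * (a x * q x))           ≡⟨ ∑-cong (λ w → sym (∑-*ˡ 2 (λ x → (a w * q w) * (a x * q x)))) ⟩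
  ∑ (λ w → ∑ λ x → 2 * ((a w * q w) * (a x * q x)))         ≤⟨ ∑-mono₂ pointwise ⟩
  ∑ (λ w → ∑ λ x → b w * a x + a w * b x)                   ≡⟨ ∑₂-distrib-+ (λ w x → b w * a x) (λ w x → a w * b x) ⟩
  ∑ (λ w → ∑ λ x → b w * a x) + ∑ (λ w → ∑ λ x → a w * b x) ≡⟨ cong₂ _+_ (∑-* b a) (∑-* a b) ⟩
  ∑ b * ∑ a + ∑ a * ∑ b                                     ≡⟨ lem₂ (∑ a) (∑ b) ⟩
  2 * (∑ a * ∑ b) ∎)
  where
  open ≤-Reasoning
  S = ∑ (λ w → a w * q w)
  b : Fin n → ℕ
  b w = a w * (q w * q w)
  lem₁ : ∀ a b c d → 2 * ((a * b) * (c * d)) ≡ (a * c) * (2 * (b * d))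
  lem₁ = solve-∀
  lem₃ : ∀ a b c d → (a * c) * (b * b + d * d) ≡ (a * (b * b)) * c + a * (c * (d * d))
  lem₃ = solve-∀
  lem₂ : ∀ x y → y * x + x * y ≡ 2 * (x * y)
  lem₂ = solve-∀
  pointwise : ∀ w x → 2 * ((a w * q w) * (a x * q x)) ≤ b w * a x + a w * b x
  pointwise w x = begin
    2 * ((a w * q w) * (a x * q x))            ≡⟨ lem₁ (a w) (q w) (a x) (q x) ⟩
    (a w * a x) * (2 * (q w * q x))            ≤⟨ *-monoʳ-≤ (a w * a x) (2ab≤a²+b² (q w) (q x)) ⟩
    (a w * a x) * (q w * q w + q x * q x)      ≡⟨ lem₃ (a w) (q w) (a x) (q x) ⟩
    b w * a x + a w * b x                      ∎

-- Indicators and truth tables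

ind : Bool → ℕ
ind true = 1
ind false = 0

ind-∧ : ∀ a b → ind (a ∧ b) ≡ ind a * ind b
ind-∧ true b = sym (+-identityʳ _)
ind-∧ false b = refl

ind≤1 : ∀ b → ind b ≤ 1
ind≤1 true = ≤-refl
ind≤1 false = z≤n

_==_ : Bool → Bool → Bool
true == d = d
false == d = not d

ind-==-split : ∀ d c → ind (d == c) + ind (d == not c) ≡ 1
ind-==-split true true = refl
ind-==-split true false = refl
ind-==-split false true = refl
ind-==-split false false = refl

-- The colour of the edge k steps after an edge of colour c in an alternating walk.
alt : ℕ → Bool → Bool
alt zero c = c
alt (suc k) c = alt k (not c)

alt-suc : ∀ k c → alt (suc k) c ≡ not (alt k c)
alt-suc zero c = refl
alt-suc (suc k) c = alt-suc k (not c)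

alt-alt : ∀ k c → alt k (alt k c) ≡ c
alt-alt zero c = refl
alt-alt (suc k) c = begin
  alt (suc k) (alt (suc k) c)   ≡⟨ alt-suc k _ ⟩
  not (alt k (alt k (not c)))   ≡⟨ cong not (alt-alt k (not c)) ⟩
  not (not c)                   ≡⟨ not-involutive c ⟩
  c ∎
  where open ≡-Reasoning

∀Bool : (Bool → Bool) → Bool
∀Bool p = p true ∧ p false

∀Bool-sound : (p : Bool → Bool) → T (∀Bool p) → ∀ b → T (p b)
∀Bool-sound p h true with p true
... | true = tt
∀Bool-sound p h false with p true
... | true = h

-- Proof by truth table: for concrete `f` and `g` the hypothesis evaluates to the unit type, so `tt`
-- proves it.
≤-cases₂ : (f g : Bool → Bool → ℕ) → T (∀Bool λ a → ∀Bool λ b → f a b ≤ᵇ g a b) → ∀ a b → f a b ≤ g a b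
≤-cases₂ f g h a b = ≤ᵇ⇒≤ _ _ (∀Bool-sound (λ b → f a b ≤ᵇ g a b) (∀Bool-sound (λ a → ∀Bool λ b → f a b ≤ᵇ g a b) h a) b)

≤-cases₃ : (f g : Bool → Bool → Bool → ℕ) →
  T (∀Bool λ a → ∀Bool λ b → ∀Bool λ c → f a b c ≤ᵇ g a b c) → ∀ a b c → f a b c ≤ g a b c
≤-cases₃ f g h a = ≤-cases₂ (f a) (g a) (∀Bool-sound (λ a → ∀Bool λ b → ∀Bool λ c → f a b c ≤ᵇ g a b c) h a)

≤-cases₄ : (f g : Bool → Bool → Bool → Bool → ℕ) →
  T (∀Bool λ a → ∀Bool λ b → ∀Bool λ c → ∀Bool λ d → f a b c d ≤ᵇ g a b c d) → ∀ a b c d → f a b c d ≤ g a b c d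
≤-cases₄ f g h a = ≤-cases₃ (f a) (g a) (∀Bool-sound (λ a → ∀Bool λ b → ∀Bool λ c → ∀Bool λ d → f a b c d ≤ᵇ g a b c d) h a)

≤-cases₅ : (f g : Bool → Bool → Bool → Bool → Bool → ℕ) →
  T (∀Bool λ a → ∀Bool λ b → ∀Bool λ c → ∀Bool λ d → ∀Bool λ e → f a b c d e ≤ᵇ g a b c d e) →
  ∀ a b c d e → f a b c d e ≤ g a b c d e
≤-cases₅ f g h a = ≤-cases₄ (f a) (g a) (∀Bool-sound (λ a → ∀Bool λ b → ∀Bool λ c → ∀Bool λ d → ∀Bool λ e → f a b c d e ≤ᵇ g a b c d e) h a)

∑-average : 0 < n → (f : Fin n → ℕ) (k : ℕ) → ∑ f ≤ n * k → ∃ λ i → f i ≤ k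
∑-average {suc n} _ = ∑-averaging

∑-*-nested : ∀ k (f : Fin n → Fin n → ℕ) → ∑ (λ i → ∑ λ j → k * f i j) ≡ k * ∑ (λ i → ∑ (f i))
∑-*-nested k f = trans (∑-cong (λ i → ∑-*ˡ k (f i))) (∑-*ˡ k (λ i → ∑ (f i)))

size-of : (Fin n → Bool) → Bool → ℕ
size-of f ρ = ∑ λ v → ind (f v == ρ)

size-split : (f : Fin n → Bool) (ρ : Bool) → size-of f ρ + size-of f (not ρ) ≡ n
size-split {n} f ρ = trans (sym (∑-distrib-+ (λ v → ind (f v == ρ)) _))
  (trans (∑-cong (λ v → ind-==-split (f v) ρ)) (trans (∑-const n 1) (*-identityʳ n)))

ind-xor-self : ∀ x → ind (x xor x) ≡ 0
ind-xor-self true = refl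
ind-xor-self false = refl

ind≡0 : ∀ x → ind x ≡ 0 → x ≡ false
ind≡0 false _ = refl

-- The template of a bipartition f: colour b between the two classes, colour not b inside them.
template : Bool → (Fin n → Bool) → Fin n → Fin n → Bool
template b f v w = b == (f v xor f w)

≡-cases₃ : (f g : Bool → Bool → Bool → Bool) →
  T (∀Bool λ a → ∀Bool λ b → ∀Bool λ c → f a b c == g a b c) → ∀ a b c → f a b c ≡ g a b c
≡-cases₃ f g h a b c = ==⇒≡ (f a b c) (g a b c)
  (∀Bool-sound (λ c → f a b c == g a b c) (∀Bool-sound (λ b → ∀Bool λ c → f a b c == g a b c)
    (∀Bool-sound (λ a → ∀Bool λ b → ∀Bool λ c → f a b c == g a b c) h a) b) c)
  where
  ==⇒≡ : ∀ x y → T (x == y) → x ≡ y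
  ==⇒≡ true true _ = refl
  ==⇒≡ false false _ = refl

≡-cases₄ : (f g : Bool → Bool → Bool → Bool → Bool) →
  T (∀Bool λ a → ∀Bool λ b → ∀Bool λ c → ∀Bool λ d → f a b c d == g a b c d) → ∀ a b c d → f a b c d ≡ g a b c d
≡-cases₄ f g h a = ≡-cases₃ (f a) (g a) (∀Bool-sound (λ a → ∀Bool λ b → ∀Bool λ c → ∀Bool λ d → f a b c d == g a b c d) h a)

-- Alternating walks

module Walks {n : ℕ} (col : Fin n → Fin n → Bool) (sy : ∀ u v → col u v ≡ col v u) where

  E : Bool → Fin n → Fin n → ℕ
  E c u v = ind (col u v == c)

  E-sym : ∀ c u v → E c u v ≡ E c v u
  E-sym c u v = cong (λ d → ind (d == c)) (sy u v)

  E² : ∀ c u v → E c u v * E c u v ≡ E c u v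
  E² c u v with col u v == c
  ... | true = refl
  ... | false = refl

  deg : Bool → Fin n → ℕ
  deg c u = ∑ (E c u)

  -- The sum is `n` and not `n - 1` because the diagonal entry `col u u` counts as a loop of its
  -- colour. Walks may use these loops, sequences of distinct vertices do not.
  deg-split : ∀ c u → deg c u + deg (not c) u ≡ n
  deg-split c u = begin
    deg c u + deg (not c) u                 ≡⟨ sym (∑-distrib-+ (E c u) (E (not c) u)) ⟩
    ∑ (λ v → E c u v + E (not c) u v)       ≡⟨ ∑-cong (λ v → ind-==-split (col u v) c) ⟩
    ∑ {n} (λ _ → 1)                         ≡⟨ ∑-const n 1 ⟩
    n * 1                                   ≡⟨ *-identityʳ n ⟩
    n ∎
    where open ≡-Reasoning

  4deg*deg≤n² : ∀ c u → 4 * (deg c u * deg (not c) u) ≤ n * n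
  4deg*deg≤n² c u = begin
    4 * (deg c u * deg (not c) u)                           ≤⟨ 4ab≤[a+b]² (deg c u) (deg (not c) u) ⟩
    (deg c u + deg (not c) u) * (deg c u + deg (not c) u)   ≡⟨ cong₂ _*_ (deg-split c u) (deg-split c u) ⟩
    n * n ∎
    where open ≤-Reasoning

  -- wk c k u v counts the alternating walks with k + 1 edges from u to v whose first edge has colour c.
  wk : Bool → ℕ → Fin n → Fin n → ℕ
  wk c zero u v = E c u v
  wk c (suc k) u v = ∑ λ w → E c u w * wk (not c) k w v

  wk-split : ∀ c i j u v → wk c (suc (i + j)) u v ≡ ∑ (λ w → wk c i u w * wk (alt (suc i) c) j w v)
  wk-split c zero j u v = refl
  wk-split c (suc i) j u v = begin
    ∑ (λ x → E c u x * wk (not c) (suc (i + j)) x v)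
      ≡⟨ ∑-cong (λ x → cong (E c u x *_) (wk-split (not c) i j x v)) ⟩
    ∑ (λ x → E c u x * ∑ (λ w → wk (not c) i x w * r w))
      ≡⟨ ∑-cong (λ x → sym (∑-*ˡ (E c u x) _)) ⟩
    ∑ (λ x → ∑ (λ w → E c u x * (wk (not c) i x w * r w)))
      ≡⟨ ∑-comm (λ x w → E c u x * (wk (not c) i x w * r w)) ⟩
    ∑ (λ w → ∑ (λ x → E c u x * (wk (not c) i x w * r w)))
      ≡⟨ ∑-cong₂ (λ w x → sym (*-assoc (E c u x) (wk (not c) i x w) (r w))) ⟩
    ∑ (λ w → ∑ (λ x → (E c u x * wk (not c) i x w) * r w))
      ≡⟨ ∑-cong (λ w → ∑-*ʳ (r w) _) ⟩
    ∑ (λ w → wk c (suc i) u w * r w) ∎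
    where
    open ≡-Reasoning
    r : Fin n → ℕ
    r w = wk (alt (suc i) (not c)) j w v

  -- The last edge has colour `alt k c`; splitting it off instead of the first one gives the
  -- recursion of the reversed walk.
  wk-reverse : ∀ c k u v → wk c k u v ≡ wk (alt k c) k v u
  wk-reverse c zero u v = E-sym c u v
  wk-reverse c (suc k) u v = begin
    wk c (suc k) u v
      ≡⟨ cong (λ i → wk c (suc i) u v) (sym (+-identityʳ k)) ⟩
    wk c (suc (k + 0)) u v
      ≡⟨ wk-split c k 0 u v ⟩
    ∑ (λ w → wk c k u w * E d w v)
      ≡⟨ ∑-cong (λ w → trans (*-comm (wk c k u w) (E d w v)) (cong₂ _*_ (E-sym d w v) (back w))) ⟩
    ∑ (λ w → E d v w * wk (not d) k w u) ∎
    where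
    open ≡-Reasoning
    d = alt (suc k) c
    back : ∀ w → wk c k u w ≡ wk (not d) k w u
    back w = trans (wk-reverse c k u w)
      (cong (λ e → wk e k w u) (sym (trans (cong not (alt-suc k c)) (not-involutive (alt k c)))))

  -- Counts the alternating walks with two edges and given first colour by their middle vertex.
  Θ : ℕ
  Θ = ∑ λ u → deg true u * deg false u

  deg*deg : ∀ c u → deg c u * deg (not c) u ≡ deg true u * deg false u
  deg*deg true u = refl
  deg*deg false u = *-comm (deg false u) (deg true u)

  ∑deg*deg : ∀ c → ∑ (λ u → deg c u * deg (not c) u) ≡ Θ
  ∑deg*deg c = ∑-cong (deg*deg c)

  4Θ≤n³ : 4 * Θ ≤ n * (n * n)
  4Θ≤n³ = begin
    4 * Θ                                              ≡⟨ sym (∑-*ˡ 4 _) ⟩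
    ∑ (λ u → 4 * (deg true u * deg false u))            ≤⟨ ∑-bound (4deg*deg≤n² true) ⟩
    n * (n * n) ∎
    where open ≤-Reasoning

  -- With f = deg (not c) as weight, the weighted l²-norm grows by a factor of at most
  -- deg c · deg (not c) ≤ n²/4 when a walk is prolonged at its front by an edge of colour c.
  Nrm : Bool → ℕ → ℕ
  Nrm c k = ∑ λ v → ∑ λ u → deg (not c) u * (wk c k u v * wk c k u v)

  Nrm-zero : ∀ c → Nrm c 0 ≡ Θ
  Nrm-zero c = begin
    ∑ (λ v → ∑ λ u → deg (not c) u * (E c u v * E c u v))  ≡⟨ ∑-cong₂ (λ v u → cong (deg (not c) u *_) (E² c u v)) ⟩
    ∑ (λ v → ∑ λ u → deg (not c) u * E c u v)              ≡⟨ ∑-comm (λ v u → deg (not c) u * E c u v) ⟩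
    ∑ (λ u → ∑ λ v → deg (not c) u * E c u v)              ≡⟨ ∑-cong (λ u → ∑-*ˡ (deg (not c) u) (E c u)) ⟩
    ∑ (λ u → deg (not c) u * deg c u)                      ≡⟨ ∑-cong (λ u → *-comm (deg (not c) u) (deg c u)) ⟩
    ∑ (λ u → deg c u * deg (not c) u)                      ≡⟨ ∑deg*deg c ⟩
    Θ ∎
    where open ≡-Reasoning

  ∑E-weight : ∀ c (X : Fin n → Fin n → ℕ) →
    ∑ (λ v → ∑ λ u → ∑ λ w → E c u w * X w v) ≡ ∑ (λ v → ∑ λ w → deg c w * X w v)
  ∑E-weight c X = ∑-cong λ v → begin
    ∑ (λ u → ∑ λ w → E c u w * X w v)   ≡⟨ ∑-comm (λ u w → E c u w * X w v) ⟩
    ∑ (λ w → ∑ λ u → E c u w * X w v)   ≡⟨ ∑-cong (λ w → ∑-*ʳ (X w v) _) ⟩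
    ∑ (λ w → ∑ (λ u → E c u w) * X w v) ≡⟨ ∑-cong (λ w → cong (_* X w v) (∑-cong (λ u → E-sym c u w))) ⟩
    ∑ (λ w → deg c w * X w v) ∎
    where open ≡-Reasoning

  -- Cauchy-Schwarz over the second vertex `w` costs the factor `deg c u`, which the weight
  -- `deg (not c) u` completes to a product of at most `n²/4` at the single vertex `u`. Summing the
  -- edge `uw` over `u` then produces `deg c w`, the weight that `Nrm (not c) k` requires.
  Nrm-suc : ∀ c k → 4 * Nrm c (suc k) ≤ (n * n) * Nrm (not c) k
  Nrm-suc c k = begin
    4 * Nrm c (suc k)
      ≡⟨ sym (trans (∑-cong (λ v → ∑-*ˡ 4 _)) (∑-*ˡ 4 _)) ⟩
    ∑ (λ v → ∑ λ u → 4 * (deg (not c) u * (wk c (suc k) u v * wk c (suc k) u v)))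
      ≤⟨ ∑-mono₂ pointwise ⟩
    ∑ (λ v → ∑ λ u → (n * n) * Y v u)
      ≡⟨ trans (∑-cong (λ v → ∑-*ˡ (n * n) (Y v))) (∑-*ˡ (n * n) (λ v → ∑ (Y v))) ⟩
    (n * n) * ∑ (λ v → ∑ (Y v))
      ≡⟨ cong ((n * n) *_) (∑E-weight c (λ w v → wk (not c) k w v * wk (not c) k w v)) ⟩
    (n * n) * ∑ (λ v → ∑ λ w → deg c w * (wk (not c) k w v * wk (not c) k w v))
      ≡⟨ cong (λ d → (n * n) * ∑ (λ v → ∑ λ w → deg d w * (wk (not c) k w v * wk (not c) k w v))) (sym (not-involutive c)) ⟩
    (n * n) * Nrm (not c) k ∎
    where
    open ≤-Reasoning
    Y : Fin n → Fin n → ℕ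
    Y v u = ∑ λ w → E c u w * (wk (not c) k w v * wk (not c) k w v)
    lem : ∀ d e y → 4 * (d * (e * y)) ≡ (4 * (e * d)) * y
    lem = solve-∀
    pointwise : ∀ v u → 4 * (deg (not c) u * (wk c (suc k) u v * wk c (suc k) u v)) ≤ (n * n) * Y v u
    pointwise v u = begin
      4 * (deg (not c) u * (wk c (suc k) u v * wk c (suc k) u v))
        ≤⟨ *-monoʳ-≤ 4 (*-monoʳ-≤ (deg (not c) u) (cauchy (E c u) (λ w → wk (not c) k w v))) ⟩
      4 * (deg (not c) u * (deg c u * Y v u))
        ≡⟨ lem (deg (not c) u) (deg c u) (Y v u) ⟩
      4 * (deg c u * deg (not c) u) * Y v u
        ≤⟨ *-monoˡ-≤ (Y v u) (4deg*deg≤n² c u) ⟩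
      (n * n) * Y v u ∎

  Nrm-iterate : ∀ c k j → 4 ^ k * Nrm c (k + j) ≤ (n * n) ^ k * Nrm (alt k c) j
  Nrm-iterate c zero j = ≤-refl
  Nrm-iterate c (suc k) j = begin
    4 * 4 ^ k * Nrm c (suc (k + j))              ≡⟨ lem 4 (4 ^ k) _ ⟩
    4 ^ k * (4 * Nrm c (suc (k + j)))            ≤⟨ *-monoʳ-≤ (4 ^ k) (Nrm-suc c (k + j)) ⟩
    4 ^ k * ((n * n) * Nrm (not c) (k + j))      ≡⟨ lem′ (4 ^ k) (n * n) _ ⟩
    (n * n) * (4 ^ k * Nrm (not c) (k + j))      ≤⟨ *-monoʳ-≤ (n * n) (Nrm-iterate (not c) k j) ⟩
    (n * n) * ((n * n) ^ k * Nrm (alt (suc k) c) j) ≡⟨ sym (*-assoc (n * n) ((n * n) ^ k) _) ⟩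
    (n * n) ^ suc k * Nrm (alt (suc k) c) j ∎
    where
    open ≤-Reasoning
    lem : ∀ a b x → (a * b) * x ≡ b * (a * x)
    lem = solve-∀
    lem′ : ∀ b a x → b * (a * x) ≡ a * (b * x)
    lem′ = solve-∀

  -- The walks have `2 (l + 2)` edges: one that is cut out, and two arcs with `l + 2` and `l + 1`
  -- edges.
  closed : Bool → ℕ → ℕ
  closed c l = ∑ λ u → wk c (suc (suc (suc l + l))) u u

  -- Seen from the two ends of the cut edge `uw` of colour `c`, both arcs to `v` begin with colour
  -- `not c`. The arc ending in `u` is reversed for this purpose, so that both can be measured by
  -- norms of the same colour.
  closed-split : ∀ c l → closed c l ≡
    ∑ (λ v → ∑ λ u → ∑ λ w → E c u w * (wk (not c) (suc l) w v * wk (not c) l u v))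
  closed-split c l = begin
    ∑ (λ u → ∑ λ w → E c u w * wk (not c) (suc (suc l + l)) w u)
      ≡⟨ ∑-cong₂ (λ u w → trans (cong (E c u w *_) (halves u w)) (sym (∑-*ˡ (E c u w) _))) ⟩
    ∑ (λ u → ∑ λ w → ∑ λ v → X u w v)
      ≡⟨ ∑-cong (λ u → ∑-comm (X u)) ⟩
    ∑ (λ u → ∑ λ v → ∑ λ w → X u w v)
      ≡⟨ ∑-comm (λ u v → ∑ λ w → X u w v) ⟩
    ∑ (λ v → ∑ λ u → ∑ λ w → X u w v) ∎
    where
    open ≡-Reasoning
    X : Fin n → Fin n → Fin n → ℕ
    X u w v = E c u w * (wk (not c) (suc l) w v * wk (not c) l u v)
    d = alt (suc (suc l)) (not c)
    d-alt : alt l d ≡ not c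
    d-alt = trans (cong (λ e → alt l (alt l e)) (not-involutive (not c))) (alt-alt l (not c))
    halves : ∀ u w → wk (not c) (suc (suc l + l)) w u ≡ ∑ (λ v → wk (not c) (suc l) w v * wk (not c) l u v)
    halves u w = trans (wk-split (not c) (suc l) l w u)
      (∑-cong (λ v → cong (wk (not c) (suc l) w v *_)
        (trans (wk-reverse d l v u) (cong (λ e → wk e l u v) d-alt))))

  -- Cut a closed walk at one edge uw of colour c and at the vertex v opposite to it; then
  -- 4nXY ≤ 4X² + n²Y² separates the two halves X and Y.
  closed-Nrm : ∀ c l → 4 * n * closed c l ≤ 4 * Nrm (not c) (suc l) + (n * n) * Nrm (not c) l
  closed-Nrm c l = begin
    4 * n * closed c l
      ≡⟨ cong (4 * n *_) (closed-split c l) ⟩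
    4 * n * ∑ (λ v → ∑ λ u → ∑ λ w → E c u w * (X w v * Y u v))
      ≡⟨ sym (trans (∑-cong (λ v → trans (∑-cong (λ u → ∑-*ˡ (4 * n) _)) (∑-*ˡ (4 * n) _))) (∑-*ˡ (4 * n) _)) ⟩
    ∑ (λ v → ∑ λ u → ∑ λ w → 4 * n * (E c u w * (X w v * Y u v)))
      ≤⟨ ∑-mono (λ v → ∑-mono₂ (λ u w → pointwise v u w)) ⟩
    ∑ (λ v → ∑ λ u → ∑ λ w → E c u w * (4 * (X w v * X w v)) + E c u w * ((n * n) * (Y u v * Y u v)))
      ≡⟨ trans (∑-cong (λ v → ∑₂-distrib-+ _ _)) (∑-distrib-+ (λ v → ∑ λ u → ∑ λ w → E c u w * (4 * (X w v * X w v))) _) ⟩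
    ∑ (λ v → ∑ λ u → ∑ λ w → E c u w * (4 * (X w v * X w v))) + ∑ (λ v → ∑ λ u → ∑ λ w → E c u w * ((n * n) * (Y u v * Y u v)))
      ≡⟨ cong₂ _+_ left right ⟩
    4 * Nrm (not c) (suc l) + (n * n) * Nrm (not c) l ∎
    where
    open ≤-Reasoning
    X Y : Fin n → Fin n → ℕ
    X w v = wk (not c) (suc l) w v
    Y u v = wk (not c) l u v
    lem : ∀ n e x y → 4 * n * (e * (x * y)) ≡ e * (2 * ((2 * x) * (n * y)))
    lem = solve-∀
    lem₂ : ∀ n e x y → e * ((2 * x) * (2 * x) + (n * y) * (n * y)) ≡ e * (4 * (x * x)) + e * ((n * n) * (y * y))
    lem₂ = solve-∀
    lem₃ : ∀ k d x → d * (k * x) ≡ k * (d * x)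
    lem₃ = solve-∀
    pointwise : ∀ v u w → 4 * n * (E c u w * (X w v * Y u v)) ≤ E c u w * (4 * (X w v * X w v)) + E c u w * ((n * n) * (Y u v * Y u v))
    pointwise v u w = begin
      4 * n * (E c u w * (X w v * Y u v))          ≡⟨ lem n (E c u w) (X w v) (Y u v) ⟩
      E c u w * (2 * ((2 * X w v) * (n * Y u v)))  ≤⟨ *-monoʳ-≤ (E c u w) (2ab≤a²+b² (2 * X w v) (n * Y u v)) ⟩
      E c u w * ((2 * X w v) * (2 * X w v) + (n * Y u v) * (n * Y u v)) ≡⟨ lem₂ n (E c u w) (X w v) (Y u v) ⟩
      _ ∎
    pull : ∀ k (Z : Fin n → Fin n → ℕ) → ∑ (λ v → ∑ λ w → deg c w * (k * (Z w v * Z w v))) ≡ k * ∑ (λ v → ∑ λ w → deg (not (not c)) w * (Z w v * Z w v))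
    pull k Z = trans (trans (∑-cong₂ (λ v w → trans (lem₃ k (deg c w) (Z w v * Z w v)) (cong (λ d → k * (deg d w * (Z w v * Z w v))) (sym (not-involutive c)))))
                      (∑-cong (λ v → ∑-*ˡ k _))) (∑-*ˡ k _)
    left : ∑ (λ v → ∑ λ u → ∑ λ w → E c u w * (4 * (X w v * X w v))) ≡ 4 * Nrm (not c) (suc l)
    left = trans (∑E-weight c (λ w v → 4 * (X w v * X w v))) (pull 4 X)
    right : ∑ (λ v → ∑ λ u → ∑ λ w → E c u w * ((n * n) * (Y u v * Y u v))) ≡ (n * n) * Nrm (not c) l
    right = trans (∑-cong₂ (λ v u → ∑-*ʳ ((n * n) * (Y u v * Y u v)) (E c u))) (pull (n * n) Y)

  -- The factors `4` and `n * n` in `closed-Nrm` balance the lengths of the two arcs: `Nrm-iterate`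
  -- bounds both terms by the same multiple of `Θ`.
  closed-bound : ∀ c l → 0 < n → 4 ^ (l + 2) * closed c l ≤ 2 * n ^ (2 * (l + 2))
  closed-bound c l n>0 = *-cancelˡ-≤ (4 * n) {{m*n≢0 4 n {{_}} {{>-nonZero n>0}}}} (begin
    4 * n * (4 ^ (l + 2) * closed c l)
      ≡⟨ lem (4 * n) (4 ^ (l + 2)) (closed c l) ⟩
    4 ^ (l + 2) * (4 * n * closed c l)
      ≤⟨ *-monoʳ-≤ (4 ^ (l + 2)) (closed-Nrm c l) ⟩
    4 ^ (l + 2) * (4 * Nrm (not c) (suc l) + (n * n) * Nrm (not c) l)
      ≡⟨ cong (_* (4 * Nrm (not c) (suc l) + (n * n) * Nrm (not c) l)) (^-distribˡ-+-* 4 l 2) ⟩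
    4 ^ l * 16 * (4 * Nrm (not c) (suc l) + (n * n) * Nrm (not c) l)
      ≡⟨ lem₁ (4 ^ l) (Nrm (not c) (suc l)) n (Nrm (not c) l) ⟩
    16 * (4 * 4 ^ l * Nrm (not c) (suc l)) + (16 * (n * n)) * (4 ^ l * Nrm (not c) l)
      ≤⟨ +-mono-≤ (*-monoʳ-≤ 16 (bnd (suc l))) (*-monoʳ-≤ (16 * (n * n)) (bnd l)) ⟩
    16 * ((n * n) ^ suc l * Θ) + (16 * (n * n)) * ((n * n) ^ l * Θ)
      ≡⟨ lem₂ n ((n * n) ^ l) Θ ⟩
    8 * ((n * n) * (n * n) ^ l) * (4 * Θ)
      ≤⟨ *-monoʳ-≤ (8 * ((n * n) * (n * n) ^ l)) 4Θ≤n³ ⟩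
    8 * ((n * n) * (n * n) ^ l) * (n * (n * n))
      ≡⟨ lem₃ n ((n * n) ^ l) ⟩
    4 * n * (2 * ((n * n) ^ l * ((n * n) * ((n * n) * 1))))
      ≡⟨ cong (λ p → 4 * n * (2 * p)) (sym (^-distribˡ-+-* (n * n) l 2)) ⟩
    4 * n * (2 * (n * n) ^ (l + 2))
      ≡⟨ cong (λ p → 4 * n * (2 * p)) (trans (cong (λ m → (n * m) ^ (l + 2)) (sym (*-identityʳ n))) (^-*-assoc n 2 (l + 2))) ⟩
    4 * n * (2 * n ^ (2 * (l + 2))) ∎)
    where
    open ≤-Reasoning
    bnd : ∀ k → 4 ^ k * Nrm (not c) k ≤ (n * n) ^ k * Θ
    bnd k = begin
      4 ^ k * Nrm (not c) k                 ≡⟨ cong (λ i → 4 ^ k * Nrm (not c) i) (sym (+-identityʳ k)) ⟩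
      4 ^ k * Nrm (not c) (k + 0)           ≤⟨ Nrm-iterate (not c) k 0 ⟩
      (n * n) ^ k * Nrm (alt k (not c)) 0   ≡⟨ cong ((n * n) ^ k *_) (Nrm-zero _) ⟩
      (n * n) ^ k * Θ ∎
    lem : ∀ a b x → a * (b * x) ≡ b * (a * x)
    lem = solve-∀
    lem₁ : ∀ f x n y → f * 16 * (4 * x + (n * n) * y) ≡ 16 * (4 * f * x) + (16 * (n * n)) * (f * y)
    lem₁ = solve-∀
    lem₂ : ∀ n p t → 16 * ((n * n) * p * t) + (16 * (n * n)) * (p * t) ≡ 8 * ((n * n) * p) * (4 * t)
    lem₂ = solve-∀
    lem₃ : ∀ n p → 8 * ((n * n) * p) * (n * (n * n)) ≡ 4 * n * (2 * (p * ((n * n) * ((n * n) * 1))))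
    lem₃ = solve-∀

  -- For wk c 1 u v and q c u v the last edge differs from, respectively agrees with, the first one.
  q : Bool → Fin n → Fin n → ℕ
  q c u v = ∑ λ w → E c u w * E c w v

  wk+q≡deg : ∀ c u v → wk c 1 u v + q c u v ≡ deg c u
  wk+q≡deg c u v = begin
    wk c 1 u v + q c u v                                       ≡⟨ sym (∑-distrib-+ (λ w → E c u w * E (not c) w v) _) ⟩
    ∑ (λ w → E c u w * E (not c) w v + E c u w * E c w v)      ≡⟨ ∑-cong (λ w → sym (*-distribˡ-+ (E c u w) _ _)) ⟩
    ∑ (λ w → E c u w * (E (not c) w v + E c w v))              ≡⟨ ∑-cong (λ w → cong (E c u w *_) (trans (+-comm (E (not c) w v) _) (ind-==-split (col w v) c))) ⟩
    ∑ (λ w → E c u w * 1)                                      ≡⟨ ∑-cong (λ w → *-identityʳ (E c u w)) ⟩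
    deg c u ∎
    where open ≡-Reasoning

  ∑wk₁ : ∀ c → ∑ (λ v → ∑ λ u → wk c 1 u v) ≡ Θ
  ∑wk₁ c = begin
    ∑ (λ v → ∑ λ u → ∑ λ w → E c u w * E (not c) w v)   ≡⟨ ∑E-weight c (λ w v → E (not c) w v) ⟩
    ∑ (λ v → ∑ λ w → deg c w * E (not c) w v)           ≡⟨ ∑-comm (λ v w → deg c w * E (not c) w v) ⟩
    ∑ (λ w → ∑ λ v → deg c w * E (not c) w v)           ≡⟨ ∑-cong (λ w → ∑-*ˡ (deg c w) (E (not c) w)) ⟩
    ∑ (λ w → deg c w * deg (not c) w)                   ≡⟨ ∑deg*deg c ⟩
    Θ ∎
    where open ≡-Reasoning

  -- With `p = wk c 1 u v` and `q = q c u v`, the product `p * q` counts closed walks of four edges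
  -- through `u` and `v` with three edges of colour `c` and one of the other: the four-cycles with
  -- an odd number of red edges. As `p + q` is `deg c u`, it is also the difference between
  -- `deg c u * p` and `p * p`.
  defect : Bool → ℕ
  defect c = ∑ λ v → ∑ λ u → deg (not c) u * (wk c 1 u v * q c u v)

  Nrm-defect : ∀ c → 4 * Nrm c 1 + 4 * defect c ≤ (n * n) * Θ
  Nrm-defect c = begin
    4 * Nrm c 1 + 4 * defect c
      ≡⟨ sym (*-distribˡ-+ 4 (Nrm c 1) (defect c)) ⟩
    4 * (Nrm c 1 + defect c)
      ≡⟨ cong (4 *_) (sym (∑₂-distrib-+ (λ v u → deg (not c) u * (wk c 1 u v * wk c 1 u v)) _)) ⟩
    4 * ∑ (λ v → ∑ λ u → deg (not c) u * (wk c 1 u v * wk c 1 u v) + deg (not c) u * (wk c 1 u v * q c u v))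
      ≡⟨ sym (trans (∑-cong (λ v → ∑-*ˡ 4 _)) (∑-*ˡ 4 _)) ⟩
    ∑ (λ v → ∑ λ u → 4 * (deg (not c) u * (wk c 1 u v * wk c 1 u v) + deg (not c) u * (wk c 1 u v * q c u v)))
      ≤⟨ ∑-mono₂ pointwise ⟩
    ∑ (λ v → ∑ λ u → (n * n) * wk c 1 u v)
      ≡⟨ trans (∑-cong (λ v → ∑-*ˡ (n * n) _)) (∑-*ˡ (n * n) _) ⟩
    (n * n) * ∑ (λ v → ∑ λ u → wk c 1 u v)
      ≡⟨ cong ((n * n) *_) (∑wk₁ c) ⟩
    (n * n) * Θ ∎
    where
    open ≤-Reasoning
    lem : ∀ d p r → 4 * (d * (p * p) + d * (p * r)) ≡ 4 * ((p + r) * d) * p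
    lem = solve-∀
    pointwise : ∀ v u → 4 * (deg (not c) u * (wk c 1 u v * wk c 1 u v) + deg (not c) u * (wk c 1 u v * q c u v)) ≤ (n * n) * wk c 1 u v
    pointwise v u = begin
      4 * (deg (not c) u * (wk c 1 u v * wk c 1 u v) + deg (not c) u * (wk c 1 u v * q c u v))
        ≡⟨ lem (deg (not c) u) (wk c 1 u v) (q c u v) ⟩
      4 * ((wk c 1 u v + q c u v) * deg (not c) u) * wk c 1 u v
        ≡⟨ cong (λ k → 4 * (k * deg (not c) u) * wk c 1 u v) (wk+q≡deg c u v) ⟩
      4 * (deg c u * deg (not c) u) * wk c 1 u v
        ≤⟨ *-monoˡ-≤ (wk c 1 u v) (4deg*deg≤n² c u) ⟩
      (n * n) * wk c 1 u v ∎

  -- Of all losses only the one for walks of two edges, in the longer arc, is recorded; the other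
  -- `l` prolongations are bounded by their plain factor and change the colour from `not c` to
  -- `alt l (not c)`.
  closed-defect : ∀ c l →
    4 ^ l * (4 * n * closed c l) + (n * n) ^ l * (4 * defect (alt l (not c))) ≤ (n * n) ^ l * (2 * (n * n) * Θ)
  closed-defect c l = begin
    4 ^ l * (4 * n * closed c l) + P * (4 * defect d)
      ≤⟨ +-monoˡ-≤ _ (*-monoʳ-≤ (4 ^ l) (closed-Nrm c l)) ⟩
    4 ^ l * (4 * Nrm (not c) (suc l) + (n * n) * Nrm (not c) l) + P * (4 * defect d)
      ≡⟨ cong₂ (λ i j → 4 ^ l * (4 * Nrm (not c) i + (n * n) * Nrm (not c) j) + P * (4 * defect d)) (+-comm 1 l) (sym (+-identityʳ l)) ⟩
    4 ^ l * (4 * Nrm (not c) (l + 1) + (n * n) * Nrm (not c) (l + 0)) + P * (4 * defect d)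
      ≡⟨ lem (4 ^ l) (Nrm (not c) (l + 1)) (n * n) (Nrm (not c) (l + 0)) (P * (4 * defect d)) ⟩
    4 * (4 ^ l * Nrm (not c) (l + 1)) + (n * n) * (4 ^ l * Nrm (not c) (l + 0)) + P * (4 * defect d)
      ≤⟨ +-monoˡ-≤ _ (+-mono-≤ (*-monoʳ-≤ 4 (Nrm-iterate (not c) l 1)) (*-monoʳ-≤ (n * n) (Nrm-iterate (not c) l 0))) ⟩
    4 * (P * Nrm d 1) + (n * n) * (P * Nrm d 0) + P * (4 * defect d)
      ≡⟨ cong (λ k → 4 * (P * Nrm d 1) + (n * n) * (P * k) + P * (4 * defect d)) (Nrm-zero d) ⟩
    4 * (P * Nrm d 1) + (n * n) * (P * Θ) + P * (4 * defect d)
      ≡⟨ lem₂ P (Nrm d 1) (n * n) Θ (defect d) ⟩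
    P * (4 * Nrm d 1 + 4 * defect d + (n * n) * Θ)
      ≤⟨ *-monoʳ-≤ P (+-monoˡ-≤ _ (Nrm-defect d)) ⟩
    P * ((n * n) * Θ + (n * n) * Θ)
      ≡⟨ cong (P *_) (lem₃ (n * n) Θ) ⟩
    P * (2 * (n * n) * Θ) ∎
    where
    open ≤-Reasoning
    P = (n * n) ^ l
    d = alt l (not c)
    lem : ∀ f x m y z → f * (4 * x + m * y) + z ≡ 4 * (f * x) + m * (f * y) + z
    lem = solve-∀
    lem₂ : ∀ p x m t y → 4 * (p * x) + m * (p * t) + p * (4 * y) ≡ p * (4 * x + 4 * y + m * t)
    lem₂ = solve-∀
    lem₃ : ∀ m t → m * t + m * t ≡ 2 * m * t
    lem₃ = solve-∀

-- Stability

-- `m² - 4ro` is the square of the difference `y` of `r` and `o`, so `y² ≤ D m`; together with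
-- `400 D ≤ m` this makes `y` at most `m / 20`.
balanced-factor : ∀ r o m D → r + o ≡ m → m * m ≤ 4 * (r * o) + D * m → 20 * (20 * D) ≤ m → 19 * m ≤ 40 * r
balanced-factor r o m D refl gap big with ≤-total r o
... | inj₂ o≤r = ≤-trans (*-monoʳ-≤ 19 (+-monoʳ-≤ r o≤r)) (≤-by (2 * r) (lem r))
  where
  lem : ∀ r → 19 * (r + r) + 2 * r ≡ 40 * r
  lem = solve-∀
... | inj₁ r≤o with m≤n⇒∃[o]m+o≡n r≤o
...   | y , refl = +-cancelʳ-≤ (20 * y) _ _ (≤-trans (+-monoʳ-≤ (19 * M) 20y≤m) (≤-reflexive (lem₂ r y)))
  where
  M = r + (r + y)
  lem₁ : ∀ r y → (r + (r + y)) * (r + (r + y)) ≡ 4 * (r * (r + y)) + y * y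
  lem₁ = solve-∀
  lem₂ : ∀ r y → 19 * (r + (r + y)) + (r + (r + y)) ≡ 40 * r + 20 * y
  lem₂ = solve-∀
  lem₃ : ∀ y → (20 * y) * (20 * y) ≡ 20 * (20 * (y * y))
  lem₃ = solve-∀
  lem₄ : ∀ D m → 20 * (20 * (D * m)) ≡ 20 * (20 * D) * m
  lem₄ = solve-∀
  y²≤Dm : y * y ≤ D * M
  y²≤Dm = +-cancelˡ-≤ (4 * (r * (r + y))) _ _ (≤-trans (≤-reflexive (sym (lem₁ r y))) gap)
  20y≤m : 20 * y ≤ M
  20y≤m = ≮⇒≥ λ m<20y → <-irrefl refl (begin-strict
    M * M                  <⟨ *-mono-< m<20y m<20y ⟩
    (20 * y) * (20 * y)    ≡⟨ lem₃ y ⟩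
    20 * (20 * (y * y))    ≤⟨ *-monoʳ-≤ 20 (*-monoʳ-≤ 20 y²≤Dm) ⟩
    20 * (20 * (D * M))    ≡⟨ lem₄ D M ⟩
    20 * (20 * D) * M      ≤⟨ *-monoˡ-≤ M big ⟩
    M * M                  ∎)
    where open ≤-Reasoning

half-product : ∀ x y m → x + y ≡ m → x ≤ y → m * x ≤ 2 * (x * y)
half-product x y m refl x≤y = ≤-trans (*-monoˡ-≤ x (+-monoˡ-≤ y x≤y)) (≤-reflexive (lem x y))
  where
  lem : ∀ x y → (y + y) * x ≡ 2 * (x * y)
  lem = solve-∀

half-sum : ∀ x y m → x + y ≡ m → x ≤ y → 2 * x ≤ m
half-sum x y m refl x≤y = +-monoʳ-≤ x (≤-trans (≤-reflexive (+-identityʳ x)) x≤y)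

module Stability {n : ℕ} (col : Fin n → Fin n → Bool) (sy : ∀ u v → col u v ≡ col v u) (C : ℕ) (n>0 : 0 < n) where
  open Walks col sy

  -- What the correction of a vertex will need: `total` limits the cycles that contain further bad
  -- edges, `local` excludes a vertex that would fit much better into the other class, and
  -- `balanced` keeps both classes close to `n / 2`.
  record NearTemplate : Set where
    field
      cls : Fin n → Bool
      cross : Bool
      total : ∑ (λ v → ∑ λ w → ind (col v w xor template cross cls v w)) ≤ 18 * C * n
      local : ∀ v → 2 * ∑ (λ w → ind (col v w xor template cross cls v w)) ≤ n + 24 * C
      balanced : ∀ ρ → 19 * n ≤ 40 * (size-of cls ρ + 12 * C)

  K : Bool → Fin n → ℕ
  K c u = ∑ λ v → wk c 1 u v * q c u v

  gap : Fin n → ℕ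
  gap u = n * n ∸ 4 * (deg true u * deg false u)

  ∑gap : ∑ gap + 4 * Θ ≡ n * (n * n)
  ∑gap = begin
    ∑ gap + 4 * Θ                                         ≡⟨ cong (∑ gap +_) (sym (∑-*ˡ 4 _)) ⟩
    ∑ gap + ∑ (λ u → 4 * (deg true u * deg false u))      ≡⟨ sym (∑-distrib-+ gap _) ⟩
    ∑ (λ u → gap u + 4 * (deg true u * deg false u))      ≡⟨ ∑-cong (λ u → m∸n+n≡m (4deg*deg≤n² true u)) ⟩
    ∑ {n} (λ _ → n * n)                                   ≡⟨ ∑-const n (n * n) ⟩
    n * (n * n) ∎
    where open ≡-Reasoning

  defect≡∑K : ∀ c → defect c ≡ ∑ (λ u → deg (not c) u * K c u)
  defect≡∑K c = trans (∑-comm (λ v u → deg (not c) u * (wk c 1 u v * q c u v)))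
    (∑-cong (λ u → ∑-*ˡ (deg (not c) u) _))

  -- One potential, so that a single averaging yields a vertex with few odd four-cycles of both
  -- kinds and with nearly equal degrees. The coefficients make each of its three parts sum to at
  -- most `C n⁴`.
  φ : Fin n → ℕ
  φ u = (16 * (deg false u * K true u) + 16 * (deg true u * K false u)) + (n * n) * gap u

  ∑φ : ∑ φ ≡ (16 * defect true + 16 * defect false) + (n * n) * ∑ gap
  ∑φ = trans (∑-distrib-+ (λ u → 16 * (deg false u * K true u) + 16 * (deg true u * K false u)) _)
    (cong₂ _+_ (trans (∑-distrib-+ (λ u → 16 * (deg false u * K true u)) _)
        (cong₂ _+_ (trans (∑-*ˡ 16 _) (cong (16 *_) (sym (defect≡∑K true))))
                   (trans (∑-*ˡ 16 _) (cong (16 *_) (sym (defect≡∑K false))))))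
      (∑-*ˡ (n * n) gap))

  -- s v and a v count the w whose colours towards u and v differ, respectively agree: if s v · a v
  -- is small then v is nearly a twin or nearly an antitwin of u.
  module At (u : Fin n) where
    s a : Fin n → ℕ
    s v = wk true 1 u v + wk false 1 u v
    a v = q true u v + q false u v

    s+a≡n : ∀ v → s v + a v ≡ n
    s+a≡n v = begin
      (wk true 1 u v + wk false 1 u v) + (q true u v + q false u v)  ≡⟨ lem (wk true 1 u v) (wk false 1 u v) (q true u v) (q false u v) ⟩
      (wk true 1 u v + q true u v) + (wk false 1 u v + q false u v)  ≡⟨ cong₂ _+_ (wk+q≡deg true u v) (wk+q≡deg false u v) ⟩
      deg true u + deg false u                                       ≡⟨ deg-split true u ⟩
      n ∎
      where
      open ≡-Reasoning
      lem : ∀ p p′ r r′ → (p + p′) + (r + r′) ≡ (p + r) + (p′ + r′)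
      lem = solve-∀

    deg-via : ∀ c v → q c u v + wk (not c) 1 u v ≡ deg c v
    deg-via c v = begin
      q c u v + wk (not c) 1 u v
        ≡⟨ sym (∑-distrib-+ (λ w → E c u w * E c w v) _) ⟩
      ∑ (λ w → E c u w * E c w v + E (not c) u w * E (not (not c)) w v)
        ≡⟨ ∑-cong (λ w → cong (λ d → E c u w * E c w v + E (not c) u w * E d w v) (not-involutive c)) ⟩
      ∑ (λ w → E c u w * E c w v + E (not c) u w * E c w v)
        ≡⟨ ∑-cong (λ w → trans (sym (*-distribʳ-+ (E c w v) (E c u w) _)) (cong (_* E c w v) (ind-==-split (col u w) c))) ⟩
      ∑ (λ w → 1 * E c w v)
        ≡⟨ ∑-cong (λ w → trans (*-identityˡ _) (E-sym c w v)) ⟩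
      deg c v ∎
      where open ≡-Reasoning

    -- The four numbers `wk` and `q` partition the vertices `w` by the colours of `uw` and `wv`. The
    -- degrees of `u`, those of `v`, and `s`, `a` are the three ways of pairing them up, which
    -- leaves a polynomial identity. It trades `s * a` for odd four-cycles and a difference of
    -- degree products.
    identity : ∀ v → s v * a v + deg true v * deg false v ≡
      2 * (wk true 1 u v * q true u v + wk false 1 u v * q false u v) + deg true u * deg false u
    identity v = begin
      s v * a v + deg true v * deg false v
        ≡⟨ cong₂ (λ x y → s v * a v + x * y) (sym (deg-via true v)) (sym (deg-via false v)) ⟩
      s v * a v + (q true u v + wk false 1 u v) * (q false u v + wk true 1 u v)
        ≡⟨ lem (wk true 1 u v) (wk false 1 u v) (q true u v) (q false u v) ⟩
      2 * (wk true 1 u v * q true u v + wk false 1 u v * q false u v) + (wk true 1 u v + q true u v) * (wk false 1 u v + q false u v)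
        ≡⟨ cong₂ (λ x y → 2 * (wk true 1 u v * q true u v + wk false 1 u v * q false u v) + x * y) (wk+q≡deg true u v) (wk+q≡deg false u v) ⟩
      2 * (wk true 1 u v * q true u v + wk false 1 u v * q false u v) + deg true u * deg false u ∎
      where
      open ≡-Reasoning
      lem : ∀ p p′ r r′ → (p + p′) * (r + r′) + (r + p′) * (r′ + p) ≡ 2 * (p * r + p′ * r′) + (p + r) * (p′ + r′)
      lem = solve-∀

    ∑sa : ∑ (λ v → s v * a v) + Θ ≡ 2 * (K true u + K false u) + n * (deg true u * deg false u)
    ∑sa = begin
      ∑ (λ v → s v * a v) + Θ
        ≡⟨ sym (∑-distrib-+ (λ v → s v * a v) _) ⟩
      ∑ (λ v → s v * a v + deg true v * deg false v)
        ≡⟨ ∑-cong identity ⟩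
      ∑ (λ v → 2 * (wk true 1 u v * q true u v + wk false 1 u v * q false u v) + deg true u * deg false u)
        ≡⟨ ∑-distrib-+ (λ v → 2 * (wk true 1 u v * q true u v + wk false 1 u v * q false u v)) _ ⟩
      ∑ (λ v → 2 * (wk true 1 u v * q true u v + wk false 1 u v * q false u v)) + ∑ {n} (λ _ → deg true u * deg false u)
        ≡⟨ cong₂ _+_ (trans (∑-*ˡ 2 _) (cong (2 *_) (∑-distrib-+ (λ v → wk true 1 u v * q true u v) _))) (∑-const n _) ⟩
      2 * (K true u + K false u) + n * (deg true u * deg false u) ∎
      where open ≡-Reasoning

  -- Comparison with one vertex approximates `col v w` by `f v xor g w`, with one bipartition for
  -- the rows and another for the columns; here the two are merged into one.
  module Symmetrise (f g : Fin n → Bool)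
    (total₁ : ∑ (λ v → ∑ λ w → ind (col v w xor (f v xor g w))) ≤ 6 * C * n)
    (local₁ : ∀ v → 2 * ∑ (λ w → ind (col v w xor (f v xor g w))) ≤ n)
    (balanced₁ : ∀ c → 19 * n ≤ 40 * size-of g c) where

    private instance
      n≢0 : NonZero n
      n≢0 = >-nonZero n>0

    bad₁ : Fin n → Fin n → ℕ
    bad₁ v w = ind (col v w xor (f v xor g w))

    h : Fin n → Bool
    h v = f v xor g v

    #h : Bool → ℕ
    #h κ = ∑ λ v → ind (h v xor κ)

    #h-sum : #h true + #h false ≡ n
    #h-sum = trans (sym (∑-distrib-+ (λ v → ind (h v xor true)) _)) (trans (∑-cong (λ v → lem (h v))) (trans (∑-const n 1) (*-identityʳ n)))
      where
      lem : ∀ x → ind (x xor true) + ind (x xor false) ≡ 1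
      lem true = refl
      lem false = refl

    -- The symmetry of col makes f v xor g w nearly symmetric in v and w, so f xor g is nearly constant.
    #h-product : 2 * (#h true * #h false) ≤ 12 * C * n
    #h-product = begin
      2 * (#h true * #h false)
        ≡⟨ lem₀ (#h true) (#h false) ⟩
      #h true * #h false + #h false * #h true
        ≡⟨ cong₂ _+_ (sym (∑-* (λ v → ind (h v xor true)) _)) (sym (∑-* (λ v → ind (h v xor false)) _)) ⟩
      ∑ (λ v → ∑ λ w → ind (h v xor true) * ind (h w xor false)) + ∑ (λ v → ∑ λ w → ind (h v xor false) * ind (h w xor true))
        ≡⟨ sym (∑₂-distrib-+ (λ v w → ind (h v xor true) * ind (h w xor false)) _) ⟩
      ∑ (λ v → ∑ λ w → ind (h v xor true) * ind (h w xor false) + ind (h v xor false) * ind (h w xor true))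
        ≤⟨ ∑-mono₂ pointwise ⟩
      ∑ (λ v → ∑ λ w → bad₁ v w + bad₁ w v)
        ≡⟨ ∑₂-distrib-+ bad₁ (λ v w → bad₁ w v) ⟩
      ∑ (λ v → ∑ (bad₁ v)) + ∑ (λ v → ∑ λ w → bad₁ w v)
        ≡⟨ cong (∑ (λ v → ∑ (bad₁ v)) +_) (∑-comm (λ v w → bad₁ w v)) ⟩
      ∑ (λ v → ∑ (bad₁ v)) + ∑ (λ v → ∑ (bad₁ v))
        ≤⟨ +-mono-≤ total₁ total₁ ⟩
      6 * C * n + 6 * C * n
        ≡⟨ lem C n ⟩
      12 * C * n ∎
      where
      open ≤-Reasoning
      lem₀ : ∀ x y → 2 * (x * y) ≡ x * y + y * x
      lem₀ = solve-∀
      lem : ∀ C n → 6 * C * n + 6 * C * n ≡ 12 * C * n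
      lem = solve-∀
      pointwise : ∀ v w → ind (h v xor true) * ind (h w xor false) + ind (h v xor false) * ind (h w xor true) ≤ bad₁ v w + bad₁ w v
      pointwise v w = subst (λ d → ind (h v xor true) * ind (h w xor false) + ind (h v xor false) * ind (h w xor true) ≤ bad₁ v w + ind (d xor (f w xor g v)))
        (sy v w)
        (≤-cases₅ (λ c fv gv fw gw → ind ((fv xor gv) xor true) * ind ((fw xor gw) xor false) + ind ((fv xor gv) xor false) * ind ((fw xor gw) xor true))
                  (λ c fv gv fw gw → ind (c xor (fv xor gw)) + ind (c xor (fw xor gv))) tt
                  (col v w) (f v) (g v) (f w) (g w))

    #h-minority : ∃ λ κ → #h κ ≤ 12 * C
    #h-minority with ≤-total (#h true) (#h false)
    ... | inj₁ p = true , *-cancelˡ-≤ n (≤-trans (half-product (#h true) (#h false) n #h-sum p)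
            (≤-trans #h-product (≤-reflexive (*-comm (12 * C) n))))
    ... | inj₂ p = false , *-cancelˡ-≤ n (≤-trans (half-product (#h false) (#h true) n (trans (+-comm (#h false) _) #h-sum) p)
            (≤-trans (≤-reflexive (cong (2 *_) (*-comm (#h false) _))) (≤-trans #h-product (≤-reflexive (*-comm (12 * C) n)))))

    nearTemplate : NearTemplate
    nearTemplate with #h-minority
    ... | κ , minor = record
      { cls = f
      -- For all but at most `12 * C` vertices `g w` is `f w xor κ`, so `f v xor g w` becomes
      -- `f v xor f w xor κ`, which is the template with cross colour `not κ`.
      ; cross = not κ
      ; total = begin
          ∑ (λ v → ∑ λ w → bad v w)                  ≤⟨ ∑-mono row ⟩
          ∑ (λ v → ∑ (bad₁ v) + 12 * C)              ≡⟨ ∑-distrib-+ (λ v → ∑ (bad₁ v)) _ ⟩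
          ∑ (λ v → ∑ (bad₁ v)) + ∑ {n} (λ _ → 12 * C) ≡⟨ cong (∑ (λ v → ∑ (bad₁ v)) +_) (∑-const n (12 * C)) ⟩
          ∑ (λ v → ∑ (bad₁ v)) + n * (12 * C)        ≤⟨ +-monoˡ-≤ _ total₁ ⟩
          6 * C * n + n * (12 * C)                   ≡⟨ lem C n ⟩
          18 * C * n ∎
      ; local = λ v → begin
          2 * ∑ (bad v)                              ≤⟨ *-monoʳ-≤ 2 (row v) ⟩
          2 * (∑ (bad₁ v) + 12 * C)                  ≡⟨ lem₂ (∑ (bad₁ v)) C ⟩
          2 * ∑ (bad₁ v) + 24 * C                    ≤⟨ +-monoˡ-≤ _ (local₁ v) ⟩
          n + 24 * C ∎
      ; balanced = λ ρ → begin
          19 * n                                     ≤⟨ balanced₁ (ρ xor κ) ⟩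
          40 * size-of g (ρ xor κ)                   ≤⟨ *-monoʳ-≤ 40 (deg-size ρ) ⟩
          40 * (size-of f ρ + 12 * C) ∎
      }
      where
      open ≤-Reasoning
      lem : ∀ C n → 6 * C * n + n * (12 * C) ≡ 18 * C * n
      lem = solve-∀
      lem₂ : ∀ x C → 2 * (x + 12 * C) ≡ 2 * x + 24 * C
      lem₂ = solve-∀
      bad : Fin n → Fin n → ℕ
      bad v w = ind (col v w xor template (not κ) f v w)
      row : ∀ v → ∑ (bad v) ≤ ∑ (bad₁ v) + 12 * C
      row v = ≤-trans (∑-mono pointwise) (≤-trans (≤-reflexive (∑-distrib-+ (bad₁ v) _)) (+-monoʳ-≤ _ minor))
        where
        pointwise : ∀ w → bad v w ≤ bad₁ v w + ind (h w xor κ)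
        pointwise w = ≤-cases₅ (λ c fv fw gw k → ind (c xor (not k == (fv xor fw))))
          (λ c fv fw gw k → ind (c xor (fv xor gw)) + ind ((fw xor gw) xor k)) tt (col v w) (f v) (f w) (g w) κ
      deg-size : ∀ ρ → size-of g (ρ xor κ) ≤ size-of f ρ + 12 * C
      deg-size ρ = ≤-trans (∑-mono pointwise) (≤-trans (≤-reflexive (∑-distrib-+ (λ v → ind (f v == ρ)) _)) (+-monoʳ-≤ _ minor))
        where
        pointwise : ∀ v → ind (g v == (ρ xor κ)) ≤ ind (f v == ρ) + ind (h v xor κ)
        pointwise v = ≤-cases₄ (λ r k fv gv → ind (gv == (r xor k)))
          (λ r k fv gv → ind (fv == r) + ind ((fv xor gv) xor k)) tt ρ κ (f v) (g v)

  -- `hyp` comes from `closed-defect` for a colouring that reaches the optimum, with common powers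
  -- of `n` cancelled. Since `8 n² Θ ≤ 2 n⁵`, the term with `C` bounds the defect as well as the
  -- shortfall of `Θ`.
  module _ (hyp : ∀ c → 2 * ((n * n) * (n * (n * n))) + 16 * defect c ≤ 8 * (n * n) * Θ + C * ((n * n) * (n * n)))
           (n≥12C : 12 * C ≤ n) where

    private instance
      n≢0 : NonZero n
      n≢0 = >-nonZero n>0

    defect-small : ∀ c → 16 * defect c ≤ C * ((n * n) * (n * n))
    defect-small c = +-cancelˡ-≤ (2 * ((n * n) * (n * (n * n)))) _ _ (begin
      2 * ((n * n) * (n * (n * n))) + 16 * defect c         ≤⟨ hyp c ⟩
      8 * (n * n) * Θ + C * ((n * n) * (n * n))             ≡⟨ cong (_+ C * ((n * n) * (n * n))) (lem (n * n) Θ) ⟩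
      2 * ((n * n) * (4 * Θ)) + C * ((n * n) * (n * n))     ≤⟨ +-monoˡ-≤ _ (*-monoʳ-≤ 2 (*-monoʳ-≤ (n * n) 4Θ≤n³)) ⟩
      2 * ((n * n) * (n * (n * n))) + C * ((n * n) * (n * n)) ∎)
      where
      open ≤-Reasoning
      lem : ∀ m t → 8 * m * t ≡ 2 * (m * (4 * t))
      lem = solve-∀

    Θ-large : 2 * (n * (n * n)) ≤ 8 * Θ + C * (n * n)
    Θ-large = *-cancelˡ-≤ (n * n) {{m*n≢0 n n}} (begin
      (n * n) * (2 * (n * (n * n)))                       ≡⟨ lem (n * n) (n * (n * n)) ⟩
      2 * ((n * n) * (n * (n * n)))                       ≤⟨ m≤m+n _ (16 * defect true) ⟩
      2 * ((n * n) * (n * (n * n))) + 16 * defect true    ≤⟨ hyp true ⟩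
      8 * (n * n) * Θ + C * ((n * n) * (n * n))           ≡⟨ lem₂ (n * n) Θ C ⟩
      (n * n) * (8 * Θ + C * (n * n)) ∎)
      where
      open ≤-Reasoning
      lem : ∀ m t → m * (2 * t) ≡ 2 * (m * t)
      lem = solve-∀
      lem₂ : ∀ m t C → 8 * m * t + C * (m * m) ≡ m * (8 * t + C * m)
      lem₂ = solve-∀

    ∑gap-small : 2 * ∑ gap ≤ C * (n * n)
    ∑gap-small = +-cancelˡ-≤ (8 * Θ) _ _ (begin
      8 * Θ + 2 * ∑ gap        ≡⟨ lem Θ (∑ gap) ⟩
      2 * (∑ gap + 4 * Θ)      ≡⟨ cong (2 *_) ∑gap ⟩
      2 * (n * (n * n))        ≤⟨ Θ-large ⟩
      8 * Θ + C * (n * n) ∎)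
      where
      open ≤-Reasoning
      lem : ∀ t g → 8 * t + 2 * g ≡ 2 * (g + 4 * t)
      lem = solve-∀

    ∑φ-small : ∑ φ ≤ n * (3 * C * (n * (n * n)))
    ∑φ-small = begin
      ∑ φ
        ≡⟨ ∑φ ⟩
      (16 * defect true + 16 * defect false) + (n * n) * ∑ gap
        ≤⟨ +-mono-≤ (+-mono-≤ (defect-small true) (defect-small false)) (*-monoʳ-≤ (n * n) (≤-trans (m≤m+n (∑ gap) _) ∑gap-small)) ⟩
      (C * ((n * n) * (n * n)) + C * ((n * n) * (n * n))) + (n * n) * (C * (n * n))
        ≡⟨ lem n C ⟩
      n * (3 * C * (n * (n * n))) ∎
      where
      open ≤-Reasoning
      lem : ∀ n C → (C * ((n * n) * (n * n)) + C * ((n * n) * (n * n))) + (n * n) * (C * (n * n)) ≡ n * (3 * C * (n * (n * n)))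
      lem = solve-∀

    module Centre (u : Fin n) (φu : φ u ≤ 3 * C * (n * (n * n))) where
      open At u

      gap-small : n * n ≤ 4 * (deg true u * deg false u) + 3 * C * n
      gap-small = begin
        n * n                                             ≡⟨ sym (m∸n+n≡m (4deg*deg≤n² true u)) ⟩
        gap u + 4 * (deg true u * deg false u)            ≤⟨ +-monoˡ-≤ _ gapu ⟩
        3 * C * n + 4 * (deg true u * deg false u)        ≡⟨ +-comm (3 * C * n) _ ⟩
        4 * (deg true u * deg false u) + 3 * C * n ∎
        where
        open ≤-Reasoning
        lem : ∀ n C → 3 * C * (n * (n * n)) ≡ (n * n) * (3 * C * n)
        lem = solve-∀
        gapu : gap u ≤ 3 * C * n
        gapu = *-cancelˡ-≤ (n * n) {{m*n≢0 n n}} (≤-trans (≤-trans (m≤n+m _ _) φu) (≤-reflexive (lem n C)))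

      deg*deg-large : 3 * (n * n) ≤ 16 * (deg true u * deg false u)
      deg*deg-large = +-cancelˡ-≤ (n * n) _ _ (begin
        n * n + 3 * (n * n)                                   ≡⟨ lem (n * n) ⟩
        4 * (n * n)                                           ≤⟨ *-monoʳ-≤ 4 gap-small ⟩
        4 * (4 * (deg true u * deg false u) + 3 * C * n)      ≡⟨ lem₂ (deg true u * deg false u) C n ⟩
        12 * C * n + 16 * (deg true u * deg false u)          ≤⟨ +-monoˡ-≤ _ (*-monoˡ-≤ n n≥12C) ⟩
        n * n + 16 * (deg true u * deg false u) ∎)
        where
        open ≤-Reasoning
        lem : ∀ m → m + 3 * m ≡ 4 * m
        lem = solve-∀
        lem₂ : ∀ x C n → 4 * (4 * x + 3 * C * n) ≡ 12 * C * n + 16 * x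
        lem₂ = solve-∀

      deg≤n : ∀ c → deg c u ≤ n
      deg≤n c = ≤-trans (m≤m+n _ _) (≤-reflexive (deg-split c u))

      3n≤16deg : ∀ c → 3 * n ≤ 16 * deg c u
      3n≤16deg c = *-cancelʳ-≤ _ _ n (begin
        3 * n * n                               ≡⟨ *-assoc 3 n n ⟩
        3 * (n * n)                             ≤⟨ deg*deg-large ⟩
        16 * (deg true u * deg false u)         ≡⟨ cong (16 *_) (sym (deg*deg c u)) ⟩
        16 * (deg c u * deg (not c) u)          ≤⟨ *-monoʳ-≤ 16 (*-monoʳ-≤ (deg c u) (deg≤n (not c))) ⟩
        16 * (deg c u * n)                      ≡⟨ sym (*-assoc 16 (deg c u) n) ⟩
        16 * deg c u * n ∎)
        where open ≤-Reasoning

      -- The odd four-cycles enter `φ` weighted by degrees of `u`; these are at least `3n / 16` and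
      -- can be divided out.
      K-small : K true u + K false u ≤ C * (n * n)
      K-small = *-cancelˡ-≤ (3 * n) {{m*n≢0 3 n}} (begin
        3 * n * (K true u + K false u)
          ≡⟨ *-distribˡ-+ (3 * n) (K true u) (K false u) ⟩
        3 * n * K true u + 3 * n * K false u
          ≤⟨ +-mono-≤ (*-monoˡ-≤ (K true u) (3n≤16deg false)) (*-monoˡ-≤ (K false u) (3n≤16deg true)) ⟩
        16 * deg false u * K true u + 16 * deg true u * K false u
          ≡⟨ cong₂ _+_ (*-assoc 16 (deg false u) _) (*-assoc 16 (deg true u) _) ⟩
        16 * (deg false u * K true u) + 16 * (deg true u * K false u)
          ≤⟨ ≤-trans (m≤m+n _ _) φu ⟩
        3 * C * (n * (n * n))
          ≡⟨ lem n C ⟩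
        3 * n * (C * (n * n)) ∎)
        where
        open ≤-Reasoning
        lem : ∀ n C → 3 * C * (n * (n * n)) ≡ 3 * n * (C * (n * n))
        lem = solve-∀

      -- In `∑sa` the term `n * (deg true u * deg false u)` is at most `n³ / 4`, and by `Θ-large`
      -- this exceeds `Θ` by at most `C n² / 8`. What remains are the odd four-cycles at `u`.
      ∑sa-small : ∑ (λ v → s v * a v) ≤ 3 * C * (n * n)
      ∑sa-small = *-cancelˡ-≤ 8 (+-cancelˡ-≤ (8 * Θ) _ _ (begin
        8 * Θ + 8 * ∑ (λ v → s v * a v)
          ≡⟨ lem (∑ (λ v → s v * a v)) Θ ⟩
        8 * (∑ (λ v → s v * a v) + Θ)
          ≡⟨ cong (8 *_) ∑sa ⟩
        8 * (2 * (K true u + K false u) + n * (deg true u * deg false u))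
          ≡⟨ lem₂ (K true u + K false u) n (deg true u * deg false u) ⟩
        16 * (K true u + K false u) + 2 * (n * (4 * (deg true u * deg false u)))
          ≤⟨ +-mono-≤ (*-monoʳ-≤ 16 K-small) (*-monoʳ-≤ 2 (*-monoʳ-≤ n (4deg*deg≤n² true u))) ⟩
        16 * (C * (n * n)) + 2 * (n * (n * n))
          ≤⟨ +-monoʳ-≤ (16 * (C * (n * n))) Θ-large ⟩
        16 * (C * (n * n)) + (8 * Θ + C * (n * n))
          ≤⟨ ≤-by (7 * (C * (n * n))) (lem₃ (C * (n * n)) Θ) ⟩
        8 * Θ + 8 * (3 * (C * (n * n)))
          ≡⟨ cong (λ k → 8 * Θ + 8 * k) (sym (*-assoc 3 C (n * n))) ⟩
        8 * Θ + 8 * (3 * C * (n * n)) ∎))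
        where
        open ≤-Reasoning
        lem : ∀ x t → 8 * t + 8 * x ≡ 8 * (x + t)
        lem = solve-∀
        lem₂ : ∀ k n x → 8 * (2 * k + n * x) ≡ 16 * k + 2 * (n * (4 * x))
        lem₂ = solve-∀
        lem₃ : ∀ y t → 16 * y + (8 * t + y) + 7 * y ≡ 8 * t + 8 * (3 * y)
        lem₃ = solve-∀

      -- Majority vote: `v` counts as an antitwin of `u` if it disagrees with `u` more often than it
      -- agrees. Its row of `bad₁` then sums to the smaller of `s v` and `a v`; as the larger is at
      -- least `n / 2`, both bounds of `bad₁-row` follow.
      g f : Fin n → Bool
      g w = col u w
      f v = a v <ᵇ s v

      bad₁ : Fin n → Fin n → ℕ
      bad₁ v w = ind (col v w xor (f v xor g w))

      ∑-differ : ∀ v → ∑ (λ w → ind (col v w xor g w)) ≡ s v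
      ∑-differ v = trans (∑-cong (λ w → trans (cong (λ d → ind (d xor g w)) (sy v w)) (lem (g w) (col w v)))) (∑-distrib-+ (λ w → E true u w * E false w v) _)
        where
        lem : ∀ x y → ind (y xor x) ≡ ind (x == true) * ind (y == false) + ind (x == false) * ind (y == true)
        lem true true = refl
        lem true false = refl
        lem false true = refl
        lem false false = refl

      ∑-agree : ∀ v → ∑ (λ w → ind (col v w xor not (g w))) ≡ a v
      ∑-agree v = trans (∑-cong (λ w → trans (cong (λ d → ind (d xor not (g w))) (sy v w)) (lem (g w) (col w v)))) (∑-distrib-+ (λ w → E true u w * E true w v) _)
        where
        lem : ∀ x y → ind (y xor not x) ≡ ind (x == true) * ind (y == true) + ind (x == false) * ind (y == false)
        lem true true = refl
        lem true false = refl
        lem false true = refl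
        lem false false = refl

      bad₁-row : ∀ v → n * ∑ (bad₁ v) ≤ 2 * (s v * a v) × 2 * ∑ (bad₁ v) ≤ n
      bad₁-row v with a v <ᵇ s v in eq
      ... | true = subst (λ k → n * k ≤ 2 * (s v * a v) × 2 * k ≤ n) (sym (∑-agree v))
          ( subst (n * a v ≤_) (cong (2 *_) (*-comm (a v) (s v))) (half-product (a v) (s v) n a+s≡n a≤s)
          , half-sum (a v) (s v) n a+s≡n a≤s )
        where
        a≤s : a v ≤ s v
        a≤s = <⇒≤ (<ᵇ⇒< (a v) (s v) (subst T (sym eq) tt))
        a+s≡n : a v + s v ≡ n
        a+s≡n = trans (+-comm (a v) _) (s+a≡n v)
      ... | false = subst (λ k → n * k ≤ 2 * (s v * a v) × 2 * k ≤ n) (sym (∑-differ v))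
          ( half-product (s v) (a v) n (s+a≡n v) s≤a , half-sum (s v) (a v) n (s+a≡n v) s≤a )
        where
        s≤a : s v ≤ a v
        s≤a = ≮⇒≥ (λ p → subst T eq (<⇒<ᵇ p))

      bad₁-total : ∑ (λ v → ∑ (bad₁ v)) ≤ 6 * C * n
      bad₁-total = *-cancelˡ-≤ n (begin
        n * ∑ (λ v → ∑ (bad₁ v))         ≡⟨ sym (∑-*ˡ n _) ⟩
        ∑ (λ v → n * ∑ (bad₁ v))         ≤⟨ ∑-mono (λ v → proj₁ (bad₁-row v)) ⟩
        ∑ (λ v → 2 * (s v * a v))        ≡⟨ ∑-*ˡ 2 _ ⟩
        2 * ∑ (λ v → s v * a v)          ≤⟨ *-monoʳ-≤ 2 ∑sa-small ⟩
        2 * (3 * C * (n * n))            ≡⟨ lem C n ⟩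
        n * (6 * C * n) ∎)
        where
        open ≤-Reasoning
        lem : ∀ C n → 2 * (3 * C * (n * n)) ≡ n * (6 * C * n)
        lem = solve-∀

      deg-balanced : 20 * (20 * (3 * C)) ≤ n → ∀ c → 19 * n ≤ 40 * deg c u
      deg-balanced n-big c = balanced-factor (deg c u) (deg (not c) u) n (3 * C) (deg-split c u)
        (subst (λ k → n * n ≤ 4 * k + 3 * C * n) (sym (deg*deg c u)) gap-small) n-big

      nearTemplate : 20 * (20 * (3 * C)) ≤ n → NearTemplate
      nearTemplate n-big = Symmetrise.nearTemplate f g bad₁-total (λ v → proj₂ (bad₁-row v)) (deg-balanced n-big)

    stability : 20 * (20 * (3 * C)) ≤ n → NearTemplate
    stability = Centre.nearTemplate (proj₁ centre) (proj₂ centre)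
      where
      centre : ∃ λ u → φ u ≤ 3 * C * (n * (n * n))
      centre = ∑-average n>0 φ (3 * C * (n * (n * n))) ∑φ-small

⌊⌋-true : {A : Set} (d : Dec A) → A → ⌊ d ⌋ ≡ true
⌊⌋-true d a = trans (isYes≗does d) (dec-true d a)

⌊⌋-false : {A : Set} (d : Dec A) → ¬ A → ⌊ d ⌋ ≡ false
⌊⌋-false d ¬a = trans (isYes≗does d) (dec-false d ¬a)

-- Closed alternating sequences

sumSeq : (k : ℕ) → (List (Fin n) → ℕ) → ℕ
sumSeq zero F = F []
sumSeq (suc k) F = ∑ λ x → sumSeq k (λ s → F (x ∷ s))

sumSeq-cong : ∀ k {F G : List (Fin n) → ℕ} → (∀ s → length s ≡ k → F s ≡ G s) → sumSeq k F ≡ sumSeq k G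
sumSeq-cong zero h = h [] refl
sumSeq-cong (suc k) h = ∑-cong (λ x → sumSeq-cong k (λ s e → h (x ∷ s) (cong suc e)))

sumSeq-mono : ∀ k {F G : List (Fin n) → ℕ} → (∀ s → length s ≡ k → F s ≤ G s) → sumSeq k F ≤ sumSeq k G
sumSeq-mono zero h = h [] refl
sumSeq-mono (suc k) h = ∑-mono (λ x → sumSeq-mono k (λ s e → h (x ∷ s) (cong suc e)))

sumSeq-+ : ∀ k (F G : List (Fin n) → ℕ) → sumSeq k (λ s → F s + G s) ≡ sumSeq k F + sumSeq k G
sumSeq-+ zero F G = refl
sumSeq-+ (suc k) F G = trans (∑-cong (λ x → sumSeq-+ k (λ s → F (x ∷ s)) (λ s → G (x ∷ s)))) (∑-distrib-+ (λ x → sumSeq k (λ s → F (x ∷ s))) _)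

sumSeq-*ˡ : ∀ k a (F : List (Fin n) → ℕ) → sumSeq k (λ s → a * F s) ≡ a * sumSeq k F
sumSeq-*ˡ zero a F = refl
sumSeq-*ˡ (suc k) a F = trans (∑-cong (λ x → sumSeq-*ˡ k a (λ s → F (x ∷ s)))) (∑-*ˡ a _)

sumSeq-const : ∀ k a → sumSeq {n} k (λ _ → a) ≡ n ^ k * a
sumSeq-const zero a = sym (+-identityʳ a)
sumSeq-const {n} (suc k) a = trans (∑-cong (λ x → sumSeq-const k a)) (trans (∑-const n (n ^ k * a)) (sym (*-assoc n (n ^ k) a)))

sumSeq-∑ : ∀ {m} k (F : List (Fin n) → Fin m → ℕ) → sumSeq k (λ s → ∑ (F s)) ≡ ∑ (λ y → sumSeq k (λ s → F s y))
sumSeq-∑ zero F = refl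
sumSeq-∑ (suc k) F = trans (∑-cong (λ x → sumSeq-∑ k (λ s → F (x ∷ s)))) (∑-comm (λ x y → sumSeq k (λ s → F (x ∷ s) y)))

sumSeq-snoc : ∀ k (F : List (Fin n) → ℕ) → sumSeq (suc k) F ≡ sumSeq k (λ s → ∑ λ y → F (s ++ [ y ]))
sumSeq-snoc zero F = refl
sumSeq-snoc (suc k) F = ∑-cong (λ x → sumSeq-snoc k (λ s → F (x ∷ s)))

sumSeq-rotate : ∀ k (F : List (Fin n) → ℕ) → sumSeq k (F ∘ rotate) ≡ sumSeq k F
sumSeq-rotate zero F = refl
sumSeq-rotate (suc k) F = trans (sym (sumSeq-∑ k (λ s y → F (s ++ [ y ])))) (sym (sumSeq-snoc k F))

mem : Fin n → List (Fin n) → Bool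
mem x = any (λ y → ⌊ x ≟ᶠ y ⌋)

≟-refl : (x : Fin n) → ⌊ x ≟ᶠ x ⌋ ≡ true
≟-refl x = ⌊⌋-true (x ≟ᶠ x) refl

≟-sym : (x y : Fin n) → ⌊ x ≟ᶠ y ⌋ ≡ ⌊ y ≟ᶠ x ⌋
≟-sym x y with x ≟ᶠ y
... | yes refl = sym (≟-refl x)
... | no x≢y = sym (⌊⌋-false (y ≟ᶠ x) (x≢y ∘ sym))

mem-shift : (z x : Fin n) (s t : List (Fin n)) → mem z (s ++ x ∷ t) ≡ ⌊ z ≟ᶠ x ⌋ ∨ mem z (s ++ t)
mem-shift z x [] t = refl
mem-shift z x (y ∷ s) t = trans (cong (⌊ z ≟ᶠ y ⌋ ∨_) (mem-shift z x s t)) (lem ⌊ z ≟ᶠ y ⌋ ⌊ z ≟ᶠ x ⌋ (mem z (s ++ t)))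
  where
  lem : ∀ a b c → a ∨ (b ∨ c) ≡ b ∨ (a ∨ c)
  lem true true c = refl
  lem true false c = refl
  lem false b c = refl

distinct-shift : (x : Fin n) (s t : List (Fin n)) → distinctᵇ (s ++ x ∷ t) ≡ distinctᵇ (x ∷ s ++ t)
distinct-shift x [] t = refl
distinct-shift x (z ∷ s) t = begin
  not (mem z (s ++ x ∷ t)) ∧ distinctᵇ (s ++ x ∷ t)
    ≡⟨ cong₂ (λ a b → not a ∧ b) (mem-shift z x s t) (distinct-shift x s t) ⟩
  not (⌊ z ≟ᶠ x ⌋ ∨ mem z (s ++ t)) ∧ (not (mem x (s ++ t)) ∧ distinctᵇ (s ++ t))
    ≡⟨ cong (λ a → not (a ∨ mem z (s ++ t)) ∧ (not (mem x (s ++ t)) ∧ distinctᵇ (s ++ t))) (≟-sym z x) ⟩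
  not (⌊ x ≟ᶠ z ⌋ ∨ mem z (s ++ t)) ∧ (not (mem x (s ++ t)) ∧ distinctᵇ (s ++ t))
    ≡⟨ lem ⌊ x ≟ᶠ z ⌋ (mem z (s ++ t)) (mem x (s ++ t)) (distinctᵇ (s ++ t)) ⟩
  not (⌊ x ≟ᶠ z ⌋ ∨ mem x (s ++ t)) ∧ (not (mem z (s ++ t)) ∧ distinctᵇ (s ++ t)) ∎
  where
  open ≡-Reasoning
  lem : ∀ a b c d → not (a ∨ b) ∧ (not c ∧ d) ≡ not (a ∨ c) ∧ (not b ∧ d)
  lem true b c d = refl
  lem false true true d = refl
  lem false true false d = refl
  lem false false true d = refl
  lem false false false d = refl

∑-delta : (z : Fin n) (F : Fin n → ℕ) → ∑ (λ x → ind ⌊ x ≟ᶠ z ⌋ * F x) ≡ F z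
∑-delta {n} z F = begin
  ∑ (λ x → ind ⌊ x ≟ᶠ z ⌋ * F x)     ≡⟨ ∑-cong pointwise ⟩
  ∑ (λ x → ind ⌊ x ≟ᶠ z ⌋ * F z)     ≡⟨ ∑-*ʳ (F z) _ ⟩
  ∑ (λ x → ind ⌊ x ≟ᶠ z ⌋) * F z     ≡⟨ cong (_* F z) (total z) ⟩
  1 * F z                             ≡⟨ *-identityˡ (F z) ⟩
  F z ∎
  where
  open ≡-Reasoning
  pointwise : ∀ x → ind ⌊ x ≟ᶠ z ⌋ * F x ≡ ind ⌊ x ≟ᶠ z ⌋ * F z
  pointwise x with x ≟ᶠ z
  ... | yes refl = refl
  ... | no _ = refl
  suc-≟ : ∀ {m} (x y : Fin m) → ⌊ Fin.suc x ≟ᶠ suc y ⌋ ≡ ⌊ x ≟ᶠ y ⌋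
  suc-≟ x y with x ≟ᶠ y
  ... | yes _ = refl
  ... | no _ = refl
  total : ∀ {m} (z : Fin m) → ∑ (λ x → ind ⌊ x ≟ᶠ z ⌋) ≡ 1
  total {suc m} zero = trans (∑-suc _) (cong suc (trans (∑-const m 0) (*-zeroʳ m)))
  total {suc m} (suc z) = trans (∑-suc _) (trans (∑-cong (λ x → cong ind (suc-≟ x z))) (total z))

alt-2* : ∀ t c → alt (2 * t) c ≡ c
alt-2* t c = trans (cong (λ k → alt (t + k) c) (+-identityʳ t)) (double t c)
  where
  double : ∀ t c → alt (t + t) c ≡ c
  double zero c = refl
  double (suc t) c = trans (cong (λ k → alt k (not c)) (+-suc t t)) (trans (cong (alt (t + t)) (not-involutive c)) (double t c))

∉⇒All≢ : (z : Fin n) (s : List (Fin n)) → mem z s ≡ false → All (_≢ z) s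
∉⇒All≢ z [] h = []
∉⇒All≢ z (x ∷ s) h with z ≟ᶠ x | h
... | no z≢x | h = (z≢x ∘ sym) ∷ ∉⇒All≢ z s h
... | yes _ | ()

alt-*4 : ∀ j c → alt (j * 4) c ≡ c
alt-*4 zero c = refl
alt-*4 (suc j) c = trans (cong (λ d → alt (j * 4) (not (not d))) (not-involutive c)) (trans (cong (alt (j * 4)) (not-involutive c)) (alt-*4 j c))

==⇒≡ : ∀ x y → (x == y) ≡ true → x ≡ y
==⇒≡ true true _ = refl
==⇒≡ false false _ = refl

module Sequences {n : ℕ} (col : Fin n → Fin n → Bool) where

  altPath : Bool → Fin n → List (Fin n) → Fin n → Bool
  altPath c u [] z = col u z == c
  altPath c u (w ∷ ws) z = (col u w == c) ∧ altPath (not c) w ws z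

  valid : Bool → List (Fin n) → Bool
  valid c [] = false
  valid c (x ∷ s) = distinctᵇ (x ∷ s) ∧ altPath c x s x

  N : Bool → ℕ → ℕ
  N c m = sumSeq m (λ s → ind (valid c s))

  altPath-snoc : ∀ c u s y z → altPath c u (s ++ [ y ]) z ≡ altPath c u s y ∧ (col y z == alt (suc (length s)) c)
  altPath-snoc c u [] y z = refl
  altPath-snoc c u (w ∷ s) y z = trans (cong ((col u w == c) ∧_) (altPath-snoc (not c) w s y z)) (sym (∧-assoc (col u w == c) _ _))

  -- The hypothesis on `alt` says that the length is even; then the edge which rotation moves to the
  -- end has the colour that alternation demands there.
  valid-rotate : ∀ c s → 2 ≤ length s → (∀ d → alt (length s) d ≡ d) → valid (not c) (rotate s) ≡ valid c s
  valid-rotate c (x ∷ []) (s≤s ()) even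
  valid-rotate c (x ∷ y ∷ s) _ even = cong₂ _∧_ dist path
    where
    dist : distinctᵇ (y ∷ s ++ [ x ]) ≡ distinctᵇ (x ∷ y ∷ s)
    dist = trans (distinct-shift x (y ∷ s) []) (cong (λ t → distinctᵇ (x ∷ y ∷ t)) (++-identityʳ s))
    path : altPath (not c) y (s ++ [ x ]) y ≡ (col x y == c) ∧ altPath (not c) y s x
    path = trans (altPath-snoc (not c) y s x y) (trans (cong (λ d → altPath (not c) y s x ∧ (col x y == d)) (even c)) (∧-comm (altPath (not c) y s x) _))

  valid-rotate-length : ∀ m → 2 ≤ m → (∀ d → alt m d ≡ d) → ∀ c s → length s ≡ m → valid (not c) (rotate s) ≡ valid c s
  valid-rotate-length m 2≤m even c s refl = valid-rotate c s 2≤m even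

  N-swap : ∀ m → 2 ≤ m → (∀ d → alt m d ≡ d) → ∀ c → N c m ≡ N (not c) m
  N-swap m 2≤m even c = trans (sumSeq-cong m (λ s e → cong ind (sym (valid-rotate-length m 2≤m even c s e))))
    (sumSeq-rotate m (λ s → ind (valid (not c) s)))

  R : Bool → ℕ → Fin n → ℕ
  R c k z = sumSeq k (λ s → ind (valid c (z ∷ s)))

  Rsum : ℕ → Bool → ℕ → Fin n → ℕ
  Rsum zero c k z = 0
  Rsum (suc j) c k z = R c k z + Rsum j (not c) k z

  avoiding : Bool → ℕ → Fin n → ℕ
  avoiding c m z = sumSeq m (λ s → ind (valid c s ∧ not (mem z s)))

  occ : Fin n → List (Fin n) → ℕ
  occ z [] = 0
  occ z (x ∷ s) = ind ⌊ x ≟ᶠ z ⌋ + occ z s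

  occ-absent : ∀ z s → mem z s ≡ false → occ z s ≡ 0
  occ-absent z [] h = refl
  occ-absent z (x ∷ s) h with z ≟ᶠ x | h
  ... | yes _ | ()
  ... | no z≢x | h = trans (cong (λ b → ind b + occ z s) (⌊⌋-false (x ≟ᶠ z) (z≢x ∘ sym))) (occ-absent z s h)

  occ-distinct : ∀ z s → distinctᵇ s ≡ true → ind (not (mem z s)) + occ z s ≡ 1
  occ-distinct z [] h = refl
  occ-distinct z (x ∷ s) h with z ≟ᶠ x
  ... | no z≢x = trans (cong (λ b → ind (not (mem z s)) + (ind b + occ z s)) (⌊⌋-false (x ≟ᶠ z) (z≢x ∘ sym))) (occ-distinct z s (right (not (mem x s)) h))
    where
    right : ∀ a {b} → a ∧ b ≡ true → b ≡ true
    right true e = e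
  ... | yes refl = trans (cong (λ b → ind b + occ x s) (≟-refl x)) (cong suc (occ-absent x s (left (mem x s) h)))
    where
    left : ∀ a {b} → not a ∧ b ≡ true → a ≡ false
    left false e = refl

  valid-distinct : ∀ c s → valid c s ≡ true → distinctᵇ s ≡ true
  valid-distinct c (x ∷ s) h with distinctᵇ (x ∷ s)
  ... | true = refl

  ++-take : (s : List (Fin n)) (y : Fin n) (j : ℕ) → j ≤ length s → take j (s ++ [ y ]) ≡ take j s
  ++-take s y zero _ = refl
  ++-take (x ∷ s) y (suc j) (s≤s h) = cong (x ∷_) (++-take s y j h)

  take-length : (s : List (Fin n)) → take (length s) s ≡ s
  take-length [] = refl
  take-length (x ∷ s) = cong (x ∷_) (take-length s)

  -- Every position of z in a closed sequence becomes the first one after rotation, and each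
  -- rotation step swaps the two starting colours.
  occ-Rsum : ∀ k → 1 ≤ k → (∀ d → alt (suc k) d ≡ d) → ∀ z j → j ≤ suc k → ∀ c →
    sumSeq (suc k) (λ s → ind (valid c s) * occ z (take j s)) ≡ Rsum j c k z
  occ-Rsum k 1≤k even z zero _ c = trans (sumSeq-cong (suc k) (λ s _ → *-zeroʳ (ind (valid c s)))) (trans (sumSeq-const (suc k) 0) (*-zeroʳ (n ^ suc k)))
  occ-Rsum k 1≤k even z (suc j) (s≤s j≤k) c = begin
    sumSeq (suc k) (λ s → ind (valid c s) * occ z (take (suc j) s))
      ≡⟨ sumSeq-cong (suc k) split ⟩
    sumSeq (suc k) (λ s → first s + ind (valid (not c) (rotate s)) * occ z (take j (rotate s)))
      ≡⟨ sumSeq-+ (suc k) first (λ s → ind (valid (not c) (rotate s)) * occ z (take j (rotate s))) ⟩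
    sumSeq (suc k) first + sumSeq (suc k) (λ s → ind (valid (not c) (rotate s)) * occ z (take j (rotate s)))
      ≡⟨ cong₂ _+_ head-part (sumSeq-rotate (suc k) (λ s → ind (valid (not c) s) * occ z (take j s))) ⟩
    R c k z + sumSeq (suc k) (λ s → ind (valid (not c) s) * occ z (take j s))
      ≡⟨ cong (R c k z +_) (occ-Rsum k 1≤k even z j (m≤n⇒m≤1+n j≤k) (not c)) ⟩
    R c k z + Rsum j (not c) k z ∎
    where
    open ≡-Reasoning
    first : List (Fin n) → ℕ
    first [] = 0
    first (x ∷ s) = ind ⌊ x ≟ᶠ z ⌋ * ind (valid c (x ∷ s))
    split : ∀ s → length s ≡ suc k →
      ind (valid c s) * occ z (take (suc j) s) ≡ first s + ind (valid (not c) (rotate s)) * occ z (take j (rotate s))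
    split (x ∷ s) e = trans (*-distribˡ-+ (ind (valid c (x ∷ s))) (ind ⌊ x ≟ᶠ z ⌋) _)
      (cong₂ _+_ (*-comm (ind (valid c (x ∷ s))) _)
        (cong₂ _*_ (cong ind (sym (valid-rotate-length (suc k) (s≤s 1≤k) even c (x ∷ s) e)))
          (cong (occ z) (sym (++-take s x j (subst (j ≤_) (sym (suc-injective e)) j≤k))))))
    head-part : sumSeq (suc k) first ≡ R c k z
    head-part = trans (∑-cong (λ x → sumSeq-*ˡ k (ind ⌊ x ≟ᶠ z ⌋) (λ s → ind (valid c (x ∷ s))))) (∑-delta z (λ x → R c k x))

  -- Distinctness lets `z` occur at most once. Recolouring edges at `z` affects only the second
  -- summand.
  N-split : ∀ k → 1 ≤ k → (∀ d → alt (suc k) d ≡ d) → ∀ c z → N c (suc k) ≡ avoiding c (suc k) z + Rsum (suc k) c k z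
  N-split k 1≤k even c z = begin
    N c (suc k)
      ≡⟨ sumSeq-cong (suc k) pointwise ⟩
    sumSeq (suc k) (λ s → ind (valid c s ∧ not (mem z s)) + ind (valid c s) * occ z (take (suc k) s))
      ≡⟨ sumSeq-+ (suc k) (λ s → ind (valid c s ∧ not (mem z s))) (λ s → ind (valid c s) * occ z (take (suc k) s)) ⟩
    avoiding c (suc k) z + sumSeq (suc k) (λ s → ind (valid c s) * occ z (take (suc k) s))
      ≡⟨ cong (avoiding c (suc k) z +_) (occ-Rsum k 1≤k even z (suc k) ≤-refl c) ⟩
    avoiding c (suc k) z + Rsum (suc k) c k z ∎
    where
    open ≡-Reasoning
    pointwise : ∀ s → length s ≡ suc k → ind (valid c s) ≡ ind (valid c s ∧ not (mem z s)) + ind (valid c s) * occ z (take (suc k) s)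
    pointwise s e with valid c s in v
    ... | false = refl
    ... | true = trans (sym (occ-distinct z s (valid-distinct c s v)))
          (cong (ind (not (mem z s)) +_) (trans (cong (occ z) (sym (trans (cong (λ j → take j s) (sym e)) (take-length s)))) (sym (+-identityʳ _))))

module _ {n : ℕ} (col col′ : Fin n → Fin n → Bool) where
  private
    module S = Sequences col
    module S′ = Sequences col′

  Rsum-mono : ∀ k z → (∀ c → S.R c k z ≤ S′.R c k z) → ∀ j c → S.Rsum j c k z ≤ S′.Rsum j c k z
  Rsum-mono k z h zero c = z≤n
  Rsum-mono k z h (suc j) c = +-mono-≤ (h c) (Rsum-mono k z h j (not c))

  -- `Q` selects the vertices on which the colourings are compared: all of them for `N-cong`, those
  -- other than `z` for sequences that avoid `z`. Distinctness supplies `v ≢ w` for consecutive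
  -- vertices.
  altPath-cong : (Q : Fin n → Set) → (∀ v w → v ≢ w → Q v → Q w → col v w ≡ col′ v w) →
    ∀ c u s z → distinctᵇ (z ∷ u ∷ s) ≡ true → All Q (z ∷ u ∷ s) → S.altPath c u s z ≡ S′.altPath c u s z
  altPath-cong Q agree c u [] z d (qz ∷ qu ∷ []) = cong (_== c) (agree u z u≢z qu qz)
    where
    u≢z : u ≢ z
    u≢z refl with () ← trans (sym (cong (λ b → not (b ∨ false) ∧ true) (≟-refl u))) d
  altPath-cong Q agree c u (w ∷ s) z d (qz ∷ qu ∷ qw ∷ qs) =
    cong₂ _∧_ (cong (_== c) (agree u w u≢w qu qw)) (altPath-cong Q agree (not c) w s z d′ (qz ∷ qw ∷ qs))
    where
    lem : ∀ a b e f g h i → not (a ∨ (b ∨ e)) ∧ (not (f ∨ g) ∧ (not h ∧ i)) ≡ true → f ≡ false × not (b ∨ e) ∧ (not h ∧ i) ≡ true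
    lem false false false false false false true _ = refl , refl
    parts = lem ⌊ z ≟ᶠ u ⌋ ⌊ z ≟ᶠ w ⌋ (mem z s) ⌊ u ≟ᶠ w ⌋ (mem u s) (mem w s) (distinctᵇ s) d
    u≢w : u ≢ w
    u≢w refl with () ← trans (sym (≟-refl u)) (proj₁ parts)
    d′ = proj₂ parts

  valid-cong : (Q : Fin n → Set) → (∀ v w → v ≢ w → Q v → Q w → col v w ≡ col′ v w) →
    ∀ c s → 2 ≤ length s → All Q s → S.valid c s ≡ S′.valid c s
  valid-cong Q agree c (x ∷ []) (s≤s ()) _
  valid-cong Q agree c (x ∷ y ∷ s) _ (qx ∷ qy ∷ qs) with distinctᵇ (x ∷ y ∷ s) in d
  ... | false = refl
  ... | true = cong₂ _∧_ (cong (_== c) (agree x y x≢y qx qy)) (altPath-cong Q agree (not c) y s x d (qx ∷ qy ∷ qs))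
    where
    x≢y : x ≢ y
    x≢y refl with () ← trans (sym (cong (λ b → not (b ∨ mem x s) ∧ distinctᵇ (x ∷ s)) (≟-refl x))) d

  N-cong : (∀ v w → v ≢ w → col v w ≡ col′ v w) → ∀ m → 2 ≤ m → ∀ c → S.N c m ≡ S′.N c m
  N-cong agree m 2≤m c = sumSeq-cong m (λ s e → cong ind
    (valid-cong (λ _ → Fin n) (λ v w v≢w _ _ → agree v w v≢w) c s (subst (2 ≤_) (sym e) 2≤m) (all s)))
    where
    all : ∀ s → All (λ _ → Fin n) s
    all [] = []
    all (x ∷ s) = x ∷ all s

  avoiding-cong : ∀ z → (∀ v w → v ≢ z → w ≢ z → col v w ≡ col′ v w) → ∀ m → 2 ≤ m → ∀ c → S.avoiding c m z ≡ S′.avoiding c m z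
  avoiding-cong z agree m 2≤m c = sumSeq-cong m pointwise
    where
    pointwise : ∀ s → length s ≡ m → ind (S.valid c s ∧ not (mem z s)) ≡ ind (S′.valid c s ∧ not (mem z s))
    pointwise s e with mem z s in h
    ... | true = cong ind (trans (∧-zeroʳ _) (sym (∧-zeroʳ _)))
    ... | false = cong (λ b → ind (b ∧ true)) (valid-cong (_≢ z) (λ v w _ → agree v w) c s (subst (2 ≤_) (sym e) 2≤m) (∉⇒All≢ z s h))

module _ {n : ℕ} (col : Fin n → Fin n → Bool) (sy : ∀ u v → col u v ≡ col v u) where
  open Walks col sy
  open Sequences col

  sumSeq-altPath : ∀ c k u z → sumSeq k (λ s → ind (altPath c u s z)) ≡ wk c k u z
  sumSeq-altPath c zero u z = refl
  sumSeq-altPath c (suc k) u z = ∑-cong (λ w →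
    trans (sumSeq-cong k (λ s _ → ind-∧ (col u w == c) (altPath (not c) w s z)))
      (trans (sumSeq-*ˡ k (E c u w) _) (cong (E c u w *_) (sumSeq-altPath (not c) k w z))))

  N≤closed : ∀ c l → N c (suc (suc (suc (suc l + l)))) ≤ closed c l
  N≤closed c l = ∑-mono (λ x → ≤-trans
    (sumSeq-mono (suc (suc (suc l + l))) (λ s _ → drop (distinctᵇ (x ∷ s)) (altPath c x s x)))
    (≤-reflexive (sumSeq-altPath c (suc (suc (suc l + l))) x x)))
    where
    drop : ∀ a b → ind (a ∧ b) ≤ ind b
    drop true b = ≤-refl
    drop false b = z≤n

-- Counting in a template

-- Along an alternating walk in a template only the classes of the vertices matter: every other
-- edge changes the class, starting with the first one iff e = true.
visits : ℕ → Bool → Bool → Bool → ℕ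
visits zero e σ ρ = 0
visits (suc k) e σ ρ = ind ((e xor σ) == ρ) + visits k (not e) (e xor σ) ρ

sideAfter : ℕ → Bool → Bool → Bool
sideAfter zero e σ = σ
sideAfter (suc k) e σ = sideAfter k (not e) (e xor σ)

-- Four consecutive steps cross the bipartition twice, so they visit each class twice and return to
-- the starting class.
visits-4+ : ∀ k e σ ρ → visits (4 + k) e σ ρ ≡ 2 + visits k e σ ρ
visits-4+ k true true true = refl
visits-4+ k true true false = refl
visits-4+ k true false true = refl
visits-4+ k true false false = refl
visits-4+ k false true true = refl
visits-4+ k false true false = refl
visits-4+ k false false true = refl
visits-4+ k false false false = refl

sideAfter-4+ : ∀ k e σ → sideAfter (4 + k) e σ ≡ sideAfter k e σ
sideAfter-4+ k true true = refl
sideAfter-4+ k true false = refl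
sideAfter-4+ k false true = refl
sideAfter-4+ k false false = refl

visits-period : ∀ r j e σ ρ → visits (j * 4 + r) e σ ρ ≡ j * 2 + visits r e σ ρ
visits-period r zero e σ ρ = refl
visits-period r (suc j) e σ ρ = trans (visits-4+ (j * 4 + r) e σ ρ) (cong (2 +_) (visits-period r j e σ ρ))

sideAfter-period : ∀ r j e σ → sideAfter (j * 4 + r) e σ ≡ sideAfter r e σ
sideAfter-period r zero e σ = refl
sideAfter-period r (suc j) e σ = trans (sideAfter-4+ (j * 4 + r) e σ) (sideAfter-period r j e σ)

module TemplateCount {n : ℕ} (f : Fin n → Bool) where

  sz : Bool → ℕ
  sz = size-of f

  used : List (Fin n) → Bool → ℕ
  used [] ρ = 0
  used (x ∷ U) ρ = ind (f x == ρ) + used U ρ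

  open-path : Bool → Bool → List (Fin n) → Bool
  open-path e σ [] = true
  open-path e σ (w ∷ ws) = (f w == (e xor σ)) ∧ open-path (not e) (e xor σ) ws

  fresh : List (Fin n) → Bool → ℕ
  fresh U σ = ∑ λ x → ind (f x == σ) * ind (not (mem x U))

  fresh+used : ∀ U σ → distinctᵇ U ≡ true → fresh U σ + used U σ ≡ sz σ
  fresh+used [] σ _ = trans (+-identityʳ _) (∑-cong (λ x → *-identityʳ _))
  fresh+used (y ∷ U) σ d = begin
    fresh (y ∷ U) σ + (ind (f y == σ) + used U σ)    ≡⟨ sym (+-assoc (fresh (y ∷ U) σ) _ _) ⟩
    (fresh (y ∷ U) σ + ind (f y == σ)) + used U σ    ≡⟨ cong (_+ used U σ) (sym step) ⟩
    fresh U σ + used U σ                             ≡⟨ fresh+used U σ (proj₂ (parts (mem y U) d)) ⟩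
    sz σ ∎
    where
    open ≡-Reasoning
    parts : ∀ a {b} → not a ∧ b ≡ true → a ≡ false × b ≡ true
    parts false e = refl , e
    pointwise : ∀ x → ind (f x == σ) * ind (not (mem x U)) ≡
      ind (f x == σ) * ind (not (mem x (y ∷ U))) + ind ⌊ x ≟ᶠ y ⌋ * (ind (f x == σ) * ind (not (mem x U)))
    pointwise x with x ≟ᶠ y
    ... | yes _ = trans (sym (+-identityʳ _)) (cong (_+ (ind (f x == σ) * ind (not (mem x U)) + 0)) (sym (*-zeroʳ (ind (f x == σ)))))
    ... | no _ = sym (+-identityʳ _)
    step : fresh U σ ≡ fresh (y ∷ U) σ + ind (f y == σ)
    step = trans (∑-cong pointwise) (trans (∑-distrib-+ (λ x → ind (f x == σ) * ind (not (mem x (y ∷ U)))) _)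
      (cong (fresh (y ∷ U) σ +_) (trans (∑-delta y (λ x → ind (f x == σ) * ind (not (mem x U))))
        (trans (cong (λ a → ind (f y == σ) * ind (not a)) (proj₁ (parts (mem y U) d))) (*-identityʳ _)))))

  fresh-count : ∀ U σ → ∑ (λ x → ind (f x == σ) * ind (distinctᵇ (x ∷ U))) ≡ ind (distinctᵇ U) * (sz σ ∸ used U σ)
  fresh-count U σ = trans (∑-cong (λ x → trans (cong (ind (f x == σ) *_) (ind-∧ (not (mem x U)) (distinctᵇ U))) (sym (*-assoc (ind (f x == σ)) _ _))))
    (trans (∑-*ʳ (ind (distinctᵇ U)) _) (trans (*-comm (fresh U σ) _) final))
    where
    final : ind (distinctᵇ U) * fresh U σ ≡ ind (distinctᵇ U) * (sz σ ∸ used U σ)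
    final with distinctᵇ U in d
    ... | false = refl
    ... | true = cong (_+ 0) (trans (sym (m+n∸n≡m (fresh U σ) (used U σ))) (cong (_∸ used U σ) (fresh+used U σ d)))

  falls : List (Fin n) → ℕ → Bool → Bool → Bool → ℕ
  falls U k e σ ρ = fall (sz ρ ∸ used U ρ) (visits k e σ ρ)

  count-paths : ∀ k e σ U →
    sumSeq k (λ w → ind (distinctᵇ (w ++ U) ∧ open-path e σ w)) ≡ ind (distinctᵇ U) * (falls U k e σ true * falls U k e σ false)
  count-paths zero e σ U = trans (cong ind (∧-identityʳ (distinctᵇ U))) (sym (*-identityʳ _))
  count-paths (suc k) e σ U = begin
    ∑ (λ x → sumSeq k (λ w → ind (distinctᵇ (x ∷ w ++ U) ∧ ((f x == σ′) ∧ open-path (not e) σ′ w))))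
      ≡⟨ ∑-cong (λ x → trans (sumSeq-cong k (λ w _ → regroup x w)) (sumSeq-*ˡ k (ind (f x == σ′)) _)) ⟩
    ∑ (λ x → ind (f x == σ′) * sumSeq k (λ w → ind (distinctᵇ (w ++ x ∷ U) ∧ open-path (not e) σ′ w)))
      ≡⟨ ∑-cong (λ x → cong (ind (f x == σ′) *_) (count-paths k (not e) σ′ (x ∷ U))) ⟩
    ∑ (λ x → ind (f x == σ′) * (ind (distinctᵇ (x ∷ U)) * (falls (x ∷ U) k (not e) σ′ true * falls (x ∷ U) k (not e) σ′ false)))
      ≡⟨ ∑-cong (λ x → trans (sym (*-assoc (ind (f x == σ′)) _ _)) (trans (scale x) (*-comm _ (ind (f x == σ′) * ind (distinctᵇ (x ∷ U)))))) ⟩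
    ∑ (λ x → (ind (f x == σ′) * ind (distinctᵇ (x ∷ U))) * G)
      ≡⟨ trans (∑-*ʳ G _) (cong (_* G) (fresh-count U σ′)) ⟩
    (ind (distinctᵇ U) * (sz σ′ ∸ used U σ′)) * G
      ≡⟨ trans (*-assoc (ind (distinctᵇ U)) _ _) (cong (ind (distinctᵇ U) *_) G-step) ⟩
    ind (distinctᵇ U) * (falls U (suc k) e σ true * falls U (suc k) e σ false) ∎
    where
    open ≡-Reasoning
    σ′ = e xor σ
    h : Bool → ℕ
    h ρ = fall (sz ρ ∸ (ind (σ′ == ρ) + used U ρ)) (visits k (not e) σ′ ρ)
    G = h true * h false
    scale : ∀ x → (ind (f x == σ′) * ind (distinctᵇ (x ∷ U))) * (falls (x ∷ U) k (not e) σ′ true * falls (x ∷ U) k (not e) σ′ false)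
      ≡ G * (ind (f x == σ′) * ind (distinctᵇ (x ∷ U)))
    scale x with f x == σ′ in fx
    ... | false = sym (*-zeroʳ G)
    ... | true = trans (*-comm (1 * ind (distinctᵇ (x ∷ U))) _) (cong (λ ρ → fall (sz true ∸ (ind (ρ == true) + used U true)) (visits k (not e) σ′ true)
        * fall (sz false ∸ (ind (ρ == false) + used U false)) (visits k (not e) σ′ false) * (1 * ind (distinctᵇ (x ∷ U)))) (==⇒≡ (f x) σ′ fx))
    pred-∸ : ∀ a u → a ∸ suc u ≡ (a ∸ u) ∸ 1
    pred-∸ a u = trans (cong (a ∸_) (+-comm 1 u)) (sym (∸-+-assoc a u 1))
    lem : ∀ a b c → a * (b * c) ≡ b * (a * c)
    lem = solve-∀
    G-step : (sz σ′ ∸ used U σ′) * G ≡ falls U (suc k) e σ true * falls U (suc k) e σ false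
    G-step with e xor σ
    ... | true = trans (sym (*-assoc (sz true ∸ used U true) _ _))
          (cong (λ a → (sz true ∸ used U true) * fall a (visits k (not e) true true) * fall (sz false ∸ used U false) (visits k (not e) true false)) (pred-∸ (sz true) (used U true)))
    ... | false = trans (lem (sz false ∸ used U false) (fall (sz true ∸ used U true) (visits k (not e) false true)) _)
          (cong (λ a → fall (sz true ∸ used U true) (visits k (not e) false true) * ((sz false ∸ used U false) * fall a (visits k (not e) false false))) (pred-∸ (sz false) (used U false)))
    regroup : ∀ x w → ind (distinctᵇ (x ∷ w ++ U) ∧ ((f x == σ′) ∧ open-path (not e) σ′ w))
      ≡ ind (f x == σ′) * ind (distinctᵇ (w ++ x ∷ U) ∧ open-path (not e) σ′ w)
    regroup x w = trans (cong ind (trans (cong (_∧ ((f x == σ′) ∧ open-path (not e) σ′ w)) (sym (distinct-shift x w U)))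
      (≡-cases₃ (λ a b c → a ∧ (b ∧ c)) (λ a b c → b ∧ (a ∧ c)) tt (distinctᵇ (w ++ x ∷ U)) (f x == σ′) (open-path (not e) σ′ w))))
      (ind-∧ (f x == σ′) _)

  module _ (b : Bool) where
    open Sequences (template b f)

    -- An edge of colour `c` crosses the bipartition exactly when `c` is `b`; this makes `c == b`
    -- the parameter `e` of `open-path`.
    template-step : ∀ c u v → (template b f u v == c) ≡ (f v == ((c == b) xor f u))
    template-step c u v = ≡-cases₄ (λ b c x y → ((b == (x xor y)) == c)) (λ b c x y → (y == ((c == b) xor x))) tt b c (f u) (f v)

    not-== : ∀ c d → (not c == d) ≡ not (c == d)
    not-== true d = refl
    not-== false d = sym (not-involutive d)

    altPath-template : ∀ c u w z →
      altPath c u w z ≡ open-path (c == b) (f u) w ∧ (f z == sideAfter (suc (length w)) (c == b) (f u))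
    altPath-template c u [] z = template-step c u z
    altPath-template c u (x ∷ w) z = trans (cong₂ _∧_ (template-step c u x) (altPath-template (not c) x w z)) (lem (not-== c b))
      where
      lem : ∀ {e′} → e′ ≡ not (c == b) →
        (f x == ((c == b) xor f u)) ∧ (open-path e′ (f x) w ∧ (f z == sideAfter (suc (length w)) e′ (f x))) ≡
        ((f x == ((c == b) xor f u)) ∧ open-path (not (c == b)) ((c == b) xor f u) w) ∧ (f z == sideAfter (suc (suc (length w))) (c == b) (f u))
      lem refl with f x == ((c == b) xor f u) in fx
      ... | false = refl
      ... | true = cong (λ σ → open-path (not (c == b)) σ w ∧ (f z == sideAfter (suc (length w)) (not (c == b)) σ)) (==⇒≡ (f x) _ fx)

    -- From here on cycles of length 4t are indexed by j = t - 1.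
    N-template : ∀ j c → N c (suc j * 4) ≡ 2 * (fall (sz true) (suc j * 2) * fall (sz false) (suc j * 2))
    N-template j c = begin
      ∑ (λ x → sumSeq k (λ w → ind (distinctᵇ (x ∷ w) ∧ altPath c x w x)))
        ≡⟨ ∑-cong (λ x → trans (sumSeq-cong k (λ w l → cong ind (cong₂ _∧_ (shift x w) (closes x w l)))) (count-paths k e (f x) (x ∷ []))) ⟩
      ∑ (λ x → 1 * (falls (x ∷ []) k e (f x) true * falls (x ∷ []) k e (f x) false))
        ≡⟨ ∑-cong (λ x → trans (*-identityˡ _) (by-class x)) ⟩
      -- `A` and `B` belong to a first vertex of class `true` and `false`: it takes one place of its
      -- own class, which the path visits `2j + 1` more times, and the other class is visited
      -- `2j + 2` times.
      ∑ (λ x → ind (f x == true) * A + ind (f x == false) * B)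
        ≡⟨ trans (∑-distrib-+ (λ x → ind (f x == true) * A) _) (cong₂ _+_ (∑-*ʳ A _) (∑-*ʳ B _)) ⟩
      sz true * A + sz false * B
        ≡⟨ lem (sz true) (fall (sz true ∸ 1) (suc (j * 2))) (fall (sz false) (suc j * 2)) (sz false) (fall (sz true) (suc j * 2)) _ ⟩
      (sz true * fall (sz true ∸ 1) (suc (j * 2))) * fall (sz false) (suc j * 2) + fall (sz true) (suc j * 2) * (sz false * fall (sz false ∸ 1) (suc (j * 2)))
        ≡⟨ cong (fall (sz true) (suc j * 2) * fall (sz false) (suc j * 2) +_) (sym (+-identityʳ _)) ⟩
      2 * (fall (sz true) (suc j * 2) * fall (sz false) (suc j * 2)) ∎
      where
      open ≡-Reasoning
      k = 3 + j * 4
      e = c == b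
      A = fall (sz true ∸ 1) (suc (j * 2)) * fall (sz false) (suc j * 2)
      B = fall (sz true) (suc j * 2) * fall (sz false ∸ 1) (suc (j * 2))
      lem : ∀ s a q s′ p b → s * (a * q) + s′ * (p * b) ≡ (s * a) * q + p * (s′ * b)
      lem = solve-∀
      shift : ∀ x w → distinctᵇ (x ∷ w) ≡ distinctᵇ (w ++ x ∷ [])
      shift x w = sym (trans (distinct-shift x w []) (cong (λ t → distinctᵇ (x ∷ t)) (++-[] w)))
        where
        ++-[] : (s : List (Fin n)) → s ++ [] ≡ s
        ++-[] [] = refl
        ++-[] (x ∷ s) = cong (x ∷_) (++-[] s)
      ==-refl : ∀ a → (a == a) ≡ true
      ==-refl true = refl
      ==-refl false = refl
      closes : ∀ x w → length w ≡ k → altPath c x w x ≡ open-path e (f x) w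
      closes x w l = trans (altPath-template c x w x) (trans (cong (λ σ → open-path e (f x) w ∧ (f x == σ))
        (trans (cong (λ m → sideAfter (suc m) e (f x)) l) (trans (cong (λ m → sideAfter m e (f x)) (sym (+-identityʳ (suc j * 4)))) (sideAfter-period 0 (suc j) e (f x)))))
        (trans (cong (open-path e (f x) w ∧_) (==-refl (f x))) (∧-identityʳ _)))
      v : ∀ σ ρ → visits k e σ ρ ≡ j * 2 + visits 3 e σ ρ
      v σ ρ = trans (cong (λ m → visits m e σ ρ) (+-comm 3 (j * 4))) (visits-period 3 j e σ ρ)
      visits-own : ∀ e σ → j * 2 + visits 3 e σ σ ≡ suc (j * 2)
      visits-own true true = +-comm (j * 2) 1
      visits-own true false = +-comm (j * 2) 1
      visits-own false true = +-comm (j * 2) 1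
      visits-own false false = +-comm (j * 2) 1
      visits-opp : ∀ e σ → j * 2 + visits 3 e σ (not σ) ≡ suc j * 2
      visits-opp true true = +-comm (j * 2) 2
      visits-opp true false = +-comm (j * 2) 2
      visits-opp false true = +-comm (j * 2) 2
      visits-opp false false = +-comm (j * 2) 2
      by-class : ∀ x → falls (x ∷ []) k e (f x) true * falls (x ∷ []) k e (f x) false ≡ ind (f x == true) * A + ind (f x == false) * B
      by-class x with f x
      ... | true = trans (cong₂ _*_ (cong (fall (sz true ∸ 1)) (trans (v true true) (visits-own e true))) (cong (fall (sz false)) (trans (v true false) (visits-opp e true))))
            (sym (trans (+-identityʳ _) (+-identityʳ _)))
      ... | false = trans (cong₂ _*_ (cong (fall (sz true)) (trans (v false true) (visits-opp e false))) (cong (fall (sz false ∸ 1)) (trans (v false false) (visits-own e false))))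
            (sym (+-identityʳ _))

-- Correcting one vertex

fall-last : ∀ k a → fall a (suc k) ≡ fall a k * (a ∸ k)
fall-last zero a = trans (*-identityʳ a) (sym (*-identityˡ a))
fall-last (suc k) a = begin
  a * fall (a ∸ 1) (suc k)              ≡⟨ cong (a *_) (fall-last k (a ∸ 1)) ⟩
  a * (fall (a ∸ 1) k * (a ∸ 1 ∸ k))    ≡⟨ sym (*-assoc a _ _) ⟩
  a * fall (a ∸ 1) k * (a ∸ 1 ∸ k)      ≡⟨ cong (a * fall (a ∸ 1) k *_) (∸-+-assoc a 1 k) ⟩
  a * fall (a ∸ 1) k * (a ∸ suc k) ∎
  where open ≡-Reasoning

-- For sequences with a bad inner edge and `1 + h` bad end edges: the error term alone covers the
-- left side.
correction-crude : ∀ p q h g {r} → ind p + ind q * (1 + h) ≤ r + 2 * ((1 + h) * suc g)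
correction-crude p q h g {r} = ≤-trans
  (≤-trans (+-mono-≤ (ind≤1 p) (*-monoˡ-≤ (1 + h) (ind≤1 q))) (≤-by (h + 2 * ((1 + h) * g)) (lem h g)))
  (m≤n+m _ r)
  where
  lem : ∀ h g → 1 + 1 * (1 + h) + (h + 2 * ((1 + h) * g)) ≡ 2 * ((1 + h) * suc g)
  lem = solve-∀

-- One closed sequence z a … y: before (first term) and after correcting the edges at z.
-- D is distinctness, A and Y say that the edges za and yz fit the template, I and J that the
-- inner edges fit the colouring and the template, Ba and By that za and yz are bad.
correction : ∀ D A Y I J Ba By g → (J ≡ true → A ≡ Y) → (g ≡ 0 → I ≡ J) →
  ind (D ∧ ((Ba xor A) ∧ (I ∧ (By xor Y)))) + ind (D ∧ (A ∧ (J ∧ Y))) * (ind Ba + ind By)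
  ≤ ind (D ∧ (A ∧ (I ∧ Y))) + (ind (D ∧ (A ∧ (J ∧ Y))) * (ind Ba * ind By) + ind (D ∧ (not A ∧ (J ∧ not Y))) * (ind Ba * ind By))
    + 2 * ((ind Ba + ind By) * g)
correction D A Y I J Ba By zero consistent same rewrite same refl with J
... | false = ≤-trans (≤-reflexive (cong₂ _+_ (cong ind (vanish D (Ba xor A))) (cong (λ x → ind x * (ind Ba + ind By)) (vanish D A)))) z≤n
  where
  vanish : ∀ D A → D ∧ (A ∧ false) ≡ false
  vanish D A = trans (cong (D ∧_) (∧-zeroʳ A)) (∧-zeroʳ D)
-- A fitting sequence is present before the correction iff neither end edge is bad, and
-- inclusion-exclusion over `Ba`, `By` gives the bound. A misfitting one is present before iff both
-- are bad.
... | true rewrite consistent refl = ≤-trans (≤-cases₄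
    (λ D Y Ba By → ind (D ∧ ((Ba xor Y) ∧ (By xor Y))) + ind (D ∧ (Y ∧ Y)) * (ind Ba + ind By))
    (λ D Y Ba By → ind (D ∧ (Y ∧ Y)) + (ind (D ∧ (Y ∧ Y)) * (ind Ba * ind By) + ind (D ∧ (not Y ∧ not Y)) * (ind Ba * ind By)))
    tt D Y Ba By) (m≤m+n _ _)
correction D A Y I J false false (suc g) _ _ = ≤-trans (≤-reflexive (trans (cong (ind (D ∧ (A ∧ (I ∧ Y))) +_) (*-zeroʳ (ind (D ∧ (A ∧ (J ∧ Y)))))) (+-identityʳ _)))
  (≤-trans (m≤m+n _ _) (m≤m+n _ _))
correction D A Y I J true By (suc g) _ _ = correction-crude (D ∧ (not A ∧ (I ∧ (By xor Y)))) (D ∧ (A ∧ (J ∧ Y))) (ind By) g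
correction D A Y I J false true (suc g) _ _ = correction-crude (D ∧ (A ∧ (I ∧ not Y))) (D ∧ (A ∧ (J ∧ Y))) 0 g

module Fix {n : ℕ} (col : Fin n → Fin n → Bool) (sy : ∀ u v → col u v ≡ col v u) (f : Fin n → Bool) (b : Bool)
  (diag : ∀ v → col v v ≡ template b f v v) where

  τ : Fin n → Fin n → Bool
  τ = template b f

  τ-sym : ∀ v w → τ v w ≡ τ w v
  τ-sym v w = cong (b ==_) (xor-comm (f v) (f w))
    where
    xor-comm : ∀ x y → x xor y ≡ y xor x
    xor-comm true true = refl
    xor-comm true false = refl
    xor-comm false true = refl
    xor-comm false false = refl

  badᵇ : Fin n → Fin n → Bool
  badᵇ v w = col v w xor τ v w

  bad : Fin n → Fin n → ℕ
  bad v w = ind (badᵇ v w)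

  bad-sym : ∀ v w → bad v w ≡ bad w v
  bad-sym v w = cong₂ (λ x y → ind (x xor y)) (sy v w) (τ-sym v w)

  bad-diag : ∀ v → bad v v ≡ 0
  bad-diag v = trans (cong (λ x → ind (x xor τ v v)) (diag v)) (ind-xor-self (τ v v))

  d : Fin n → ℕ
  d v = ∑ (bad v)

  -- Twice the number of bad edges, as `bad` is symmetric and vanishes on the diagonal.
  e₀ : ℕ
  e₀ = ∑ d

  bad-xor : ∀ v w → col v w ≡ badᵇ v w xor τ v w
  bad-xor v w = lem (col v w) (τ v w)
    where
    lem : ∀ x y → x ≡ (x xor y) xor y
    lem true true = refl
    lem true false = refl
    lem false true = refl
    lem false false = refl

  badIn : Fin n → List (Fin n) → ℕ
  badIn a [] = 0
  badIn a (x ∷ s) = bad a x + badIn x s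

  private
    module S = Sequences col
    module St = Sequences τ

  altPath-good : ∀ c a w y → badIn a (w ++ [ y ]) ≡ 0 → S.altPath c a w y ≡ St.altPath c a w y
  altPath-good c a [] y h = cong (_== c) (trans (bad-xor a y) (cong (_xor τ a y) (ind≡0 (badᵇ a y) (m+n≡0⇒m≡0 (bad a y) h))))
  altPath-good c a (x ∷ w) y h = cong₂ _∧_ (altPath-good₁ (m+n≡0⇒m≡0 (bad a x) h)) (altPath-good (not c) x w y (m+n≡0⇒n≡0 (bad a x) h))
    where
    altPath-good₁ : bad a x ≡ 0 → (col a x == c) ≡ (τ a x == c)
    altPath-good₁ h′ = cong (_== c) (trans (bad-xor a x) (cong (_xor τ a x) (ind≡0 (badᵇ a x) h′)))

  -- Linearity over the edges of the path: the edge at `a` is bad for `d a` choices of its other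
  -- end, each of the `suc k` later edges for `e₀` choices of both ends, and the remaining vertices
  -- are free.
  ∑badIn : ∀ k a → sumSeq (suc (suc k)) (badIn a) ≡ n ^ suc k * d a + suc k * (n ^ k * e₀)
  ∑∑badIn : ∀ k → ∑ (λ a → sumSeq (suc k) (badIn a)) ≡ suc k * (n ^ k * e₀)
  ∑badIn-suc : ∀ k a → sumSeq (suc k) (badIn a) ≡ n ^ k * d a + ∑ (λ x → sumSeq k (badIn x))

  ∑badIn-suc k a = trans (∑-cong (λ x → trans (sumSeq-+ k (λ _ → bad a x) (badIn x)) (cong (_+ sumSeq k (badIn x)) (sumSeq-const k (bad a x)))))
    (trans (∑-distrib-+ (λ x → n ^ k * bad a x) _) (cong (_+ ∑ (λ x → sumSeq k (badIn x))) (∑-*ˡ (n ^ k) (bad a))))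
  ∑badIn k a = trans (∑badIn-suc (suc k) a) (cong (n ^ suc k * d a +_) (∑∑badIn k))
  ∑∑badIn zero = trans (∑-cong (λ a → trans (∑badIn-suc 0 a) (cong (1 * d a +_) (trans (∑-const n 0) (*-zeroʳ n)))))
    (trans (∑-cong (λ a → trans (+-identityʳ _) (*-identityˡ (d a)))) (sym (trans (+-identityʳ _) (+-identityʳ _))))
  ∑∑badIn (suc k) = trans (∑-cong (∑badIn k)) (trans (∑-distrib-+ (λ a → n ^ suc k * d a) _)
    (trans (cong₂ _+_ (∑-*ˡ (n ^ suc k) d) (∑-const n _)) (lem n (n ^ k) k e₀)))
    where
    lem : ∀ n p k e → (n * p) * e + n * (suc k * (p * e)) ≡ suc (suc k) * (n * p * e)
    lem = solve-∀

  module Vertex (z : Fin n) where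

    col′ : Fin n → Fin n → Bool
    col′ v w = if ⌊ v ≟ᶠ z ⌋ ∨ ⌊ w ≟ᶠ z ⌋ then τ v w else col v w

    col′-sym : ∀ v w → col′ v w ≡ col′ w v
    col′-sym v w with v ≟ᶠ z | w ≟ᶠ z
    ... | yes _ | yes _ = τ-sym v w
    ... | yes _ | no _ = τ-sym v w
    ... | no _ | yes _ = τ-sym v w
    ... | no _ | no _ = sy v w

    col′-at : ∀ w → col′ z w ≡ τ z w
    col′-at w = cong (λ p → if p ∨ ⌊ w ≟ᶠ z ⌋ then τ z w else col z w) (≟-refl z)

    col′-away : ∀ v w → v ≢ z → w ≢ z → col v w ≡ col′ v w
    col′-away v w v≢z w≢z = sym (cong₂ (λ p r → if p ∨ r then τ v w else col v w) (⌊⌋-false (v ≟ᶠ z) v≢z) (⌊⌋-false (w ≟ᶠ z) w≢z))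

    private
      module S′ = Sequences col′

    last-bad : Fin n → List (Fin n) → ℕ
    last-bad a [] = bad z a
    last-bad a (x ∷ s) = last-bad x s

    last-bad-snoc : ∀ a w y → last-bad a (w ++ [ y ]) ≡ bad z y
    last-bad-snoc a [] y = refl
    last-bad-snoc a (x ∷ w) y = last-bad-snoc x w y

    -- Counts the walks of two bad edges that start in `z`.
    S₀ : ℕ
    S₀ = ∑ λ a → bad z a * d a

    -- The bad edge `za` together with a bad inner edge: an inner edge at `a` gives the term with
    -- `S₀`, each of the `suc k` others is chosen independently of `a` and gives `d z * e₀`.
    ∑front : ∀ k → ∑ (λ a → sumSeq (suc (suc k)) (λ s → bad z a * badIn a s)) ≡ n ^ k * (n * S₀ + suc k * (d z * e₀))
    ∑front k = begin
      ∑ (λ a → sumSeq (suc (suc k)) (λ s → bad z a * badIn a s))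
        ≡⟨ ∑-cong (λ a → trans (sumSeq-*ˡ (suc (suc k)) (bad z a) (badIn a)) (cong (bad z a *_) (∑badIn k a))) ⟩
      ∑ (λ a → bad z a * (n ^ suc k * d a + suc k * (n ^ k * e₀)))
        ≡⟨ ∑-cong (λ a → lem (bad z a) (n ^ suc k) (d a) (suc k * (n ^ k * e₀))) ⟩
      ∑ (λ a → n ^ suc k * (bad z a * d a) + bad z a * (suc k * (n ^ k * e₀)))
        ≡⟨ trans (∑-distrib-+ (λ a → n ^ suc k * (bad z a * d a)) _) (cong₂ _+_ (∑-*ˡ (n ^ suc k) _) (∑-*ʳ _ (bad z))) ⟩
      n ^ suc k * S₀ + d z * (suc k * (n ^ k * e₀))
        ≡⟨ lem₂ n (n ^ k) S₀ (d z) k e₀ ⟩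
      n ^ k * (n * S₀ + suc k * (d z * e₀)) ∎
      where
      open ≡-Reasoning
      lem : ∀ b p d q → b * (p * d + q) ≡ p * (b * d) + b * q
      lem = solve-∀
      lem₂ : ∀ n p s d k e → n * p * s + d * (suc k * (p * e)) ≡ p * (n * s + suc k * (d * e))
      lem₂ = solve-∀

    ∑last : ∀ k a → sumSeq (suc k) (last-bad a) ≡ n ^ k * d z
    ∑last zero a = sym (+-identityʳ _)
    ∑last (suc k) a = trans (∑-cong (λ x → ∑last k x)) (trans (∑-const n _) (sym (*-assoc n (n ^ k) (d z))))

    back : ℕ → ℕ
    back k = ∑ λ a → sumSeq k (λ s → last-bad a s * badIn a s)

    -- The mirror image of `∑front`, for a bad last edge. Lists are peeled from the front, so a
    -- recursion is needed: its first inner edge is summed over `a` to give `d x`, and the rest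
    -- repeats.
    back-suc : ∀ k → back (suc k) ≡ ∑ (λ x → d x * sumSeq k (last-bad x)) + n * back k
    back-suc k = begin
      ∑ (λ a → ∑ λ x → sumSeq k (λ s → last-bad x s * (bad a x + badIn x s)))
        ≡⟨ ∑-cong₂ (λ a x → trans (sumSeq-cong k (λ s _ → trans (*-distribˡ-+ (last-bad x s) (bad a x) _) (cong (_+ last-bad x s * badIn x s) (*-comm (last-bad x s) _))))
             (trans (sumSeq-+ k (λ s → bad a x * last-bad x s) _) (cong (_+ sumSeq k (λ s → last-bad x s * badIn x s)) (sumSeq-*ˡ k (bad a x) (last-bad x))))) ⟩
      ∑ (λ a → ∑ λ x → bad a x * sumSeq k (last-bad x) + sumSeq k (λ s → last-bad x s * badIn x s))
        ≡⟨ ∑₂-distrib-+ (λ a x → bad a x * sumSeq k (last-bad x)) _ ⟩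
      ∑ (λ a → ∑ λ x → bad a x * sumSeq k (last-bad x)) + ∑ (λ (a : Fin n) → back k)
        ≡⟨ cong₂ _+_ (trans (∑-comm (λ a x → bad a x * sumSeq k (last-bad x))) (∑-cong (λ x → trans (∑-*ʳ _ (λ a → bad a x))
             (cong (_* sumSeq k (last-bad x)) (∑-cong (λ a → bad-sym a x)))))) (∑-const n (back k)) ⟩
      ∑ (λ x → d x * sumSeq k (last-bad x)) + n * back k ∎
      where open ≡-Reasoning

    back₁ : back 1 ≡ S₀
    back₁ = trans (back-suc 0) (trans (cong₂ _+_ (∑-cong (λ x → *-comm (d x) (bad z x)))
      (trans (cong (n *_) (trans (∑-cong (λ a → *-zeroʳ (bad z a))) (trans (∑-const n 0) (*-zeroʳ n)))) (*-zeroʳ n))) (+-identityʳ S₀))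

    ∑back : ∀ k → back (suc (suc k)) ≡ n ^ k * (n * S₀ + suc k * (d z * e₀))
    ∑back k = trans (back-suc (suc k)) (trans (cong (_+ n * back (suc k)) (trans (∑-cong (λ x → cong (d x *_) (∑last k x))) (∑-*ʳ (n ^ k * d z) d))) (step k))
      where
      step : ∀ k → e₀ * (n ^ k * d z) + n * back (suc k) ≡ n ^ k * (n * S₀ + suc k * (d z * e₀))
      step zero = trans (cong (λ x → e₀ * (1 * d z) + n * x) back₁) (lem n S₀ (d z) e₀)
        where
        lem : ∀ n s d e → e * (1 * d) + n * s ≡ 1 * (n * s + 1 * (d * e))
        lem = solve-∀
      step (suc k) = trans (cong (λ x → e₀ * (n ^ suc k * d z) + n * x) (∑back k)) (lem n (n ^ k) S₀ (d z) k e₀)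
        where
        lem : ∀ n p s d k e → e * (n * p * d) + n * (p * (n * s + suc k * (d * e))) ≡ n * p * (n * s + suc (suc k) * (d * e))
        lem = solve-∀

    ∑error : ∀ k → ∑ (λ a → sumSeq (suc (suc k)) (λ s → 2 * ((bad z a + last-bad a s) * badIn a s))) ≡ 4 * (n ^ k * (n * S₀ + suc k * (d z * e₀)))
    ∑error k = begin
      ∑ (λ a → sumSeq m (λ s → 2 * ((bad z a + last-bad a s) * badIn a s)))
        ≡⟨ ∑-cong (λ a → trans (sumSeq-cong m (λ s _ → cong (2 *_) (*-distribʳ-+ (badIn a s) (bad z a) (last-bad a s))))
             (trans (sumSeq-*ˡ m 2 (λ s → bad z a * badIn a s + last-bad a s * badIn a s)) (cong (2 *_) (sumSeq-+ m (λ s → bad z a * badIn a s) (λ s → last-bad a s * badIn a s))))) ⟩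
      ∑ (λ a → 2 * (sumSeq m (λ s → bad z a * badIn a s) + sumSeq m (λ s → last-bad a s * badIn a s)))
        ≡⟨ trans (∑-*ˡ 2 _) (cong (2 *_) (∑-distrib-+ (λ a → sumSeq m (λ s → bad z a * badIn a s)) _)) ⟩
      2 * (∑ (λ a → sumSeq m (λ s → bad z a * badIn a s)) + back m)
        ≡⟨ cong (2 *_) (cong₂ _+_ (∑front k) (∑back k)) ⟩
      2 * (X + X)
        ≡⟨ lem X ⟩
      4 * X ∎
      where
      open ≡-Reasoning
      m = suc (suc k)
      X = n ^ k * (n * S₀ + suc k * (d z * e₀))
      lem : ∀ x → 2 * (x + x) ≡ 4 * x
      lem = solve-∀

    module Count (j : ℕ) (c : Bool) where
      open TemplateCount f

      -- A closed sequence of length `4j + 4` through `z` is written `z a w y`: `i` is the length of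
      -- `w`, and `k` counts all vertices but `z`.
      i k : ℕ
      i = 1 + j * 4
      k = 3 + j * 4

      -- `o` is the class of `z`, and `σ` the class into which the template leads from `z` along an
      -- edge of colour `c`.
      e o σ : Bool
      e = c == b
      o = f z
      σ = e xor o

      -- The number of fillings `w` for given `z`, `a` in class `s` and `y` in the other class.
      -- Since `a` and `y` are in different classes, two places are taken in the class of `z` and
      -- one in the other. Each class receives `2j` vertices of `w`, and one of them a further one.
      pathsVia : Bool → ℕ
      pathsVia s = fall (sz o ∸ 2) (j * 2 + ind ((not e xor s) == o)) * fall (sz (not o) ∸ 1) (j * 2 + ind ((not e xor s) == not o))

      through : Bool → Fin n → List (Fin n) → Fin n → Bool
      through s a w y = distinctᵇ (w ++ z ∷ a ∷ y ∷ []) ∧ ((f a == s) ∧ ((f y == not s) ∧ open-path (not e) s w))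

      mate : Bool → Fin n → ℕ
      mate s a = ind (f a == s) * ind (not ⌊ z ≟ᶠ a ⌋)

      distinct₃ : ∀ a y → f a ≢ f y → ind (distinctᵇ (z ∷ a ∷ y ∷ [])) ≡ ind (not ⌊ z ≟ᶠ a ⌋) * ind (not ⌊ z ≟ᶠ y ⌋)
      distinct₃ a y fa≢fy = trans (cong (λ p → ind (not (⌊ z ≟ᶠ a ⌋ ∨ (⌊ z ≟ᶠ y ⌋ ∨ false)) ∧ (not (p ∨ false) ∧ true)))
          (⌊⌋-false (a ≟ᶠ y) (λ { refl → fa≢fy refl }))) (lem ⌊ z ≟ᶠ a ⌋ ⌊ z ≟ᶠ y ⌋)
        where
        lem : ∀ p r → ind (not (p ∨ (r ∨ false)) ∧ true) ≡ ind (not p) * ind (not r)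
        lem true r = refl
        lem false true = refl
        lem false false = refl

      through-count : ∀ s a y → sumSeq i (λ w → ind (through s a w y)) ≡ mate s a * mate (not s) y * pathsVia s
      through-count s a y = begin
        sumSeq i (λ w → ind (through s a w y))
          ≡⟨ sumSeq-cong i (λ w _ → regroup w) ⟩
        sumSeq i (λ w → ind (f a == s) * ind (f y == not s) * ind (distinctᵇ (w ++ U) ∧ open-path (not e) s w))
          ≡⟨ sumSeq-*ˡ i (ind (f a == s) * ind (f y == not s)) (λ w → ind (distinctᵇ (w ++ U) ∧ open-path (not e) s w)) ⟩
        ind (f a == s) * ind (f y == not s) * sumSeq i (λ w → ind (distinctᵇ (w ++ U) ∧ open-path (not e) s w))
          ≡⟨ cong (ind (f a == s) * ind (f y == not s) *_) (count-paths i (not e) s U) ⟩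
        ind (f a == s) * ind (f y == not s) * (ind (distinctᵇ U) * (falls U i (not e) s true * falls U i (not e) s false))
          ≡⟨ cong (λ p → ind (f a == s) * ind (f y == not s) * (ind (distinctᵇ U) * p))
               (cong₂ _*_ (cong (fall (sz true ∸ used U true)) (vis true)) (cong (fall (sz false ∸ used U false)) (vis false))) ⟩
        ind (f a == s) * ind (f y == not s) * (ind (distinctᵇ U) * (G s true (used U true) * G s false (used U false)))
          ≡⟨ evaluate s (f a) (f y) o refl refl ⟩
        mate s a * mate (not s) y * pathsVia s ∎
        where
        open ≡-Reasoning
        U = z ∷ a ∷ y ∷ []
        G : Bool → Bool → ℕ → ℕ
        G x ρ u = fall (sz ρ ∸ u) (j * 2 + ind ((not e xor x) == ρ))
        regroup : ∀ w → ind (through s a w y) ≡ ind (f a == s) * ind (f y == not s) * ind (distinctᵇ (w ++ U) ∧ open-path (not e) s w)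
        regroup w = trans (cong ind (≡-cases₄ (λ D A Y O → D ∧ (A ∧ (Y ∧ O))) (λ D A Y O → (A ∧ Y) ∧ (D ∧ O)) tt (distinctᵇ (w ++ U)) (f a == s) (f y == not s) (open-path (not e) s w)))
          (trans (ind-∧ ((f a == s) ∧ (f y == not s)) _) (cong (_* ind (distinctᵇ (w ++ U) ∧ open-path (not e) s w)) (ind-∧ (f a == s) _)))
        vis : ∀ ρ → visits i (not e) s ρ ≡ j * 2 + ind ((not e xor s) == ρ)
        vis ρ = trans (cong (λ m → visits m (not e) s ρ) (+-comm 1 (j * 4))) (trans (visits-period 1 j (not e) s ρ) (cong (j * 2 +_) (+-identityʳ _)))
        order : ∀ s fz → G s true (ind (fz == true) + 1) * G s false (ind (fz == false) + 1) ≡ G s fz 2 * G s (not fz) 1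
        order s true = refl
        order s false = *-comm (G s true 1) _
        P Q : ℕ
        P = ind (not ⌊ z ≟ᶠ a ⌋)
        Q = ind (not ⌊ z ≟ᶠ y ⌋)
        evaluate : ∀ s fa fy fz → f a ≡ fa → f y ≡ fy →
          ind (fa == s) * ind (fy == not s) * (ind (distinctᵇ U) *
            (G s true (ind (fz == true) + (ind (fa == true) + (ind (fy == true) + 0))) * G s false (ind (fz == false) + (ind (fa == false) + (ind (fy == false) + 0)))))
          ≡ ind (fa == s) * P * (ind (fy == not s) * Q) * (G s fz 2 * G s (not fz) 1)
        evaluate true false fy fz _ _ = refl
        evaluate false true fy fz _ _ = refl
        evaluate true true true fz _ _ = sym (cong (_* (G true fz 2 * G true (not fz) 1)) (*-zeroʳ (1 * P)))
        evaluate false false false fz _ _ = sym (cong (_* (G false fz 2 * G false (not fz) 1)) (*-zeroʳ (1 * P)))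
        evaluate true true false fz p r = trans (+-identityʳ _) (cong₂ _*_
          (trans (distinct₃ a y (λ q → case trans (sym p) (trans q r) of λ ())) (sym (cong₂ _*_ (*-identityˡ P) (*-identityˡ Q)))) (order true fz))
        evaluate false false true fz p r = trans (+-identityʳ _) (cong₂ _*_
          (trans (distinct₃ a y (λ q → case trans (sym p) (trans q r) of λ ())) (sym (cong₂ _*_ (*-identityˡ P) (*-identityˡ Q)))) (order false fz))

      private
        ¬c-flag : (not c == b) ≡ not e
        ¬c-flag = not-== b c b

      fits-za : ∀ a → (τ z a == c) ≡ (f a == σ)
      fits-za a = template-step b c z a

      fits-yz : ∀ y → (τ y z == not c) ≡ (o == (not e xor f y))
      fits-yz y = trans (template-step b (not c) y z) (cong (λ x → o == (x xor f y)) ¬c-flag)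

      -- The inner path has `4j + 2` edges, of which `2j + 1` cross the bipartition, so its ends lie
      -- in different classes.
      fits-inner : ∀ a w y → length w ≡ i → St.altPath (not c) a w y ≡ open-path (not e) (f a) w ∧ (f y == not (f a))
      fits-inner a w y l = trans (altPath-template b (not c) a w y) (cong₂ (λ x m → open-path x (f a) w ∧ (f y == m)) ¬c-flag
        (trans (cong₂ (λ x m → sideAfter (suc m) x (f a)) ¬c-flag l) (trans (cong (λ m → sideAfter m (not e) (f a)) (+-comm 2 (j * 4)))
          (trans (sideAfter-period 2 j (not e) (f a)) (≡-cases₃ (λ x y _ → not x xor (x xor y)) (λ x y _ → not y) tt (not e) (f a) true)))))

      distinct-ends : ∀ a w y → distinctᵇ (z ∷ a ∷ w ++ [ y ]) ≡ distinctᵇ (w ++ z ∷ a ∷ y ∷ [])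
      distinct-ends a w y = sym (trans (distinct-shift z w (a ∷ [ y ])) (trans (distinct-shift a (z ∷ w) [ y ]) (distinct-shift z [ a ] (w ++ [ y ]))))

      through-fits : ∀ a w y → length w ≡ i →
        distinctᵇ (z ∷ a ∷ w ++ [ y ]) ∧ ((τ z a == c) ∧ (St.altPath (not c) a w y ∧ (τ y z == not c))) ≡ through σ a w y
      through-fits a w y l = cong₂ _∧_ (distinct-ends a w y) (trans (cong₂ (λ p r → p ∧ (r ∧ (τ y z == not c))) (fits-za a) (fits-inner a w y l)) (trans (cong (λ p → (f a == σ) ∧ ((open-path (not e) (f a) w ∧ (f y == not (f a))) ∧ p)) (fits-yz y)) body))
        where
        body : (f a == σ) ∧ ((open-path (not e) (f a) w ∧ (f y == not (f a))) ∧ (o == (not e xor f y))) ≡ (f a == σ) ∧ ((f y == not σ) ∧ open-path (not e) σ w)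
        body with f a == σ in eq
        ... | false = refl
        ... | true = trans (cong (λ x → (open-path (not e) x w ∧ (f y == not x)) ∧ (o == (not e xor f y))) (==⇒≡ (f a) σ eq))
              (≡-cases₄ (λ e o y p → (p ∧ (y == not (e xor o))) ∧ (o == (not e xor y))) (λ e o y p → (y == not (e xor o)) ∧ p) tt e o (f y) (open-path (not e) σ w))

      through-misfits : ∀ a w y → length w ≡ i →
        distinctᵇ (z ∷ a ∷ w ++ [ y ]) ∧ (not (τ z a == c) ∧ (St.altPath (not c) a w y ∧ not (τ y z == not c))) ≡ through (not σ) a w y
      through-misfits a w y l = cong₂ _∧_ (distinct-ends a w y) (trans (cong₂ (λ p r → not p ∧ (r ∧ not (τ y z == not c))) (fits-za a) (fits-inner a w y l)) (trans (cong (λ p → not (f a == σ) ∧ ((open-path (not e) (f a) w ∧ (f y == not (f a))) ∧ not p)) (fits-yz y)) (trans (cong (_∧ ((open-path (not e) (f a) w ∧ (f y == not (f a))) ∧ not (o == (not e xor f y)))) (≡-cases₃ (λ x y _ → not (x == y)) (λ x y _ → x == not y) tt (f a) σ true)) body)))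
        where
        body : (f a == not σ) ∧ ((open-path (not e) (f a) w ∧ (f y == not (f a))) ∧ not (o == (not e xor f y))) ≡ (f a == not σ) ∧ ((f y == not (not σ)) ∧ open-path (not e) (not σ) w)
        body with f a == not σ in eq
        ... | false = refl
        ... | true = trans (cong (λ x → (open-path (not e) x w ∧ (f y == not x)) ∧ not (o == (not e xor f y))) (==⇒≡ (f a) (not σ) eq))
              (≡-cases₄ (λ e o y p → (p ∧ (y == not (not (e xor o)))) ∧ not (o == (not e xor y))) (λ e o y p → (y == not (not (e xor o))) ∧ p) tt e o (f y) (open-path (not e) (not σ) w))

      -- The parity argument: the ends of a fitting inner path lie in different classes, so `za` and
      -- `yz` fit or misfit together. Hence no alternating cycle through `z` has one bad edge at `z`
      -- and no other.
      consistent : ∀ a w y → length w ≡ i → St.altPath (not c) a w y ≡ true → (τ z a == c) ≡ (τ y z == not c)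
      consistent a w y l J = trans (fits-za a) (trans (trans (≡-cases₃ (λ e o x → x == (e xor o)) (λ e o x → o == (not e xor not x)) tt e o (f a))
        (cong (λ x → o == (not e xor x)) (sym (==⇒≡ (f y) (not (f a)) (right (open-path (not e) (f a) w) (trans (sym (fits-inner a w y l)) J)))))) (sym (fits-yz y)))
        where
        right : ∀ p {r} → p ∧ r ≡ true → r ≡ true
        right true h = h

      last-colour : ∀ (w : List (Fin n)) → length w ≡ i → alt (suc (length w)) (not c) ≡ not c
      last-colour w l = trans (cong (λ m → alt (suc m) (not c)) l) (trans (cong (λ x → alt (j * 4) (not x)) (not-involutive c)) (alt-*4 j (not c)))

      valid-before : ∀ a w y → length w ≡ i → S.valid c (z ∷ a ∷ w ++ [ y ]) ≡
        distinctᵇ (z ∷ a ∷ w ++ [ y ]) ∧ ((badᵇ z a xor (τ z a == c)) ∧ (S.altPath (not c) a w y ∧ (badᵇ y z xor (τ y z == not c))))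
      valid-before a w y l = cong (distinctᵇ (z ∷ a ∷ w ++ [ y ]) ∧_) (cong₂ _∧_ (shape z a c)
        (trans (S.altPath-snoc (not c) a w y z) (cong (S.altPath (not c) a w y ∧_) (trans (cong (col y z ==_) (last-colour w l)) (shape y z (not c))))))
        where
        shape : ∀ u v c → (col u v == c) ≡ badᵇ u v xor (τ u v == c)
        shape u v c = trans (cong (_== c) (bad-xor u v)) (≡-cases₃ (λ x y c → (x xor y) == c) (λ x y c → x xor (y == c)) tt (badᵇ u v) (τ u v) c)

      valid-after : ∀ a w y → length w ≡ i → S′.valid c (z ∷ a ∷ w ++ [ y ]) ≡
        distinctᵇ (z ∷ a ∷ w ++ [ y ]) ∧ ((τ z a == c) ∧ (S.altPath (not c) a w y ∧ (τ y z == not c)))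
      valid-after a w y l with distinctᵇ (z ∷ a ∷ w ++ [ y ]) in D
      ... | false = refl
      ... | true = cong₂ _∧_ (cong (_== c) (col′-at a)) (trans (S′.altPath-snoc (not c) a w y z) (cong₂ _∧_
            (sym (altPath-cong col col′ (_≢ z) (λ v w _ → col′-away v w) (not c) a w y (proj₂ parts) (∉⇒All≢ z (y ∷ a ∷ w) (proj₁ parts))))
            (trans (cong (col′ y z ==_) (last-colour w l)) (cong (_== not c) (trans (col′-sym y z) (trans (col′-at y) (τ-sym z y)))))))
        where
        split : ∀ p {r} → not p ∧ r ≡ true → p ≡ false × r ≡ true
        split false h = refl , h
        parts = split (mem z (y ∷ a ∷ w)) (trans (sym (trans (distinct-shift y (z ∷ a ∷ w) []) (trans (cong (λ t → distinctᵇ (y ∷ z ∷ a ∷ t)) (++-identityʳ w)) (distinct-shift z [ y ] (a ∷ w))))) D)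

      Σ₃ : (Fin n → List (Fin n) → Fin n → ℕ) → ℕ
      Σ₃ F = ∑ λ a → sumSeq i λ w → ∑ λ y → F a w y

      Σ₃-+ : ∀ F G → Σ₃ (λ a w y → F a w y + G a w y) ≡ Σ₃ F + Σ₃ G
      Σ₃-+ F G = trans (∑-cong (λ a → trans (sumSeq-cong i (λ w _ → ∑-distrib-+ (F a w) (G a w))) (sumSeq-+ i (λ w → ∑ (F a w)) (λ w → ∑ (G a w))))) (∑-distrib-+ (λ a → sumSeq i λ w → ∑ (F a w)) _)

      Σ₃-mono : ∀ {F G} → (∀ a w y → length w ≡ i → F a w y ≤ G a w y) → Σ₃ F ≤ Σ₃ G
      Σ₃-mono h = ∑-mono (λ a → sumSeq-mono i (λ w l → ∑-mono (λ y → h a w y l)))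

      Σ₃-chain : ∀ (F : Fin n → List (Fin n) → ℕ) → Σ₃ (λ a w y → F a (w ++ [ y ])) ≡ ∑ (λ a → sumSeq (suc i) (F a))
      Σ₃-chain F = ∑-cong (λ a → sym (sumSeq-snoc i (F a)))

      Σ₃-through : ∀ s (g : Fin n → Fin n → ℕ) → Σ₃ (λ a w y → ind (through s a w y) * g a y) ≡ pathsVia s * ∑ (λ a → ∑ λ y → mate s a * mate (not s) y * g a y)
      Σ₃-through s g = trans (∑-cong (λ a → trans (sumSeq-∑ i (λ w y → ind (through s a w y) * g a y)) (∑-cong (λ y → inner a y)))) (∑-*-nested (pathsVia s) (λ a y → mate s a * mate (not s) y * g a y))
        where
        lem : ∀ g m p → g * (m * p) ≡ p * (m * g)
        lem = solve-∀
        inner : ∀ a y → sumSeq i (λ w → ind (through s a w y) * g a y) ≡ pathsVia s * (mate s a * mate (not s) y * g a y)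
        inner a y = trans (sumSeq-cong i (λ w _ → *-comm (ind (through s a w y)) (g a y))) (trans (sumSeq-*ˡ i (g a y) (λ w → ind (through s a w y)))
          (trans (cong (g a y *_) (through-count s a y)) (lem (g a y) (mate s a * mate (not s) y) (pathsVia s))))

      α A : Bool → ℕ
      α s = ∑ λ a → ind (f a == s) * bad z a
      A s = ∑ (mate s)

      mate-bad : ∀ s a → mate s a * bad z a ≡ ind (f a == s) * bad z a
      mate-bad s a with z ≟ᶠ a
      ... | no _ = cong (_* bad z a) (*-identityʳ (ind (f a == s)))
      ... | yes refl = trans (cong (mate′ *_) (bad-diag z)) (trans (*-zeroʳ mate′) (sym (trans (cong (ind (f z == s) *_) (bad-diag z)) (*-zeroʳ (ind (f z == s))))))
        where mate′ = ind (f z == s) * 0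

      ∑-either : ∀ s → ∑ (λ a → ∑ λ y → mate s a * mate (not s) y * (bad z a + bad z y)) ≡ α s * A (not s) + A s * α (not s)
      ∑-either s = trans (∑-cong₂ (λ a y → lem (mate s a) (mate (not s) y) (bad z a) (bad z y)))
        (trans (∑₂-distrib-+ (λ a y → (mate s a * bad z a) * mate (not s) y) (λ a y → mate s a * (mate (not s) y * bad z y)))
          (cong₂ _+_ (trans (∑-* (λ a → mate s a * bad z a) (mate (not s))) (cong (_* A (not s)) (∑-cong (mate-bad s))))
                     (trans (∑-* (mate s) (λ y → mate (not s) y * bad z y)) (cong (A s *_) (∑-cong (mate-bad (not s)))))))
        where
        lem : ∀ m m′ x y → m * m′ * (x + y) ≡ (m * x) * m′ + m * (m′ * y)
        lem = solve-∀

      ∑-both : ∀ s → ∑ (λ a → ∑ λ y → mate s a * mate (not s) y * (bad z a * bad z y)) ≡ α s * α (not s)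
      ∑-both s = trans (∑-cong₂ (λ a y → lem (mate s a) (mate (not s) y) (bad z a) (bad z y)))
        (trans (∑-* (λ a → mate s a * bad z a) (λ y → mate (not s) y * bad z y)) (cong₂ _*_ (∑-cong (mate-bad s)) (∑-cong (mate-bad (not s)))))
        where
        lem : ∀ m m′ x y → m * m′ * (x * y) ≡ (m * x) * (m′ * y)
        lem = solve-∀

      α-sum : ∀ s → α s + α (not s) ≡ d z
      α-sum s = trans (sym (∑-distrib-+ (λ a → ind (f a == s) * bad z a) _)) (∑-cong (λ a → trans (sym (*-distribʳ-+ (bad z a) (ind (f a == s)) _))
        (trans (cong (_* bad z a) (ind-==-split (f a) s)) (*-identityˡ (bad z a)))))

      A-size : ∀ s → A s + ind (o == s) ≡ sz s
      A-size s = trans (cong (A s +_) (sym (∑-delta z (λ a → ind (f a == s))))) (trans (sym (∑-distrib-+ (mate s) _)) (∑-cong pointwise))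
        where
        pointwise : ∀ a → mate s a + ind ⌊ a ≟ᶠ z ⌋ * ind (f a == s) ≡ ind (f a == s)
        pointwise a = trans (cong (λ p → mate s a + ind p * ind (f a == s)) (≟-sym a z)) (lem ⌊ z ≟ᶠ a ⌋ (ind (f a == s)))
          where
          lem : ∀ p x → x * ind (not p) + ind p * x ≡ x
          lem true x = trans (cong (_+ (x + 0)) (*-zeroʳ x)) (+-identityʳ x)
          lem false x = trans (+-identityʳ _) (*-identityʳ x)

      -- `correction` summed over all `z a w y`. On the left fitting sequences are weighted by their
      -- number of bad end edges; on the right stand the fitting and the misfitting sequences with
      -- two bad end edges, and then `∑error`.
      R-compare : S.R c k z + pathsVia σ * (α σ * A (not σ) + A σ * α (not σ))
        ≤ S′.R c k z + (pathsVia σ * (α σ * α (not σ)) + pathsVia (not σ) * (α (not σ) * α σ)) + 4 * (n ^ (j * 4) * (n * S₀ + suc (j * 4) * (d z * e₀)))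
      R-compare = begin
        S.R c k z + pathsVia σ * (α σ * A (not σ) + A σ * α (not σ))
          ≡⟨ sym (cong₂ _+_ (Σ₃-chain (λ a s → ind (S.valid c (z ∷ a ∷ s)))) (trans (Σ₃-through σ (λ a y → bad z a + bad z y)) (cong (pathsVia σ *_) (∑-either σ)))) ⟩
        Σ₃ (λ a w y → ind (S.valid c (z ∷ a ∷ w ++ [ y ]))) + Σ₃ (λ a w y → ind (through σ a w y) * (bad z a + bad z y))
          ≡⟨ sym (Σ₃-+ (λ a w y → ind (S.valid c (z ∷ a ∷ w ++ [ y ]))) (λ a w y → ind (through σ a w y) * (bad z a + bad z y))) ⟩
        Σ₃ (λ a w y → ind (S.valid c (z ∷ a ∷ w ++ [ y ])) + ind (through σ a w y) * (bad z a + bad z y))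
          ≤⟨ Σ₃-mono pointwise ⟩
        Σ₃ (λ a w y → V′ a w y + (F₁ a w y + F₂ a w y) + err a w y)
          ≡⟨ trans (Σ₃-+ (λ a w y → V′ a w y + (F₁ a w y + F₂ a w y)) err) (cong (_+ Σ₃ err) (trans (Σ₃-+ V′ (λ a w y → F₁ a w y + F₂ a w y)) (cong (Σ₃ V′ +_) (Σ₃-+ F₁ F₂)))) ⟩
        Σ₃ V′ + (Σ₃ F₁ + Σ₃ F₂) + Σ₃ err
          ≡⟨ cong₂ _+_ (cong₂ _+_ (Σ₃-chain (λ a s → ind (S′.valid c (z ∷ a ∷ s))))
               (cong₂ _+_ (trans (Σ₃-through σ (λ a y → bad z a * bad z y)) (cong (pathsVia σ *_) (∑-both σ)))
                          (trans (Σ₃-through (not σ) (λ a y → bad z a * bad z y)) (cong (pathsVia (not σ) *_) (trans (∑-both (not σ)) (cong (λ x → α (not σ) * α x) (not-involutive σ)))))))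
               (trans (Σ₃-chain (λ a s → 2 * ((bad z a + last-bad a s) * badIn a s))) (∑error (j * 4))) ⟩
        _ ∎
        where
        open ≤-Reasoning
        V′ F₁ F₂ err : Fin n → List (Fin n) → Fin n → ℕ
        V′ a w y = ind (S′.valid c (z ∷ a ∷ w ++ [ y ]))
        F₁ a w y = ind (through σ a w y) * (bad z a * bad z y)
        F₂ a w y = ind (through (not σ) a w y) * (bad z a * bad z y)
        err a w y = 2 * ((bad z a + last-bad a (w ++ [ y ])) * badIn a (w ++ [ y ]))
        pointwise : ∀ a w y → length w ≡ i → ind (S.valid c (z ∷ a ∷ w ++ [ y ])) + ind (through σ a w y) * (bad z a + bad z y) ≤ V′ a w y + (F₁ a w y + F₂ a w y) + err a w y
        pointwise a w y l rewrite valid-before a w y l | valid-after a w y l | last-bad-snoc a w y | sym (through-fits a w y l) | sym (through-misfits a w y l) | bad-sym z y =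
          correction (distinctᵇ (z ∷ a ∷ w ++ [ y ])) (τ z a == c) (τ y z == not c) (S.altPath (not c) a w y) (St.altPath (not c) a w y)
            (badᵇ z a) (badᵇ y z) (badIn a (w ++ [ y ])) (consistent a w y l) (altPath-good (not c) a w y)

-- Gain against error

*-^ : ∀ k a b → (a * b) ^ k ≡ a ^ k * b ^ k
*-^ zero a b = refl
*-^ (suc k) a b = trans (cong (a * b *_) (*-^ k a b)) (lem a b (a ^ k) (b ^ k))
  where
  lem : ∀ a b p q → a * b * (p * q) ≡ a * p * (b * q)
  lem = solve-∀

^≤fall : ∀ k a → (a ∸ k) ^ k ≤ fall a k
^≤fall zero a = ≤-refl
^≤fall (suc k) zero = z≤n
^≤fall (suc k) (suc a) = *-mono-≤ (≤-trans (m∸n≤m a k) (n≤1+n a)) (^≤fall k a)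

-- The correction terms nS + k d e are of smaller order than n²d: if d is bounded use S ≤ d²,
-- and otherwise S ≤ e = O(n).
errors-small : ∀ K k B n d S e → 1 ≤ d → 1 ≤ n → e ≤ B * n → S ≤ e → S ≤ d * d →
  16 * (K * K * B) ≤ n → 4 * (K * k * B) ≤ n → K * (n * S + k * (d * e)) < n * n * d
errors-small K k B n d S e d≥1 n≥1 e≤Bn S≤e S≤d² big₁ big₂ = *-cancelˡ-< 4 _ _ (begin-strict
  4 * (K * (n * S + k * (d * e)))               ≡⟨ lem K k n d S e ⟩
  n * (4 * (K * S)) + 4 * (K * k * (d * e))     ≤⟨ +-mono-≤ (*-monoʳ-≤ n 4KS≤nd) 4Kkde≤n²d ⟩
  n * (n * d) + n * (n * d)                     <⟨ m<m+n _ (+-mono-≤ pos z≤n) ⟩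
  n * (n * d) + n * (n * d) + (n * (n * d) + n * (n * d)) ≡⟨ lem₂ n d ⟩
  4 * (n * n * d) ∎)
  where
  open ≤-Reasoning
  lem : ∀ K k n d S e → 4 * (K * (n * S + k * (d * e))) ≡ n * (4 * (K * S)) + 4 * (K * k * (d * e))
  lem = solve-∀
  lem₂ : ∀ n d → n * (n * d) + n * (n * d) + (n * (n * d) + n * (n * d)) ≡ 4 * (n * n * d)
  lem₂ = solve-∀
  pos : 1 ≤ n * (n * d)
  pos = *-mono-≤ n≥1 (*-mono-≤ n≥1 d≥1)
  4KS≤nd : 4 * (K * S) ≤ n * d
  4KS≤nd with 4 * (K * B) ≤? d
  ... | yes big = begin
    4 * (K * S)             ≤⟨ *-monoʳ-≤ 4 (*-monoʳ-≤ K (≤-trans S≤e e≤Bn)) ⟩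
    4 * (K * (B * n))       ≡⟨ lem₃ K B n ⟩
    n * (4 * (K * B))       ≤⟨ *-monoʳ-≤ n big ⟩
    n * d ∎
    where
    lem₃ : ∀ K B n → 4 * (K * (B * n)) ≡ n * (4 * (K * B))
    lem₃ = solve-∀
  ... | no small = begin
    4 * (K * S)                       ≤⟨ *-monoʳ-≤ 4 (*-monoʳ-≤ K S≤d²) ⟩
    4 * (K * (d * d))                 ≤⟨ *-monoʳ-≤ 4 (*-monoʳ-≤ K (*-monoʳ-≤ d (<⇒≤ (≰⇒> small)))) ⟩
    4 * (K * (d * (4 * (K * B))))     ≡⟨ lem₃ K B d ⟩
    16 * (K * K * B) * d              ≤⟨ *-monoˡ-≤ d big₁ ⟩
    n * d ∎
    where
    lem₃ : ∀ K B d → 4 * (K * (d * (4 * (K * B)))) ≡ 16 * (K * K * B) * d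
    lem₃ = solve-∀
  4Kkde≤n²d : 4 * (K * k * (d * e)) ≤ n * (n * d)
  4Kkde≤n²d = begin
    4 * (K * k * (d * e))           ≤⟨ *-monoʳ-≤ 4 (*-monoʳ-≤ (K * k) (*-monoʳ-≤ d e≤Bn)) ⟩
    4 * (K * k * (d * (B * n)))     ≡⟨ lem₄ K k B n d ⟩
    4 * (K * k * B) * (n * d)       ≤⟨ *-monoˡ-≤ (n * d) big₂ ⟩
    n * (n * d) ∎
    where
    lem₄ : ∀ K k B n d → 4 * (K * k * (d * (B * n))) ≡ 4 * (K * k * B) * (n * d)
    lem₄ = solve-∀

-- Both sides are compared with `40 * P * n * (x + y)`. On the left `4xy ≤ (x + y)²` and
-- `x + y ≤ 3n/5` make the mixed product linear in `x + y`; on the right `A₁` and `A₂` are at least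
-- `2n/5`.
gain-large : ∀ n P Q A₁ A₂ x y → 2 * n ≤ 5 * A₁ → 2 * n ≤ 5 * A₂ → 2 * n ≤ 5 * P → 5 * Q ≤ 3 * n → 5 * (x + y) ≤ 3 * n →
  100 * ((P + Q) * (x * y)) + n * n * (x + y) ≤ 100 * (P * (x * A₂ + A₁ * y))
gain-large n P Q A₁ A₂ x y hA₁ hA₂ hP hQ hd = begin
  100 * ((P + Q) * (x * y)) + n * n * d
    ≡⟨ cong (_+ n * n * d) (lem₁ (P + Q) (x * y)) ⟩
  5 * ((P + Q) * (5 * (4 * (x * y)))) + n * n * d
    ≤⟨ +-monoˡ-≤ _ (*-monoʳ-≤ 5 (*-monoʳ-≤ (P + Q) 20xy)) ⟩
  5 * ((P + Q) * (3 * n * d)) + n * n * d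
    ≡⟨ lem₂ P Q n d ⟩
  n * d * (15 * P + 3 * (5 * Q) + n)
    ≤⟨ *-monoʳ-≤ (n * d) (+-monoˡ-≤ n (+-monoʳ-≤ (15 * P) (*-monoʳ-≤ 3 hQ))) ⟩
  n * d * (15 * P + 3 * (3 * n) + n)
    ≡⟨ cong (n * d *_) (lem₃ P n) ⟩
  n * d * (15 * P + 5 * (2 * n))
    ≤⟨ *-monoʳ-≤ (n * d) (+-monoʳ-≤ (15 * P) (*-monoʳ-≤ 5 hP)) ⟩
  n * d * (15 * P + 5 * (5 * P))
    ≡⟨ lem₄ P n x y ⟩
  20 * (P * (x * (2 * n) + (2 * n) * y))
    ≤⟨ *-monoʳ-≤ 20 (*-monoʳ-≤ P (+-mono-≤ (*-monoʳ-≤ x hA₂) (*-monoˡ-≤ y hA₁))) ⟩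
  20 * (P * (x * (5 * A₂) + (5 * A₁) * y))
    ≡⟨ lem₅ P x y A₁ A₂ ⟩
  100 * (P * (x * A₂ + A₁ * y)) ∎
  where
  open ≤-Reasoning
  d = x + y
  20xy : 5 * (4 * (x * y)) ≤ 3 * n * d
  20xy = begin
    5 * (4 * (x * y))   ≤⟨ *-monoʳ-≤ 5 (4ab≤[a+b]² x y) ⟩
    5 * (d * d)         ≡⟨ sym (*-assoc 5 d d) ⟩
    5 * d * d           ≤⟨ *-monoˡ-≤ d hd ⟩
    3 * n * d ∎
  lem₁ : ∀ p z → 100 * (p * z) ≡ 5 * (p * (5 * (4 * z)))
  lem₁ = solve-∀
  lem₂ : ∀ P Q n d → 5 * ((P + Q) * (3 * n * d)) + n * n * d ≡ n * d * (15 * P + 3 * (5 * Q) + n)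
  lem₂ = solve-∀
  lem₃ : ∀ P n → 15 * P + 3 * (3 * n) + n ≡ 15 * P + 5 * (2 * n)
  lem₃ = solve-∀
  lem₄ : ∀ P n x y → n * (x + y) * (15 * P + 5 * (5 * P)) ≡ 20 * (P * (x * (2 * n) + (2 * n) * y))
  lem₄ = solve-∀
  lem₅ : ∀ P x y A B → 20 * (P * (x * (5 * B) + (5 * A) * y)) ≡ 100 * (P * (x * B + A * y))
  lem₅ = solve-∀

class-large : ∀ n C s t → 19 * n ≤ 40 * (s + 12 * C) → 40 * (12 * C + t) ≤ n → 2 * n ≤ 5 * (s ∸ t)
class-large n C s t h big = *-cancelˡ-≤ 8 (+-cancelʳ-≤ (40 * (12 * C + t)) _ _ (begin
  8 * (2 * n) + 40 * (12 * C + t)      ≤⟨ +-monoʳ-≤ (8 * (2 * n)) big ⟩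
  8 * (2 * n) + n                      ≤⟨ ≤-by (2 * n) (lem n) ⟩
  19 * n                               ≤⟨ h ⟩
  40 * (s + 12 * C)                    ≤⟨ *-monoʳ-≤ 40 (+-monoˡ-≤ (12 * C) (≤-trans (m≤n+m∸n s t) (≤-reflexive (+-comm t (s ∸ t))))) ⟩
  40 * (s ∸ t + t + 12 * C)            ≡⟨ lem₂ (s ∸ t) t C ⟩
  8 * (5 * (s ∸ t)) + 40 * (12 * C + t) ∎))
  where
  open ≤-Reasoning
  lem : ∀ n → 8 * (2 * n) + n + 2 * n ≡ 19 * n
  lem = solve-∀
  lem₂ : ∀ x t C → 40 * (x + t + 12 * C) ≡ 8 * (5 * x) + 40 * (12 * C + t)
  lem₂ = solve-∀

-- The recolouring procedure

∑-mono-< : {n : ℕ} {f g : Fin n → ℕ} → (∀ i → f i ≤ g i) → (i : Fin n) → f i < g i → ∑ f < ∑ g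
∑-mono-< {f = f} {g} h i fi<gi = begin-strict
  ∑ f                                                <⟨ m<m+n (∑ f) (≤-trans (m<n⇒0<n∸m fi<gi) (term≤∑ (λ j → g j ∸ f j) i)) ⟩
  ∑ f + ∑ (λ j → g j ∸ f j)                          ≡⟨ sym (∑-distrib-+ f _) ⟩
  ∑ (λ j → f j + (g j ∸ f j))                        ≡⟨ ∑-cong (λ j → m+[n∸m]≡n (h j)) ⟩
  ∑ g ∎
  where
  open ≤-Reasoning

-- `400` is the `100` of `gain-large` times the `4` of `R-compare`; the power is the loss in
-- replacing `n ^ (j * 4)` by `j * 4` factors of falling factorials, each at least `n / 4`.
K₀ : ℕ → ℕ
K₀ j = 400 * 4 ^ (j * 4)

record Large (C j n : ℕ) : Set where
  field
    n>0 : 1 ≤ n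
    classes : 40 * (12 * C + (2 + j * 2)) ≤ n
    degrees : 120 * C ≤ n
    errors₁ : 16 * (K₀ j * K₀ j * (18 * C)) ≤ n
    errors₂ : 4 * (K₀ j * suc (j * 4) * (18 * C)) ≤ n

module FixStep {n : ℕ} (f : Fin n → Bool) (b : Bool) (C j : ℕ) (large : Large C j n)
  (balanced : ∀ ρ → 19 * n ≤ 40 * (size-of f ρ + 12 * C)) where
  open Large large
  open TemplateCount f using (sz; N-template)

  private
    k = 3 + j * 4

  module Step (col : Fin n → Fin n → Bool) (sy : ∀ u v → col u v ≡ col v u) (diag : ∀ v → col v v ≡ template b f v v) where
    open Fix col sy f b diag public

    module At (total : e₀ ≤ 18 * C * n) (local : ∀ v → 2 * d v ≤ n + 24 * C)
      (z : Fin n) (z-bad : 1 ≤ d z) (z-max : ∀ v → d v ≤ d z) where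
      open Vertex z public
      private
        module S = Sequences col
        module S′ = Sequences col′

      S₀≤e₀ : S₀ ≤ e₀
      S₀≤e₀ = ∑-mono (λ a → ≤-trans (*-monoˡ-≤ (d a) (ind≤1 (badᵇ z a))) (≤-reflexive (*-identityˡ (d a))))

      S₀≤d² : S₀ ≤ d z * d z
      S₀≤d² = ≤-trans (∑-mono (λ a → *-monoʳ-≤ (bad z a) (z-max a))) (≤-reflexive (∑-*ʳ (d z) (bad z)))

      -- Both values of `pathsVia` are `H` times one last factor, `P` for fitting and `Q` for
      -- misfitting sequences. With `H` taken out, `gain-large` leaves a surplus of `n² * d z`, and
      -- `errors-small` keeps the error strictly below it.
      R-< : ∀ c → S.R c k z < S′.R c k z
      R-< c = *-cancelˡ-< 100 _ _ (+-cancelʳ-< (H * (n * n * d z)) _ _ (begin-strict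
        100 * S.R c k z + H * (n * n * d z)
          ≤⟨ main ⟩
        100 * S′.R c k z + 400 * (n ^ (j * 4) * err)
          ≤⟨ +-monoʳ-≤ (100 * S′.R c k z) (*-monoʳ-≤ 400 (*-monoˡ-≤ err n^≤)) ⟩
        100 * S′.R c k z + 400 * (4 ^ (j * 4) * H * err)
          ≡⟨ cong (100 * S′.R c k z +_) (lem (4 ^ (j * 4)) H err) ⟩
        100 * S′.R c k z + H * (K₀ j * err)
          <⟨ +-monoʳ-< (100 * S′.R c k z) (*-monoʳ-< H {{>-nonZero H>0}} (errors-small (K₀ j) (suc (j * 4)) (18 * C) n (d z) S₀ e₀ z-bad n>0 total S₀≤e₀ S₀≤d² errors₁ errors₂)) ⟩
        100 * S′.R c k z + H * (n * n * d z) ∎))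
        where
        open ≤-Reasoning
        open Count j c hiding (k)
        J = j * 2
        own = sz o
        opp = sz (not o)
        P = opp ∸ 1 ∸ J
        Q = own ∸ 2 ∸ J
        H = fall (own ∸ 2) J * fall (opp ∸ 1) J
        err = n * S₀ + suc (j * 4) * (d z * e₀)
        x = α σ
        y = α (not σ)
        lem : ∀ g h r → 400 * (g * h * r) ≡ h * (400 * g * r)
        lem = solve-∀
        class : ∀ ρ t → t ≤ 2 + J → 2 * n ≤ 5 * (sz ρ ∸ t)
        class ρ t t≤ = class-large n C (sz ρ) t (balanced ρ) (≤-trans (*-monoʳ-≤ 40 (+-monoʳ-≤ (12 * C) t≤)) classes)
        hP : 2 * n ≤ 5 * P
        hP = ≤-trans (class (not o) (1 + J) (n≤1+n _)) (≤-reflexive (cong (5 *_) (sym (∸-+-assoc opp 1 J))))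
        hQ₀ : 2 * n ≤ 5 * Q
        hQ₀ = ≤-trans (class o (2 + J) ≤-refl) (≤-reflexive (cong (5 *_) (sym (∸-+-assoc own 2 J))))
        own+opp : own + opp ≡ n
        own+opp = size-split f o
        hQ : 5 * Q ≤ 3 * n
        hQ = +-cancelʳ-≤ (2 * n) _ _ (begin
          5 * Q + 2 * n        ≤⟨ +-mono-≤ (*-monoʳ-≤ 5 (≤-trans (m∸n≤m _ J) (m∸n≤m own 2))) (class (not o) 0 z≤n) ⟩
          5 * own + 5 * opp    ≡⟨ sym (*-distribˡ-+ 5 own opp) ⟩
          5 * (own + opp)      ≡⟨ cong (5 *_) own+opp ⟩
          5 * n                ≡⟨ lem₁ n ⟩
          3 * n + 2 * n ∎)
          where
          lem₁ : ∀ n → 5 * n ≡ 3 * n + 2 * n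
          lem₁ = solve-∀
        hA : ∀ s → 2 * n ≤ 5 * A s
        hA s = ≤-trans (class s 1 (s≤s z≤n)) (*-monoʳ-≤ 5 (begin
          sz s ∸ 1                   ≡⟨ cong (_∸ 1) (sym (A-size s)) ⟩
          A s + ind (o == s) ∸ 1     ≤⟨ ∸-monoˡ-≤ 1 (+-monoʳ-≤ (A s) (ind≤1 (o == s))) ⟩
          A s + 1 ∸ 1                ≡⟨ m+n∸n≡m (A s) 1 ⟩
          A s ∎))
        hd : 5 * (x + y) ≤ 3 * n
        hd = *-cancelˡ-≤ 2 (begin
          2 * (5 * (x + y))    ≡⟨ cong (λ m → 2 * (5 * m)) (α-sum σ) ⟩
          2 * (5 * d z)        ≡⟨ lem₁ (d z) ⟩
          5 * (2 * d z)        ≤⟨ *-monoʳ-≤ 5 (local z) ⟩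
          5 * (n + 24 * C)     ≡⟨ lem₂ n C ⟩
          5 * n + 120 * C      ≤⟨ +-monoʳ-≤ (5 * n) degrees ⟩
          5 * n + n            ≡⟨ lem₃ n ⟩
          2 * (3 * n) ∎)
          where
          lem₁ : ∀ m → 2 * (5 * m) ≡ 5 * (2 * m)
          lem₁ = solve-∀
          lem₂ : ∀ n C → 5 * (n + 24 * C) ≡ 5 * n + 120 * C
          lem₂ = solve-∀
          lem₃ : ∀ n → 5 * n + n ≡ 2 * (3 * n)
          lem₃ = solve-∀
        n^≤ : n ^ (j * 4) ≤ 4 ^ (j * 4) * H
        n^≤ = begin
          n ^ (j * 4)                                          ≡⟨ trans (cong (n ^_) 4j) (^-distribˡ-+-* n J J) ⟩
          n ^ J * n ^ J                                        ≤⟨ *-mono-≤ (^-monoˡ-≤ J (quarter Q hQ₀)) (^-monoˡ-≤ J (quarter P hP)) ⟩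
          (4 * Q) ^ J * (4 * P) ^ J                            ≡⟨ cong₂ _*_ (*-^ J 4 Q) (*-^ J 4 P) ⟩
          4 ^ J * Q ^ J * (4 ^ J * P ^ J)                      ≤⟨ *-mono-≤ (*-monoʳ-≤ (4 ^ J) (^≤fall J (own ∸ 2))) (*-monoʳ-≤ (4 ^ J) (^≤fall J (opp ∸ 1))) ⟩
          4 ^ J * fall (own ∸ 2) J * (4 ^ J * fall (opp ∸ 1) J) ≡⟨ lem₁ (4 ^ J) (fall (own ∸ 2) J) (fall (opp ∸ 1) J) ⟩
          4 ^ J * 4 ^ J * H                                    ≡⟨ cong (_* H) (sym (trans (cong (4 ^_) 4j) (^-distribˡ-+-* 4 J J))) ⟩
          4 ^ (j * 4) * H ∎
          where
          4j : j * 4 ≡ J + J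
          4j = *-distribˡ-+ j 2 2
          lem₁ : ∀ p a b → p * a * (p * b) ≡ p * p * (a * b)
          lem₁ = solve-∀
          quarter : ∀ X → 2 * n ≤ 5 * X → n ≤ 4 * X
          quarter X h = *-cancelˡ-≤ 2 (≤-trans h (≤-by (3 * X) (lem₂ X)))
            where
            lem₂ : ∀ X → 5 * X + 3 * X ≡ 2 * (4 * X)
            lem₂ = solve-∀
        H>0 : 0 < H
        H>0 = pos (4 ^ (j * 4)) H (≤-trans (m^n>0 n {{>-nonZero n>0}} (j * 4)) n^≤)
          where
          pos : ∀ g h → 0 < g * h → 0 < h
          pos g zero p = subst (0 <_) (*-zeroʳ g) p
          pos g (suc h) p = z<s
        via-fit : pathsVia σ ≡ H * P
        via-fit = trans (cong₂ _*_ (cong (λ m → fall (own ∸ 2) (j * 2 + ind m)) (≡-cases₃ (λ e o _ → (not e xor (e xor o)) == o) (λ _ _ _ → false) tt e o true))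
            (cong (λ m → fall (opp ∸ 1) (j * 2 + ind m)) (≡-cases₃ (λ e o _ → (not e xor (e xor o)) == not o) (λ _ _ _ → true) tt e o true)))
          (trans (cong₂ _*_ (cong (fall (own ∸ 2)) (+-identityʳ J)) (trans (cong (fall (opp ∸ 1)) (+-comm J 1)) (fall-last J (opp ∸ 1)))) (sym (*-assoc (fall (own ∸ 2) J) _ _)))
        via-misfit : pathsVia (not σ) ≡ H * Q
        via-misfit = trans (cong₂ _*_ (cong (λ m → fall (own ∸ 2) (j * 2 + ind m)) (≡-cases₃ (λ e o _ → (not e xor not (e xor o)) == o) (λ _ _ _ → true) tt e o true))
            (cong (λ m → fall (opp ∸ 1) (j * 2 + ind m)) (≡-cases₃ (λ e o _ → (not e xor not (e xor o)) == not o) (λ _ _ _ → false) tt e o true)))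
          (trans (cong₂ _*_ (trans (cong (fall (own ∸ 2)) (+-comm J 1)) (fall-last J (own ∸ 2))) (cong (fall (opp ∸ 1)) (+-identityʳ J)))
            (lem₁ (fall (own ∸ 2) J) Q (fall (opp ∸ 1) J)))
          where
          lem₁ : ∀ a q b → a * q * b ≡ a * b * q
          lem₁ = solve-∀
        compared : S.R c k z + H * P * (x * A (not σ) + A σ * y) ≤ S′.R c k z + (H * P * (x * y) + H * Q * (y * x)) + 4 * (n ^ (j * 4) * err)
        compared = subst₂ (λ p q → S.R c k z + p * (x * A (not σ) + A σ * y) ≤ S′.R c k z + (p * (x * y) + q * (y * x)) + 4 * (n ^ (j * 4) * err)) via-fit via-misfit R-compare
        main : 100 * S.R c k z + H * (n * n * d z) ≤ 100 * S′.R c k z + 400 * (n ^ (j * 4) * err)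
        main = +-cancelˡ-≤ (H * (100 * ((P + Q) * (x * y)))) _ _ (begin
          H * (100 * ((P + Q) * (x * y))) + (100 * S.R c k z + H * (n * n * d z))
            ≡⟨ lem₁ H (100 * ((P + Q) * (x * y))) (100 * S.R c k z) (n * n * d z) ⟩
          100 * S.R c k z + H * (100 * ((P + Q) * (x * y)) + n * n * d z)
            ≡⟨ cong (λ m → 100 * S.R c k z + H * (100 * ((P + Q) * (x * y)) + n * n * m)) (sym (α-sum σ)) ⟩
          100 * S.R c k z + H * (100 * ((P + Q) * (x * y)) + n * n * (x + y))
            ≤⟨ +-monoʳ-≤ (100 * S.R c k z) (*-monoʳ-≤ H (gain-large n P Q (A σ) (A (not σ)) x y (hA σ) (hA (not σ)) hP hQ hd)) ⟩
          100 * S.R c k z + H * (100 * (P * (x * A (not σ) + A σ * y)))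
            ≡⟨ lem₂ (S.R c k z) H P (x * A (not σ) + A σ * y) ⟩
          100 * (S.R c k z + H * P * (x * A (not σ) + A σ * y))
            ≤⟨ *-monoʳ-≤ 100 compared ⟩
          100 * (S′.R c k z + (H * P * (x * y) + H * Q * (y * x)) + 4 * (n ^ (j * 4) * err))
            ≡⟨ lem₃ (S′.R c k z) H P Q x y (n ^ (j * 4) * err) ⟩
          H * (100 * ((P + Q) * (x * y))) + (100 * S′.R c k z + 400 * (n ^ (j * 4) * err)) ∎)
          where
          lem₁ : ∀ h p r q → h * p + (r + h * q) ≡ r + h * (p + q)
          lem₁ = solve-∀
          lem₂ : ∀ r h p w → 100 * r + h * (100 * (p * w)) ≡ 100 * (r + h * p * w)
          lem₂ = solve-∀
          lem₃ : ∀ r h p q x y w → 100 * (r + (h * p * (x * y) + h * q * (y * x)) + 4 * w) ≡ h * (100 * ((p + q) * (x * y))) + (100 * r + 400 * w)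
          lem₃ = solve-∀

      N-< : ∀ c → S.N c (suc j * 4) < S′.N c (suc j * 4)
      N-< c = begin-strict
        S.N c (suc k)                                        ≡⟨ S.N-split k (s≤s z≤n) even c z ⟩
        S.avoiding c (suc k) z + (S.R c k z + S.Rsum k (not c) k z)   ≡⟨ cong (_+ (S.R c k z + S.Rsum k (not c) k z)) (avoiding-cong col col′ z col′-away (suc k) (s≤s (s≤s z≤n)) c) ⟩
        S′.avoiding c (suc k) z + (S.R c k z + S.Rsum k (not c) k z)  <⟨ +-monoʳ-< (S′.avoiding c (suc k) z) (+-mono-<-≤ (R-< c) (Rsum-mono col col′ k z (λ c → <⇒≤ (R-< c)) k (not c))) ⟩
        S′.avoiding c (suc k) z + (S′.R c k z + S′.Rsum k (not c) k z) ≡⟨ sym (S′.N-split k (s≤s z≤n) even c z) ⟩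
        S′.N c (suc k) ∎
        where
        open ≤-Reasoning
        even : ∀ d → alt (suc k) d ≡ d
        even = alt-*4 (suc j)

      fixed-diag : ∀ v → col′ v v ≡ τ v v
      fixed-diag v with v ≟ᶠ z
      ... | yes _ = refl
      ... | no _ = diag v

      bad-fixed : ∀ v w → ind (col′ v w xor τ v w) ≤ bad v w
      bad-fixed v w with v ≟ᶠ z | w ≟ᶠ z
      ... | yes _ | yes _ = ≤-trans (≤-reflexive (ind-xor-self (τ v w))) z≤n
      ... | yes _ | no _ = ≤-trans (≤-reflexive (ind-xor-self (τ v w))) z≤n
      ... | no _ | yes _ = ≤-trans (≤-reflexive (ind-xor-self (τ v w))) z≤n
      ... | no _ | no _ = ≤-refl

      private
        module Fixed = Fix col′ col′-sym f b fixed-diag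

      d-fixed : ∀ v → Fixed.d v ≤ d v
      d-fixed v = ∑-mono (bad-fixed v)

      d-fixed-z : Fixed.d z ≡ 0
      d-fixed-z = trans (∑-cong (λ w → trans (cong (λ x → ind (x xor τ z w)) (col′-at w)) (ind-xor-self (τ z w)))) (trans (∑-const n 0) (*-zeroʳ n))

      e₀-fixed : Fixed.e₀ < e₀
      e₀-fixed = ∑-mono-< d-fixed z (≤-trans (s≤s (≤-reflexive d-fixed-z)) z-bad)

  T₀ : ℕ
  T₀ = 2 * (fall (sz true) (suc j * 2) * fall (sz false) (suc j * 2))

  -- Correcting a vertex of maximal bad degree strictly increases the count, and it terminates
  -- in the template.
  N-near-template : ∀ E col sy diag → (let open Step col sy diag) →
    e₀ ≤ E → e₀ ≤ 18 * C * n → (∀ v → 2 * d v ≤ n + 24 * C) →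
    ∀ c → Sequences.N col c (suc j * 4) ≤ T₀ × (Sequences.N col c (suc j * 4) ≡ T₀ → e₀ ≡ 0)
  N-near-template E col sy diag e₀≤E total local c = by-max (maximum n>0 d)
    where
    open Step col sy diag
    by-max : (∃ λ z → ∀ v → d v ≤ d z) → Sequences.N col c (suc j * 4) ≤ T₀ × (Sequences.N col c (suc j * 4) ≡ T₀ → e₀ ≡ 0)
    by-max (z , z-max) with 1 ≤? d z
    ... | no d≡0 = ≤-reflexive (trans (N-cong col τ (λ v w _ → same v w) (suc j * 4) (s≤s (s≤s z≤n)) c) (N-template b j c)) , λ _ → none
      where
      dv≡0 : ∀ v → d v ≡ 0
      dv≡0 v = n≤0⇒n≡0 (≤-trans (z-max v) (≤-pred (≰⇒> d≡0)))
      none : e₀ ≡ 0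
      none = trans (∑-cong dv≡0) (trans (∑-const n 0) (*-zeroʳ n))
      same : ∀ v w → col v w ≡ τ v w
      same v w = trans (bad-xor v w) (cong (_xor τ v w) (ind≡0 (badᵇ v w) (n≤0⇒n≡0 (≤-trans (term≤∑ (bad v) w) (≤-reflexive (dv≡0 v))))))
    by-max (z , z-max) | yes z-bad = step E e₀≤E
      where
      open At total local z z-bad z-max
      -- Each correction lowers `e₀`, so its bound `E` makes the recursion structural. A bad vertex
      -- makes the inequality strict, which rules out equality with `T₀`.
      step : ∀ E → e₀ ≤ E → Sequences.N col c (suc j * 4) ≤ T₀ × (Sequences.N col c (suc j * 4) ≡ T₀ → e₀ ≡ 0)
      step zero e₀≤0 with () ← ≤-trans e₀-fixed e₀≤0
      step (suc E) e₀≤E = <⇒≤ N<T₀ , λ N≡T₀ → ⊥-elim (<-irrefl N≡T₀ N<T₀)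
        where
        N<T₀ : Sequences.N col c (suc j * 4) < T₀
        N<T₀ = <-≤-trans (N-< c) (proj₁ (N-near-template E col′ col′-sym fixed-diag (≤-pred (≤-trans e₀-fixed e₀≤E))
          (≤-trans (<⇒≤ e₀-fixed) total) (λ v → ≤-trans (*-monoʳ-≤ 2 (d-fixed v)) (local v)) c))

-- The extremal product

fall≡0 : ∀ a k → a < k → fall a k ≡ 0
fall≡0 zero (suc k) _ = refl
fall≡0 (suc a) (suc k) (s≤s a<k) = trans (cong (suc a *_) (fall≡0 a k a<k)) (*-zeroʳ (suc a))

fall>0 : ∀ a k → k ≤ a → 0 < fall a k
fall>0 a zero _ = z<s
fall>0 (suc a) (suc k) (s≤s k≤a) = *-mono-≤ {1} {suc a} (s≤s z≤n) (fall>0 a k k≤a)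

fall-pascal : ∀ a k → fall (suc a) (suc k) ≡ fall a (suc k) + suc k * fall a k
fall-pascal a k with k ≤? a
... | yes k≤a = begin
  suc a * fall a k                        ≡⟨ cong (λ m → suc m * fall a k) (sym (m∸n+n≡m k≤a)) ⟩
  suc (a ∸ k + k) * fall a k              ≡⟨ lem (a ∸ k) k (fall a k) ⟩
  fall a k * (a ∸ k) + suc k * fall a k   ≡⟨ cong (_+ suc k * fall a k) (sym (fall-last k a)) ⟩
  fall a (suc k) + suc k * fall a k ∎
  where
  open ≡-Reasoning
  lem : ∀ r k x → suc (r + k) * x ≡ x * r + suc k * x
  lem = solve-∀
... | no k≰a = begin
  suc a * fall a k                        ≡⟨ cong (suc a *_) zero-k ⟩
  suc a * 0                               ≡⟨ trans (*-zeroʳ (suc a)) (sym (*-zeroʳ (suc k))) ⟩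
  suc k * 0                               ≡⟨ cong₂ (λ x y → x + suc k * y) (sym (fall≡0 a (suc k) (m<n⇒m<1+n (≰⇒> k≰a)))) (sym zero-k) ⟩
  fall a (suc k) + suc k * fall a k ∎
  where
  open ≡-Reasoning
  zero-k : fall a k ≡ 0
  zero-k = fall≡0 a k (≰⇒> k≰a)

-- This divisibility makes the quotient in `altCycles` exact for the extremal colouring, so that the
-- bound is attained.
k∣fall : ∀ a k → suc k ∣ fall a (suc k)
k∣fall zero k = suc k ∣0
k∣fall (suc a) k = subst (suc k ∣_) (sym (fall-pascal a k)) (∣m∣n⇒∣m+n (k∣fall a k) (m∣m*n (fall a k)))

-- With `x = suc g + y` both products contain `fall x k * fall y k`, and
-- `(x + 1)(y - k) < (x - k)(y + 1)` remains. For `y ≤ k` the left product vanishes, so strictness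
-- is claimed only where it is positive.
fall-balance : ∀ k g y → fall (suc (suc g) + y) (suc k) * fall y (suc k) ≤ fall (suc g + y) (suc k) * fall (suc y) (suc k)
  × (0 < fall (suc (suc g) + y) (suc k) * fall y (suc k) → fall (suc (suc g) + y) (suc k) * fall y (suc k) < fall (suc g + y) (suc k) * fall (suc y) (suc k))
fall-balance k g y with suc k ≤? y
... | no k≮y = ≤-trans (≤-reflexive vanishes) z≤n , λ pos → ⊥-elim (<-irrefl (sym vanishes) pos)
  where
  vanishes : fall (suc (suc g) + y) (suc k) * fall y (suc k) ≡ 0
  vanishes = trans (cong (fall (suc (suc g) + y) (suc k) *_) (fall≡0 y (suc k) (≰⇒> k≮y))) (*-zeroʳ (fall (suc (suc g) + y) (suc k)))
... | yes k<y = <⇒≤ increase , λ _ → increase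
  where
  open ≤-Reasoning
  x = suc g + y
  a = fall x k
  b = fall y k
  ab>0 : 0 < a * b
  ab>0 = *-mono-≤ (fall>0 x k (≤-trans (<⇒≤ k<y) (m≤n+m y (suc g)))) (fall>0 y k (<⇒≤ k<y))
  lem₁ : ∀ x a b r → suc x * a * (b * r) ≡ a * b * (suc x * r)
  lem₁ = solve-∀
  lem₂ : ∀ a b r y → a * b * (r * suc y) ≡ a * r * (suc y * b)
  lem₂ = solve-∀
  key : suc x * (y ∸ k) < (x ∸ k) * suc y
  key with m≤n⇒∃[o]m+o≡n (<⇒≤ k<y)
  ... | r , refl = begin-strict
    suc (suc g + (k + r)) * (k + r ∸ k)      ≡⟨ cong (suc (suc g + (k + r)) *_) (m+n∸m≡n k r) ⟩
    suc (suc g + (k + r)) * r                <⟨ m<m+n _ {k * suc g + suc g} (≤-trans (s≤s z≤n) (m≤n+m (suc g) (k * suc g))) ⟩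
    suc (suc g + (k + r)) * r + (k * suc g + suc g) ≡⟨ lem₃ g k r ⟩
    (suc g + r) * suc (k + r)                ≡⟨ cong (_* suc (k + r)) (sym (trans (cong (_∸ k) (lem₄ g k r)) (m+n∸m≡n k (suc g + r)))) ⟩
    (suc g + (k + r) ∸ k) * suc (k + r) ∎
    where
    lem₃ : ∀ g k r → suc (suc g + (k + r)) * r + (k * suc g + suc g) ≡ (suc g + r) * suc (k + r)
    lem₃ = solve-∀
    lem₄ : ∀ g k r → suc g + (k + r) ≡ k + (suc g + r)
    lem₄ = solve-∀
  increase : fall (suc x) (suc k) * fall y (suc k) < fall x (suc k) * fall (suc y) (suc k)
  increase = begin-strict
    suc x * a * fall y (suc k)           ≡⟨ cong (suc x * a *_) (fall-last k y) ⟩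
    suc x * a * (b * (y ∸ k))            ≡⟨ lem₁ x a b (y ∸ k) ⟩
    a * b * (suc x * (y ∸ k))            <⟨ *-monoʳ-< (a * b) {{>-nonZero ab>0}} key ⟩
    a * b * ((x ∸ k) * suc y)            ≡⟨ lem₂ a b (x ∸ k) y ⟩
    a * (x ∸ k) * (suc y * b)            ≡⟨ cong (_* (suc y * b)) (sym (fall-last k x)) ⟩
    fall x (suc k) * fall (suc y) (suc k) ∎

[2*y]/2 : ∀ y → (y + y) / 2 ≡ y
[2*y]/2 y = trans (cong (_/ 2) (lem y)) (m*n/n≡m y 2)
  where
  lem : ∀ y → y + y ≡ y * 2
  lem = solve-∀

[1+2*y]/2 : ∀ y → suc (y + y) / 2 ≡ y
[1+2*y]/2 y = trans (cong (_/ 2) (lem y)) (trans (+-distrib-/-∣ʳ 1 {y * 2} {2} (n∣m*n y {2})) (m*n/n≡m y 2))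
  where
  lem : ∀ y → suc (y + y) ≡ 1 + y * 2
  lem = solve-∀

optimum : ℕ → ℕ → ℕ
optimum K n = fall ((n + 1) / 2) K * fall (n / 2) K

-- Moving a vertex from the larger to the smaller class increases the product.
falls≤optimum : ∀ k g y → fall (g + y) (suc k) * fall y (suc k) ≤ optimum (suc k) (g + y + y)
  × (0 < optimum (suc k) (g + y + y) → fall (g + y) (suc k) * fall y (suc k) ≡ optimum (suc k) (g + y + y) → y ≡ (g + y + y) / 2)
falls≤optimum k zero y = ≤-reflexive (cong₂ (λ a b → fall a (suc k) * fall b (suc k)) (sym (trans (cong (_/ 2) (+-comm (y + y) 1)) ([1+2*y]/2 y))) (sym ([2*y]/2 y)))
  , λ _ _ → sym ([2*y]/2 y)
falls≤optimum k (suc zero) y = ≤-reflexive (cong₂ (λ a b → fall a (suc k) * fall b (suc k)) (sym (trans (cong (_/ 2) (lem y)) ([2*y]/2 (suc y)))) (sym ([1+2*y]/2 y)))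
  , λ _ _ → sym ([1+2*y]/2 y)
  where
  lem : ∀ y → suc (y + y) + 1 ≡ suc y + suc y
  lem = solve-∀
falls≤optimum k (suc (suc g)) y = ≤-trans (proj₁ (fall-balance k g y)) next
  , λ pos eq → ⊥-elim (<-irrefl eq (<-≤-trans (proj₂ (fall-balance k g y) (subst (0 <_) (sym eq) pos)) next))
  where
  lem : ∀ g y → g + suc y + suc y ≡ suc (suc g) + y + y
  lem = solve-∀
  next : fall (suc g + y) (suc k) * fall (suc y) (suc k) ≤ optimum (suc k) (suc (suc g) + y + y)
  next = subst₂ (λ a m → fall a (suc k) * fall (suc y) (suc k) ≤ optimum (suc k) m) (+-suc g y) (lem g y) (proj₁ (falls≤optimum k g (suc y)))

falls≤optimum′ : ∀ k x y → fall x (suc k) * fall y (suc k) ≤ optimum (suc k) (x + y)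
  × (0 < optimum (suc k) (x + y) → fall x (suc k) * fall y (suc k) ≡ optimum (suc k) (x + y) → x ≡ (x + y) / 2 ⊎ y ≡ (x + y) / 2)
falls≤optimum′ k x y with ≤-total y x
... | inj₁ y≤x with m≤n⇒∃[o]m+o≡n y≤x
...   | g , refl = subst (λ m → fall m (suc k) * fall y (suc k) ≤ optimum (suc k) (m + y)) (+-comm g y) (proj₁ (falls≤optimum k g y))
  , λ pos eq → inj₂ (subst (λ m → 0 < optimum (suc k) (m + y) → fall m (suc k) * fall y (suc k) ≡ optimum (suc k) (m + y) → y ≡ (m + y) / 2) (+-comm g y) (proj₂ (falls≤optimum k g y)) pos eq)
falls≤optimum′ k x y | inj₂ x≤y with m≤n⇒∃[o]m+o≡n x≤y
...   | g , refl = subst₂ (λ p m → p ≤ optimum (suc k) m) (comm g) (total g) (proj₁ (falls≤optimum k g x))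
  , λ pos eq → inj₁ (subst₂ (λ p m → 0 < optimum (suc k) m → p ≡ optimum (suc k) m → x ≡ m / 2) (comm g) (total g) (proj₂ (falls≤optimum k g x)) pos eq)
  where
  comm : ∀ g → fall (g + x) (suc k) * fall x (suc k) ≡ fall x (suc k) * fall (x + g) (suc k)
  comm g = trans (*-comm (fall (g + x) (suc k)) _) (cong (λ m → fall x (suc k) * fall m (suc k)) (+-comm g x))
  total : ∀ g → g + x + x ≡ x + (x + g)
  total g = trans (+-comm (g + x) x) (cong (x +_) (+-comm g x))

even-or-odd : ∀ n → ∃ λ y → n ≡ y + y ⊎ n ≡ suc (y + y)
even-or-odd zero = 0 , inj₁ refl
even-or-odd (suc n) with even-or-odd n
... | y , inj₁ refl = y , inj₂ refl
... | y , inj₂ refl = suc y , inj₁ (cong suc (sym (+-suc y y)))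

halves : ∀ n → ∃ λ h → n / 2 ≡ h × ((n + 1) / 2 ≡ h × n ≡ h + h ⊎ (n + 1) / 2 ≡ suc h × n ≡ suc (h + h))
halves n with even-or-odd n
... | y , inj₁ refl = y , [2*y]/2 y , inj₁ (trans (cong (_/ 2) (+-comm (y + y) 1)) ([1+2*y]/2 y) , refl)
... | y , inj₂ refl = y , [1+2*y]/2 y , inj₂ (trans (cong (_/ 2) (lem y)) ([2*y]/2 (suc y)) , refl)
  where
  lem : ∀ y → suc (y + y) + 1 ≡ suc y + suc y
  lem = solve-∀

half-complement : ∀ n x → x + n / 2 ≡ n → x ≡ (n + 1) / 2
half-complement n x h with halves n
... | y , p , inj₁ (r , s) rewrite p | r = +-cancelʳ-≡ y x y (trans h s)
... | y , p , inj₂ (r , s) rewrite p | r = +-cancelʳ-≡ y x (suc y) (trans h s)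

n≤1+2*half : ∀ n → n ≤ 1 + 2 * (n / 2)
n≤1+2*half n with halves n
... | y , p , inj₁ (_ , s) rewrite p = ≤-trans (≤-reflexive s) (m≤n⇒m≤1+n (+-monoʳ-≤ y (m≤m+n y 0)))
... | y , p , inj₂ (_ , s) rewrite p = ≤-trans (≤-reflexive s) (s≤s (+-monoʳ-≤ y (m≤m+n y 0)))

half≤upper-half : ∀ n → n / 2 ≤ (n + 1) / 2
half≤upper-half n with halves n
... | y , p , inj₁ (r , _) = ≤-reflexive (trans p (sym r))
... | y , p , inj₂ (r , _) = ≤-trans (≤-reflexive p) (≤-trans (n≤1+n y) (≤-reflexive (sym r)))

-- The order of the optimum

bernoulli : ∀ m n a → n ^ suc m ≤ (n ∸ a) ^ suc m + suc m * a * n ^ m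
bernoulli zero n a = begin
  n * 1                          ≡⟨ *-identityʳ n ⟩
  n                              ≤⟨ m≤n+m∸n n a ⟩
  a + (n ∸ a)                    ≡⟨ lem a (n ∸ a) ⟩
  (n ∸ a) * 1 + 1 * a * 1 ∎
  where
  open ≤-Reasoning
  lem : ∀ a b → a + b ≡ b * 1 + 1 * a * 1
  lem = solve-∀
bernoulli (suc m) n a = begin
  n * n ^ suc m                                              ≤⟨ *-monoʳ-≤ n (bernoulli m n a) ⟩
  n * (p + suc m * a * n ^ m)                                ≡⟨ lem n p (suc m * a) (n ^ m) ⟩
  n * p + suc m * a * n ^ suc m                              ≤⟨ +-monoˡ-≤ _ (*-monoˡ-≤ p (m≤n+m∸n n a)) ⟩
  (a + (n ∸ a)) * p + suc m * a * n ^ suc m                  ≡⟨ cong (_+ suc m * a * n ^ suc m) (*-distribʳ-+ p a (n ∸ a)) ⟩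
  a * p + (n ∸ a) * p + suc m * a * n ^ suc m                ≤⟨ +-monoˡ-≤ _ (+-monoˡ-≤ _ (*-monoʳ-≤ a (^-monoˡ-≤ (suc m) (m∸n≤m n a)))) ⟩
  a * n ^ suc m + (n ∸ a) * p + suc m * a * n ^ suc m        ≡⟨ lem₂ (a * n ^ suc m) ((n ∸ a) * p) (suc m) a (n ^ suc m) refl ⟩
  (n ∸ a) * p + suc (suc m) * a * n ^ suc m ∎
  where
  open ≤-Reasoning
  p = (n ∸ a) ^ suc m
  lem : ∀ n p s q → n * (p + s * q) ≡ n * p + s * (n * q)
  lem = solve-∀
  lem₂ : ∀ w q s a r → w ≡ a * r → w + q + s * a * r ≡ q + suc s * a * r
  lem₂ w q s a r refl = lem₃ q s a r
    where
    lem₃ : ∀ q s a r → a * r + q + s * a * r ≡ q + suc s * a * r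
    lem₃ = solve-∀

square-^ : ∀ n k → n ^ (k * 2) ≡ (n * n) ^ k
square-^ n k = trans (cong (n ^_) (*-comm k 2)) (trans (sym (^-*-assoc n 2 k)) (cong (λ m → (n * m) ^ k) (*-identityʳ n)))

-- Twice the coefficient of the error in `bernoulli` for exponent `2K` and shift `1 + 2K`.
slack : ℕ → ℕ
slack K = 2 * (K * 2 * (1 + 2 * K))

-- Each factor of the two falling factorials exceeds `h ∸ K`, where `n ≤ 1 + 2h`; so its double is
-- at least `n ∸ (1 + 2K)`, and `bernoulli` compares the power of this with the power of `n`.
optimum-large : ∀ k n → 2 * n ^ (suc k * 2) ≤ 4 ^ suc k * (2 * optimum (suc k) n) + slack (suc k) * n ^ suc (k * 2)
optimum-large k n = begin
  2 * n ^ (K * 2)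
    ≤⟨ *-monoʳ-≤ 2 (bernoulli (suc (k * 2)) n a) ⟩
  2 * ((n ∸ a) ^ (K * 2) + K * 2 * a * n ^ suc (k * 2))
    ≤⟨ *-monoʳ-≤ 2 (+-monoˡ-≤ (K * 2 * a * n ^ suc (k * 2)) powers) ⟩
  2 * (4 ^ K * optimum K n + K * 2 * a * n ^ suc (k * 2))
    ≡⟨ lem (4 ^ K) (optimum K n) (K * 2 * a) (n ^ suc (k * 2)) ⟩
  4 ^ K * (2 * optimum K n) + slack K * n ^ suc (k * 2) ∎
  where
  open ≤-Reasoning
  K = suc k
  a = 1 + 2 * K
  lem : ∀ f o s p → 2 * (f * o + s * p) ≡ f * (2 * o) + 2 * s * p
  lem = solve-∀
  base : ∀ h → n ≤ 1 + 2 * h → n ∸ a ≤ 2 * (h ∸ K)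
  base h n≤ = ≤-trans (∸-monoˡ-≤ a n≤) (≤-reflexive (sym (*-distribˡ-∸ 2 h K)))
  one : ∀ h → n ≤ 1 + 2 * h → (n ∸ a) ^ K ≤ 2 ^ K * fall h K
  one h n≤ = begin
    (n ∸ a) ^ K             ≤⟨ ^-monoˡ-≤ K (base h n≤) ⟩
    (2 * (h ∸ K)) ^ K       ≡⟨ *-^ K 2 (h ∸ K) ⟩
    2 ^ K * (h ∸ K) ^ K     ≤⟨ *-monoʳ-≤ (2 ^ K) (^≤fall K h) ⟩
    2 ^ K * fall h K ∎
  lem₂ : ∀ p x y → p * x * (p * y) ≡ p * p * (x * y)
  lem₂ = solve-∀
  powers : (n ∸ a) ^ (K * 2) ≤ 4 ^ K * optimum K n
  powers = begin
    (n ∸ a) ^ (K * 2)                                      ≡⟨ trans (square-^ (n ∸ a) K) (*-^ K (n ∸ a) (n ∸ a)) ⟩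
    (n ∸ a) ^ K * (n ∸ a) ^ K                              ≤⟨ *-mono-≤ (one ((n + 1) / 2) (≤-trans (n≤1+2*half n) (s≤s (*-monoʳ-≤ 2 (half≤upper-half n))))) (one (n / 2) (n≤1+2*half n)) ⟩
    2 ^ K * fall ((n + 1) / 2) K * (2 ^ K * fall (n / 2) K) ≡⟨ lem₂ (2 ^ K) (fall ((n + 1) / 2) K) (fall (n / 2) K) ⟩
    2 ^ K * 2 ^ K * optimum K n                            ≡⟨ cong (_* optimum K n) (sym (*-^ K 2 2)) ⟩
    4 ^ K * optimum K n ∎

-- Stability and correction combined

module Upper {n : ℕ} (col : Fin n → Fin n → Bool) (sy : ∀ u v → col u v ≡ col v u) (j : ℕ) where
  open Walks col sy
  open Sequences col

  private
    K = suc j * 2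
    l = j * 2

  C : ℕ
  C = slack K

  N≤closed₄ : ∀ c → N c (suc j * 4) ≤ closed c l
  N≤closed₄ c = subst (λ m → N c (4 + m) ≤ closed c l) (sym (*-distribˡ-+ j 2 2)) (N≤closed col sy c l)

  N-swap₄ : ∀ c → N c (suc j * 4) ≡ N (not c) (suc j * 4)
  N-swap₄ = N-swap (suc j * 4) (s≤s (s≤s z≤n)) (alt-*4 (suc j))

  N-colour : ∀ c c′ → N c (suc j * 4) ≡ N c′ (suc j * 4)
  N-colour true true = refl
  N-colour true false = N-swap₄ true
  N-colour false true = N-swap₄ false
  N-colour false false = refl

  -- `many` and `optimum-large` put the number of closed walks within order `n^(4t-1)` of the
  -- maximum, and `closed-defect` turns this shortfall into a bound on the defect. As `l` is even,
  -- starting colour `not c′` makes the recorded defect that of `c′`.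
  defect-bound : 0 < n → ∀ c → 2 * optimum K n ≤ N c (suc j * 4) →
    ∀ c′ → 2 * ((n * n) * (n * (n * n))) + 16 * defect c′ ≤ 8 * (n * n) * Θ + C * ((n * n) * (n * n))
  defect-bound n>0 c many c′ = *-cancelˡ-≤ p {{m^n≢0 n² l {{m*n≢0 n n {{>-nonZero n>0}} {{>-nonZero n>0}}}}}} (begin
    p * (2 * (n² * (n * n²)) + 16 * defect c′)
      ≡⟨ lem₁ p n² n (defect c′) ⟩
    n * (2 * (n² * (n² * p))) + 4 * (p * (4 * defect c′))
      ≤⟨ +-monoˡ-≤ (4 * (p * (4 * defect c′))) (*-monoʳ-≤ n closed-large) ⟩
    n * (4 * (4 * 4 ^ l) * closed c″ l + C * (n * (n² * p))) + 4 * (p * (4 * defect c′))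
      ≡⟨ lem₂ n (4 ^ l) (closed c″ l) C p (defect c′) ⟩
    4 * (4 ^ l * (4 * n * closed c″ l) + p * (4 * defect c′)) + C * (n² * (n² * p))
      ≤⟨ +-monoˡ-≤ (C * (n² * (n² * p))) (*-monoʳ-≤ 4 (subst (λ x → 4 ^ l * (4 * n * closed c″ l) + p * (4 * defect x) ≤ p * (2 * n² * Θ)) colour-back (closed-defect c″ l))) ⟩
    4 * (p * (2 * n² * Θ)) + C * (n² * (n² * p))
      ≡⟨ lem₃ p n² Θ C ⟩
    p * (8 * n² * Θ + C * (n² * n²)) ∎)
    where
    open ≤-Reasoning
    n² = n * n
    p = n² ^ l
    c″ = not c′
    even : ∀ j c → alt (j * 2) c ≡ c
    even zero c = refl
    even (suc j) c = trans (cong (alt (j * 2)) (not-involutive c)) (even j c)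
    colour-back : alt l (not c″) ≡ c′
    colour-back = trans (even j (not c″)) (not-involutive c′)
    closed-large : 2 * (n² * (n² * p)) ≤ 4 * (4 * 4 ^ l) * closed c″ l + C * (n * (n² * p))
    closed-large = begin
      2 * (n² * (n² * p))
        ≡⟨ cong (2 *_) (sym (square-^ n K)) ⟩
      2 * n ^ (K * 2)
        ≤⟨ optimum-large (suc l) n ⟩
      4 ^ K * (2 * optimum K n) + C * n ^ suc (suc l * 2)
        ≡⟨ cong (λ x → 4 ^ K * (2 * optimum K n) + C * (n * x)) (square-^ n (suc l)) ⟩
      4 ^ K * (2 * optimum K n) + C * (n * (n² * p))
        ≤⟨ +-monoˡ-≤ (C * (n * (n² * p))) (*-monoʳ-≤ (4 ^ K) (≤-trans many (≤-trans (≤-reflexive (N-colour c c″)) (N≤closed₄ c″)))) ⟩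
      4 ^ K * closed c″ l + C * (n * (n² * p)) ∎
    lem₁ : ∀ p q n x → p * (2 * (q * (n * q)) + 16 * x) ≡ n * (2 * (q * (q * p))) + 4 * (p * (4 * x))
    lem₁ = solve-∀
    lem₂ : ∀ n f x C p d → n * (4 * (4 * f) * x + C * (n * (n * n * p))) + 4 * (p * (4 * d)) ≡ 4 * (f * (4 * n * x) + p * (4 * d)) + C * (n * n * (n * n * p))
    lem₂ = solve-∀
    lem₃ : ∀ p q t C → 4 * (p * (2 * q * t)) + C * (q * (q * p)) ≡ p * (8 * q * t + C * (q * q))
    lem₃ = solve-∀

  Extremal : Set
  Extremal = Σ (Fin n → Bool) λ f → Σ Bool λ b →
    (∀ v w → v ≢ w → col v w ≡ template b f v w) × (size-of f true ≡ n / 2 ⊎ size-of f false ≡ n / 2)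

  module _ (large : Large C j n) (big₁ : 12 * C ≤ n) (big₂ : 20 * (20 * (3 * C)) ≤ n) where
    open Large large

    optimum>0 : 0 < optimum K n
    optimum>0 = *-mono-≤ {1} {fall ((n + 1) / 2) K} (fall>0 ((n + 1) / 2) K (≤-trans K≤half (half≤upper-half n))) (fall>0 (n / 2) K K≤half)
      where
      open ≤-Reasoning
      K≤half : K ≤ n / 2
      K≤half = *-cancelˡ-≤ 2 (≤-pred (begin
        1 + 2 * K                  ≤⟨ +-monoˡ-≤ (2 * K) {1} {K} (s≤s z≤n) ⟩
        3 * K                      ≤⟨ *-mono-≤ {3} {40} (s≤s (s≤s (s≤s z≤n))) (m≤n+m K (12 * C)) ⟩
        40 * (12 * C + K)          ≤⟨ classes ⟩
        n                          ≤⟨ n≤1+2*half n ⟩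
        1 + 2 * (n / 2) ∎))

    module _ (near : Stability.NearTemplate col sy C n>0) where
      open Stability.NearTemplate near

      -- The colouring has no say on the diagonal, so let it agree with the template there.
      col° : Fin n → Fin n → Bool
      col° v w = if ⌊ v ≟ᶠ w ⌋ then template cross cls v w else col v w

      col°-diag : ∀ v → col° v v ≡ template cross cls v v
      col°-diag v = cong (λ p → if p then template cross cls v v else col v v) (≟-refl v)

      col°-off : ∀ v w → v ≢ w → col v w ≡ col° v w
      col°-off v w v≢w = sym (cong (λ p → if p then template cross cls v w else col v w) (⌊⌋-false (v ≟ᶠ w) v≢w))

      col°-sym : ∀ v w → col° v w ≡ col° w v
      col°-sym v w with v ≟ᶠ w
      ... | yes refl = sym (col°-diag v)
      ... | no v≢w = trans (sy v w) (col°-off w v (v≢w ∘ sym))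

      open FixStep cls cross C j large balanced using (T₀; N-near-template; module Step)
      open Step col° col°-sym col°-diag using (bad; badᵇ; bad-xor; d; e₀)

      bad°≤ : ∀ v w → bad v w ≤ ind (col v w xor template cross cls v w)
      bad°≤ v w with v ≟ᶠ w
      ... | yes refl = ≤-trans (≤-reflexive (ind-xor-self (template cross cls v v))) z≤n
      ... | no _ = ≤-refl

      sizes : size-of cls true + size-of cls false ≡ n
      sizes = size-split cls true

      T₀≤ : T₀ ≤ 2 * optimum K n
      T₀≤ = *-monoʳ-≤ 2 (subst (λ m → fall (size-of cls true) K * fall (size-of cls false) K ≤ optimum K m) sizes (proj₁ (falls≤optimum′ (suc l) (size-of cls true) (size-of cls false))))

      bound : ∀ c → N c (suc j * 4) ≤ T₀ × (N c (suc j * 4) ≡ T₀ → e₀ ≡ 0)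
      bound c = subst (λ m → m ≤ T₀ × (m ≡ T₀ → e₀ ≡ 0)) (sym (N-cong col col° col°-off (suc j * 4) (s≤s (s≤s z≤n)) c))
        (N-near-template e₀ col° col°-sym col°-diag ≤-refl (≤-trans (∑-mono₂ bad°≤) total) (λ v → ≤-trans (*-monoʳ-≤ 2 (∑-mono (bad°≤ v))) (local v)) c)

      -- `T₀` lies between the count and the optimum, so all three coincide: equality with the count
      -- leaves no bad edge, equality with the optimum balances the classes.
      extremal : ∀ c → N c (suc j * 4) ≡ 2 * optimum K n → Extremal
      extremal c eq = cls , cross , agree , subst (λ m → size-of cls true ≡ m / 2 ⊎ size-of cls false ≡ m / 2) sizes
          (proj₂ (falls≤optimum′ (suc l) (size-of cls true) (size-of cls false)) (subst (λ m → 0 < optimum K m) (sym sizes) optimum>0)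
            (subst (λ m → fall (size-of cls true) K * fall (size-of cls false) K ≡ optimum K m) (sym sizes) (*-cancelˡ-≡ _ _ 2 T₀≡)))
        where
        T₀≡ : T₀ ≡ 2 * optimum K n
        T₀≡ = ≤-antisym T₀≤ (≤-trans (≤-reflexive (sym eq)) (proj₁ (bound c)))
        none : e₀ ≡ 0
        none = proj₂ (bound c) (trans eq (sym T₀≡))
        agree : ∀ v w → v ≢ w → col v w ≡ template cross cls v w
        agree v w v≢w = trans (col°-off v w v≢w) (trans (bad-xor v w) (cong (_xor template cross cls v w)
          (ind≡0 (badᵇ v w) (n≤0⇒n≡0 (≤-trans (term≤∑ (bad v) w) (≤-trans (term≤∑ d v) (≤-reflexive none)))))))

    -- Stability is available once the count reaches the optimum; below the optimum the bound holds
    -- and equality is impossible.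
    upper : ∀ c → N c (suc j * 4) ≤ 2 * optimum K n × (N c (suc j * 4) ≡ 2 * optimum K n → Extremal)
    upper c = [ (λ many → let near = stable many in ≤-trans (proj₁ (bound near c)) (T₀≤ near) , extremal near c)
              , (λ few → <⇒≤ few , λ eq → ⊥-elim (<-irrefl eq few)) ]′ (≤-<-connex (2 * optimum K n) (N c (suc j * 4)))
      where
      stable : 2 * optimum K n ≤ N c (suc j * 4) → Stability.NearTemplate col sy C n>0
      stable many = Stability.stability col sy C n>0 (defect-bound n>0 c many) big₁ big₂

  lower : Extremal → ∀ c → N c (suc j * 4) ≡ 2 * optimum K n
  lower (f , b , agree , half) c = trans (N-cong col (template b f) agree (suc j * 4) (s≤s (s≤s z≤n)) c)
      (trans (TemplateCount.N-template f b j c) (cong (2 *_) (product half)))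
    where
    product : size-of f true ≡ n / 2 ⊎ size-of f false ≡ n / 2 → fall (size-of f true) K * fall (size-of f false) K ≡ optimum K n
    product (inj₁ h) = trans (*-comm (fall (size-of f true) K) _) (cong₂ (λ x y → fall x K * fall y K)
      (half-complement n (size-of f false) (trans (cong (size-of f false +_) (sym h)) (trans (+-comm (size-of f false) _) (size-split f true)))) h)
    product (inj₂ h) = cong₂ (λ x y → fall x K * fall y K) (half-complement n (size-of f true) (trans (cong (size-of f true +_) (sym h)) (size-split f true))) h

-- Cycles and sequences

count : {X : Set} → (X → Bool) → List X → ℕ
count p xs = length (filterᵇ p xs)

count-∷ : {X : Set} (p : X → Bool) (x : X) (xs : List X) → count p (x ∷ xs) ≡ ind (p x) + count p xs
count-∷ p x xs with p x
... | true = refl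
... | false = refl

count-++ : {X : Set} (p : X → Bool) (xs ys : List X) → count p (xs ++ ys) ≡ count p xs + count p ys
count-++ p xs ys = trans (cong length (filter-++ _ xs ys)) (length-++ (filterᵇ p xs))

count-map : {X Y : Set} (p : Y → Bool) (g : X → Y) (xs : List X) → count p (map g xs) ≡ count (p ∘ g) xs
count-map p g [] = refl
count-map p g (x ∷ xs) = trans (count-∷ p (g x) (map g xs)) (trans (cong (ind (p (g x)) +_) (count-map p g xs)) (sym (count-∷ (p ∘ g) x xs)))

count-concatMap : ∀ {n} {X Y : Set} (p : Y → Bool) (g : X → List Y) (h : Fin n → X) → count p (concatMap g (tabulate h)) ≡ ∑ (λ x → count p (g (h x)))
count-concatMap {n = zero} p g h = sym (∑-zero (λ x → count p (g (h x))))
count-concatMap {n = suc n} p g h = trans (count-++ p (g (h zero)) _) (trans (cong (count p (g (h zero)) +_) (count-concatMap p g (h ∘ suc))) (sym (∑-suc (λ x → count p (g (h x))))))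

count-allFin : ∀ {n} {X : Set} (p : X → Bool) (h : Fin n → X) → count p (tabulate h) ≡ ∑ (λ x → ind (p (h x)))
count-allFin {n = zero} p h = sym (∑-zero (λ x → ind (p (h x))))
count-allFin {n = suc n} p h = trans (count-∷ p (h zero) _) (trans (cong (ind (p (h zero)) +_) (count-allFin p (h ∘ suc))) (sym (∑-suc (λ x → ind (p (h x))))))

count-allSeqs : ∀ n m (p : List (Fin n) → Bool) → count p (allSeqs n m) ≡ sumSeq m (ind ∘ p)
count-allSeqs n zero p = trans (count-∷ p [] []) (+-identityʳ _)
count-allSeqs n (suc m) p = trans (count-concatMap p (λ x → map (x ∷_) (allSeqs n m)) (λ x → x))
  (∑-cong (λ x → trans (count-map p (x ∷_) (allSeqs n m)) (count-allSeqs n m (p ∘ (x ∷_)))))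

matches : Bool → List Bool → Bool
matches c [] = true
matches c (d ∷ ds) = (d == c) ∧ matches (not c) ds

and-xor : ∀ d ds e → and (zipWith _xor_ (d ∷ ds) (ds ++ [ e ])) ≡ matches d (d ∷ ds) ∧ (alt (length ds) d xor e)
and-xor d [] e = trans (∧-identityʳ (d xor e)) (cong (_∧ (d xor e)) (sym (lem d)))
  where
  lem : ∀ d → (d == d) ∧ true ≡ true
  lem true = refl
  lem false = refl
and-xor d (d′ ∷ ds) e = trans (cong ((d xor d′) ∧_) (and-xor d′ ds e)) (lem d d′)
  where
  lem : ∀ d d′ → (d xor d′) ∧ (((d′ == d′) ∧ matches (not d′) ds) ∧ (alt (length ds) d′ xor e))
    ≡ ((d == d) ∧ ((d′ == not d) ∧ matches (not (not d)) ds)) ∧ (alt (length ds) (not d) xor e)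
  lem true true = refl
  lem true false = refl
  lem false true = refl
  lem false false = refl

-- An alternating colour list is determined by its first colour, and for even length the closing
-- comparison holds automatically.
alternating-split : ∀ d ds → (∀ c → alt (suc (length ds)) c ≡ c) →
  ind (alternatingᵇ (d ∷ ds)) ≡ ind (matches true (d ∷ ds)) + ind (matches false (d ∷ ds))
alternating-split d ds even = trans (cong ind (trans (and-xor d ds d) (trans (cong (matches d (d ∷ ds) ∧_) closes) (∧-identityʳ _)))) (lem d)
  where
  closes : alt (length ds) d xor d ≡ true
  closes = flip (alt (length ds) d) d (trans (sym (alt-suc (length ds) d)) (even d))
    where
    flip : ∀ x y → not x ≡ y → x xor y ≡ true
    flip true false _ = refl
    flip false true _ = refl
  lem : ∀ d → ind (matches d (d ∷ ds)) ≡ ind (matches true (d ∷ ds)) + ind (matches false (d ∷ ds))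
  lem true = sym (+-identityʳ _)
  lem false = refl

module _ {n : ℕ} (G : RedBlueK n) where
  open Sequences (colour G)

  altPath-matches : ∀ c u s z → altPath c u s z ≡ matches c (zipWith (colour G) (u ∷ s) (s ++ [ z ]))
  altPath-matches c u [] z = sym (∧-identityʳ _)
  altPath-matches c u (w ∷ s) z = cong ((colour G u w == c) ∧_) (altPath-matches (not c) w s z)

  isAlt-split : ∀ s → 1 ≤ length s → (∀ c → alt (length s) c ≡ c) →
    ind (isAltSeqᵇ G s) ≡ ind (valid true s) + ind (valid false s)
  isAlt-split (x ∷ s) _ even with distinctᵇ (x ∷ s)
  ... | false = refl
  ... | true = trans (split (zipWith (colour G) (x ∷ s) (s ++ [ x ])) (edges x s) even)
      (sym (cong₂ (λ p r → ind p + ind r) (altPath-matches true x s x) (altPath-matches false x s x)))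
    where
    edges : ∀ u s → length (zipWith (colour G) (u ∷ s) (s ++ [ x ])) ≡ suc (length s)
    edges u [] = refl
    edges u (w ∷ s) = cong suc (edges w s)
    split : ∀ cs → length cs ≡ suc (length s) → (∀ c → alt (suc (length s)) c ≡ c) →
      ind (alternatingᵇ cs) ≡ ind (matches true cs) + ind (matches false cs)
    split (d ∷ ds) l even = alternating-split d ds (λ c → trans (cong (λ m → alt m c) l) (even c))

  altSeqCount-N : ∀ m → 1 ≤ m → (∀ c → alt m c ≡ c) → altSeqCount G m ≡ N true m + N false m
  altSeqCount-N m 1≤m even = trans (count-allSeqs n m (isAltSeqᵇ G))
    (trans (sumSeq-cong m (λ s l → isAlt-split s (subst (1 ≤_) (sym l) 1≤m) (λ c → trans (cong (λ k → alt k c) l) (even c))))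
      (sumSeq-+ m (λ s → ind (valid true s)) (λ s → ind (valid false s))))

  altCycles-≤ : ∀ m → altCycles G m * (2 * m) ≤ altSeqCount G m
  altCycles-≤ zero = z≤n
  altCycles-≤ (suc m) = m/n*n≤m (altSeqCount G (suc m)) (2 * suc m)

  altCycles-exact : ∀ m r → 1 ≤ m → altSeqCount G m ≡ r * (2 * m) → altCycles G m ≡ r
  altCycles-exact (suc m) r _ h = trans (cong (_/ (2 * suc m)) h) (m*n/n≡m r (2 * suc m))

  N-bound : ∀ l c → 0 < n → 4 ^ (2 + l) * N c (2 * (2 + l)) ≤ 2 * n ^ (2 * (2 + l))
  N-bound l c n>0 = subst₂ (λ t m → 4 ^ t * N c m ≤ 2 * n ^ (2 * t)) (+-comm l 2) (lem l)
    (≤-trans (*-monoʳ-≤ (4 ^ (l + 2)) (N≤closed (colour G) (symmetric G) c l)) (Walks.closed-bound (colour G) (symmetric G) c l n>0))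
    where
    lem : ∀ l → suc (suc (suc (suc (l + l)))) ≡ 2 * (2 + l)
    lem = solve-∀

  altCycles-bound : ∀ t → 2 ≤ t → 0 < n → t * 4 ^ t * altCycles G (2 * t) ≤ n ^ (2 * t)
  altCycles-bound t@(suc (suc l)) (s≤s (s≤s z≤n)) n>0 = *-cancelˡ-≤ 4 (begin
    4 * (t * 4 ^ t * q)                                     ≡⟨ lem t (4 ^ t) q ⟩
    4 ^ t * (q * (2 * (2 * t)))                             ≤⟨ *-monoʳ-≤ (4 ^ t) (altCycles-≤ (2 * t)) ⟩
    4 ^ t * altSeqCount G (2 * t)                           ≡⟨ cong (4 ^ t *_) (altSeqCount-N (2 * t) (s≤s z≤n) (alt-2* t)) ⟩
    4 ^ t * (N true (2 * t) + N false (2 * t))              ≡⟨ *-distribˡ-+ (4 ^ t) (N true (2 * t)) _ ⟩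
    4 ^ t * N true (2 * t) + 4 ^ t * N false (2 * t)        ≤⟨ +-mono-≤ (N-bound l true n>0) (N-bound l false n>0) ⟩
    2 * n ^ (2 * t) + 2 * n ^ (2 * t)                       ≡⟨ lem₂ (n ^ (2 * t)) ⟩
    4 * n ^ (2 * t) ∎)
    where
    open ≤-Reasoning
    q = altCycles G (2 * t)
    lem : ∀ t p q → 4 * (t * p * q) ≡ p * (q * (2 * (2 * t)))
    lem = solve-∀
    lem₂ : ∀ p → 2 * p + 2 * p ≡ 4 * p
    lem₂ = solve-∀

  module Extremality (j : ℕ) where
    open Upper (colour G) (symmetric G) j

    private
      t = suc j
      K = t * 2
      F = optimum K n

    count-N : altSeqCount G (4 * t) ≡ N true (t * 4) + N false (t * 4)
    count-N = trans (cong (altSeqCount G) (*-comm 4 t)) (altSeqCount-N (t * 4) (s≤s z≤n) (alt-*4 t))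

    size≡ : (f : Fin n → Bool) → size f ≡ size-of f true
    size≡ f = trans (count-allFin f (λ x → x)) (∑-cong (λ x → lem (f x)))
      where
      lem : ∀ x → ind x ≡ ind (x == true)
      lem true = refl
      lem false = refl

    size-not : (f : Fin n → Bool) → size-of (not ∘ f) true ≡ size-of f false
    size-not f = ∑-cong (λ x → lem (f x))
      where
      lem : ∀ x → ind (not x == true) ≡ ind (x == false)
      lem true = refl
      lem false = refl

    differ⇔ : ∀ c b x y → c ≡ (b == (x xor y)) → (c ≡ b → x ≢ y) × (x ≢ y → c ≡ b)
    differ⇔ c true true true refl = (λ ()) , λ h → ⊥-elim (h refl)
    differ⇔ c true true false refl = (λ _ ()) , λ _ → refl
    differ⇔ c true false true refl = (λ _ ()) , λ _ → refl
    differ⇔ c true false false refl = (λ ()) , λ h → ⊥-elim (h refl)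
    differ⇔ c false true true refl = (λ ()) , λ h → ⊥-elim (h refl)
    differ⇔ c false true false refl = (λ _ ()) , λ _ → refl
    differ⇔ c false false true refl = (λ _ ()) , λ _ → refl
    differ⇔ c false false false refl = (λ ()) , λ h → ⊥-elim (h refl)

    ⇔template : ∀ c b x y → (c ≡ b → x ≢ y) × (x ≢ y → c ≡ b) → c ≡ (b == (x xor y))
    ⇔template true true true true (h , _) = ⊥-elim (h refl refl)
    ⇔template false true true true _ = refl
    ⇔template c true true false (_ , h) = h (λ ())
    ⇔template c true false true (_ , h) = h (λ ())
    ⇔template true true false false (h , _) = ⊥-elim (h refl refl)
    ⇔template false true false false _ = refl
    ⇔template true false true true _ = refl
    ⇔template false false true true (h , _) = ⊥-elim (h refl refl)
    ⇔template c false true false (_ , h) = h (λ ())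
    ⇔template c false false true (_ , h) = h (λ ())
    ⇔template true false false false _ = refl
    ⇔template false false false false (h , _) = ⊥-elim (h refl refl)

    extremal⇒bipartite : Extremal → Σ Bool λ b → colourClassIsBalancedCompleteBipartite G b
    extremal⇒bipartite (f , b , agree , inj₁ half) = b , f , trans (size≡ f) half , λ v w v≢w → differ⇔ (colour G v w) b (f v) (f w) (agree v w v≢w)
    extremal⇒bipartite (f , b , agree , inj₂ half) = b , not ∘ f , trans (size≡ (not ∘ f)) (trans (size-not f) half) ,
      λ v w v≢w → differ⇔ (colour G v w) b (not (f v)) (not (f w)) (trans (agree v w v≢w) (cong (b ==_) (xor-not (f v) (f w))))
      where
      xor-not : ∀ x y → x xor y ≡ not x xor not y
      xor-not true y = refl
      xor-not false y = sym (not-involutive y)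

    bipartite⇒extremal : (Σ Bool λ b → colourClassIsBalancedCompleteBipartite G b) → Extremal
    bipartite⇒extremal (b , S , half , classes) = S , b , (λ v w v≢w → ⇔template (colour G v w) b (S v) (S w) (classes v w v≢w)) , inj₁ (trans (sym (size≡ S)) half)

    module _ (large : Large C j n) (big₁ : 12 * C ≤ n) (big₂ : 20 * (20 * (3 * C)) ≤ n) where

      private
        q = altCycles G (4 * t)
        above : ∀ c → N c (t * 4) ≤ 2 * F
        above c = proj₁ (upper large big₁ big₂ c)

      lem₁ : ∀ t q → 4 * (2 * t * q) ≡ q * (2 * (4 * t))
      lem₁ = solve-∀
      lem₂ : ∀ F → 2 * F + 2 * F ≡ 4 * F
      lem₂ = solve-∀

      4*cycles≤ : 4 * (2 * t * q) ≤ N true (t * 4) + N false (t * 4)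
      4*cycles≤ = ≤-trans (≤-reflexive (lem₁ t q)) (≤-trans (altCycles-≤ (4 * t)) (≤-reflexive count-N))

      cycles≤ : 2 * t * q ≤ F
      cycles≤ = *-cancelˡ-≤ 4 (≤-trans 4*cycles≤ (≤-trans (+-mono-≤ (above true) (above false)) (≤-reflexive (lem₂ F))))

      cycles≡⇒extremal : 2 * t * q ≡ F → Extremal
      cycles≡⇒extremal eq = proj₂ (upper large big₁ big₂ true) (≤-antisym (above true) (+-cancelʳ-≤ (2 * F) (2 * F) (N true (t * 4)) (begin
        2 * F + 2 * F                    ≡⟨ lem₂ F ⟩
        4 * F                            ≡⟨ cong (4 *_) (sym eq) ⟩
        4 * (2 * t * q)                  ≤⟨ 4*cycles≤ ⟩
        N true (t * 4) + N false (t * 4) ≤⟨ +-monoʳ-≤ (N true (t * 4)) (above false) ⟩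
        N true (t * 4) + 2 * F ∎)))
        where open ≤-Reasoning

    extremal⇒cycles≡ : Extremal → 2 * t * altCycles G (4 * t) ≡ F
    extremal⇒cycles≡ ext = go (∣m⇒∣m*n (fall (n / 2) K) (k∣fall ((n + 1) / 2) (suc (j * 2))))
      where
      go : K ∣ F → 2 * t * altCycles G (4 * t) ≡ F
      go (divides r F≡) = trans (cong (2 * t *_) (altCycles-exact (4 * t) r (s≤s z≤n) exact)) (trans (lem t r) (sym F≡))
        where
        lem : ∀ t r → 2 * t * r ≡ r * (t * 2)
        lem = solve-∀
        lem′ : ∀ t r → 2 * (r * (t * 2)) + 2 * (r * (t * 2)) ≡ r * (2 * (4 * t))
        lem′ = solve-∀
        exact : altSeqCount G (4 * t) ≡ r * (2 * (4 * t))
        exact = trans count-N (trans (cong₂ _+_ (lower ext true) (lower ext false)) (trans (cong (λ x → 2 * x + 2 * x) F≡) (lem′ t r)))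

threshold : ℕ → ℕ
threshold j = 1 + (40 * (12 * C + (2 + j * 2)) + (120 * C + (16 * (K₀ j * K₀ j * (18 * C)) + (4 * (K₀ j * suc (j * 4) * (18 * C))
    + (12 * C + 20 * (20 * (3 * C)))))))
  where
  C = slack (suc j * 2)

theorem1p5 : ((t : ℕ) → 2 ≤ t →
    Σ ℕ λ C → Σ ℕ λ n₀ → (n : ℕ) → n₀ ≤ n → (G : RedBlueK n) →
    t * 4 ^ t * altCycles G (2 * t) ≤ n ^ (2 * t) + C * n ^ (2 * t ∸ 1))
    ×
    ((t : ℕ) → 1 ≤ t →
    Σ ℕ λ n₀ → (n : ℕ) → n₀ ≤ n → (G : RedBlueK n) →
    (2 * t * altCycles G (4 * t) ≤ fall ((n + 1) / 2) (2 * t) * fall (n / 2) (2 * t))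
    × ((2 * t * altCycles G (4 * t) ≡ fall ((n + 1) / 2) (2 * t) * fall (n / 2) (2 * t))
    ⇔ (Σ Bool λ b → colourClassIsBalancedCompleteBipartite G b)))
-- The walk bound carries no error term, hence the constant `0`; `n₀ = 1` because its proof cancels
-- a factor `4 * n`.
theorem1p5 = (λ t 2≤t → 0 , 1 , λ n n>0 G → ≤-trans (altCycles-bound G t 2≤t n>0) (m≤m+n _ _)) , second
  where
  second : (t : ℕ) → 1 ≤ t →
    Σ ℕ λ n₀ → (n : ℕ) → n₀ ≤ n → (G : RedBlueK n) →
    (2 * t * altCycles G (4 * t) ≤ fall ((n + 1) / 2) (2 * t) * fall (n / 2) (2 * t))
    × ((2 * t * altCycles G (4 * t) ≡ fall ((n + 1) / 2) (2 * t) * fall (n / 2) (2 * t))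
    ⇔ (Σ Bool λ b → colourClassIsBalancedCompleteBipartite G b))
  second (suc j) _ = threshold j , λ n n₀≤n G → go n n₀≤n G
    where
    C = slack (suc j * 2)
    go : ∀ n → threshold j ≤ n → (G : RedBlueK n) →
      (2 * suc j * altCycles G (4 * suc j) ≤ optimum (2 * suc j) n)
      × ((2 * suc j * altCycles G (4 * suc j) ≡ optimum (2 * suc j) n)
      ⇔ (Σ Bool λ b → colourClassIsBalancedCompleteBipartite G b))
    go n n₀≤n G = subst (λ K → (2 * suc j * altCycles G (4 * suc j) ≤ optimum K n)
        × ((2 * suc j * altCycles G (4 * suc j) ≡ optimum K n) ⇔ (Σ Bool λ b → colourClassIsBalancedCompleteBipartite G b))) (*-comm (suc j) 2)
      (cycles≤ large big₁ big₂ , mk⇔ (extremal⇒bipartite ∘ cycles≡⇒extremal large big₁ big₂) (extremal⇒cycles≡ ∘ bipartite⇒extremal))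
      where
      open Extremality G j
      peel : ∀ a b → a + b ≤ n → a ≤ n × b ≤ n
      peel a b h = ≤-trans (m≤m+n a b) h , ≤-trans (m≤n+m b a) h
      p₀ = peel 1 _ n₀≤n
      p₁ = peel (40 * (12 * C + (2 + j * 2))) _ (proj₂ p₀)
      p₂ = peel (120 * C) _ (proj₂ p₁)
      p₃ = peel (16 * (K₀ j * K₀ j * (18 * C))) _ (proj₂ p₂)
      p₄ = peel (4 * (K₀ j * suc (j * 4) * (18 * C))) _ (proj₂ p₃)
      p₅ = peel (12 * C) _ (proj₂ p₄)
      large : Large C j n
      large = record { n>0 = proj₁ p₀ ; classes = proj₁ p₁ ; degrees = proj₁ p₂ ; errors₁ = proj₁ p₃ ; errors₂ = proj₁ p₄ }
      big₁ : 12 * C ≤ n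
      big₁ = proj₁ p₅
      big₂ : 20 * (20 * (3 * C)) ≤ n
      big₂ = proj₂ p₅
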